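{- $\mathbf{NL}=\mathbf{1LogCFL}$.
   Context: $\mathbf{1LogCFL}$ is the class of languages logspace-reducible to the following problem: given a directed graph $G=(V,E)$ with edges labeled from $\{push,pop,\epsilon\}$ and vertices $s,t$, decide whether there is a directed path $P$ from $s$ to $t$ such that the concatenation of the edge labels along $P$ is generated by the context-free grammar $S\to S\,S \mid push\ S\ pop \mid \epsilon \mid \emptyset$, where $\emptyset$ denotes the empty string. -}

module Defs where

open import Data.Nat using (ℕ; zero; suc; _+_; _*_; _<?_)
open import Data.Nat.Logarithm using (⌊log₂_⌋)
open import Data.Bool using (Bool; true; false)
open import Data.Fin using (Fin; zero; suc; toℕ; inject₁; fromℕ<)
open import Data.List using (List; []; _∷_; _++_; [_]; length; replicate; concatMap)
open import Data.List.Membership.Propositional using (_∈_)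
open import Data.Vec using (Vec; lookup; _[_]≔_) renaming (replicate to vreplicate)
open import Data.Maybe using (Maybe; just; nothing)
open import Data.Product using (Σ; ∃; _×_; _,_)
open import Data.Empty using (⊥)
open import Relation.Nullary using (yes; no)
open import Relation.Binary.PropositionalEquality using (_≡_)
open import Relation.Binary.Construct.Closure.ReflexiveTransitive using (Star)

Language : Set₁
Language = List Bool → Set

-- Turing-machine infrastructure (read-only two-way input tape with
-- endmarkers, one work tape bounded to s cells)

data InSym : Set where
  lend : InSym
  rend : InSym
  bit  : Bool → InSym

-- symbol under input head position i (0 = left endmarker, |x|+1 = right endmarker)
readIn : List Bool → ℕ → InSym
readIn x zero = lend
readIn [] (suc _) = rend
readIn (b ∷ x) (suc zero) = bit b
readIn (b ∷ x) (suc (suc k)) = readIn x (suc k)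

data Dir : Set where
  left stay right : Dir

move : ∀ {m} → Dir → Fin m → Maybe (Fin m)
move left zero = nothing
move left (suc i) = just (inject₁ i)
move stay i = just i
move {m} right i with suc (toℕ i) <? m
... | yes p = just (fromℕ< p)
... | no _ = nothing

-- configuration on input of length n, with work space s,
-- q states and work alphabet Fin (suc w) (zero = blank)
record Config (q w n s : ℕ) : Set where
  constructor config
  field
    state  : Fin q
    inHead : Fin (2 + n)
    tape   : Vec (Fin (suc w)) s
    wHead  : Fin s
open Config public

record NTM : Set where
  field
    states  : ℕ
    symbols : ℕ
    start   : Fin states
    accept  : Fin states → Bool
    δ       : Fin states → InSym → Fin (suc symbols) →
              List (Fin states × Fin (suc symbols) × Dir × Dir)
open NTM public

NConfig : NTM → List Bool → ℕ → Set
NConfig M x s = Config (states M) (symbols M) (length x) s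

data NStep (M : NTM) (x : List Bool) {s : ℕ} : NConfig M x s → NConfig M x s → Set where
  step : ∀ {c q' a di dw ih' wh'} →
         (q' , a , di , dw) ∈ δ M (state c) (readIn x (toℕ (inHead c))) (lookup (tape c) (wHead c)) →
         move di (inHead c) ≡ just ih' →
         move dw (wHead c) ≡ just wh' →
         NStep M x c (config q' ih' (tape c [ wHead c ]≔ a) wh')

AcceptsInSpace : NTM → List Bool → ℕ → Set
AcceptsInSpace M x zero = ⊥
AcceptsInSpace M x (suc s) =
  Σ (NConfig M x (suc s)) λ c →
    Star (NStep M x) (config (start M) zero (vreplicate (suc s) zero) zero) c ×
    accept M (state c) ≡ true

logSpace : ℕ → ℕ → ℕ
logSpace c n = c * suc ⌊log₂ n ⌋

NL : Language → Set
NL L = Σ NTM λ M → Σ ℕ λ c →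
  ∀ x → (L x → AcceptsInSpace M x (logSpace c (length x))) ×
        (AcceptsInSpace M x (logSpace c (length x)) → L x)

record Transducer : Set where
  field
    states  : ℕ
    symbols : ℕ
    start   : Fin states
    -- nothing = halt; otherwise new state, written symbol, input move,
    -- work move, and optionally one output bit
    δ       : Fin states → InSym → Fin (suc symbols) →
              Maybe (Fin states × Fin (suc symbols) × Dir × Dir × Maybe Bool)

TConfig : Transducer → List Bool → ℕ → Set
TConfig T x s = Config (Transducer.states T) (Transducer.symbols T) (length x) s

emit : Maybe Bool → List Bool
emit nothing = []
emit (just b) = [ b ]

data Run (T : Transducer) (x : List Bool) {s : ℕ} : TConfig T x s → List Bool → Set where
  halt : ∀ {c} →
         Transducer.δ T (state c) (readIn x (toℕ (inHead c))) (lookup (tape c) (wHead c)) ≡ nothing →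
         Run T x c []
  step : ∀ {c q' a di dw o ih' wh' out} →
         Transducer.δ T (state c) (readIn x (toℕ (inHead c))) (lookup (tape c) (wHead c))
           ≡ just (q' , a , di , dw , o) →
         move di (inHead c) ≡ just ih' →
         move dw (wHead c) ≡ just wh' →
         Run T x (config q' ih' (tape c [ wHead c ]≔ a) wh') out →
         Run T x c (emit o ++ out)

ComputesInSpace : Transducer → List Bool → ℕ → List Bool → Set
ComputesInSpace T x zero y = ⊥
ComputesInSpace T x (suc s) y =
  Run T x (config (Transducer.start T) zero (vreplicate (suc s) zero) zero) y

LogspaceComputable : (List Bool → List Bool) → Set
LogspaceComputable f = Σ Transducer λ T → Σ ℕ λ c →
  ∀ x → ComputesInSpace T x (logSpace c (length x)) (f x)

data Label : Set where
  push pop eps : Label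

-- S → S S | push S pop | ε | ∅   (ε is the terminal label, ∅ the empty word)
data Gen : List Label → Set where
  empty : Gen []
  ε-rule : Gen [ eps ]
  cat   : ∀ {u v} → Gen u → Gen v → Gen (u ++ v)
  nest  : ∀ {u} → Gen u → Gen (push ∷ u ++ [ pop ])

record Instance : Set where
  constructor mkInstance
  field
    nV    : ℕ
    src   : Fin nV
    tgt   : Fin nV
    edges : List (Fin nV × Label × Fin nV)

data Walk {n : ℕ} (E : List (Fin n × Label × Fin n)) : Fin n → Fin n → List Label → Set where
  here : ∀ {v} → Walk E v v []
  edge : ∀ {u l v t w} → (u , l , v) ∈ E → Walk E v t w → Walk E u t (l ∷ w)

YesInstance : Instance → Set
YesInstance I = ∃ λ w → Walk (Instance.edges I) (Instance.src I) (Instance.tgt I) w × Gen w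

unary : ℕ → List Bool
unary k = replicate k true ++ [ false ]

labBits : Label → List Bool
labBits push = true ∷ true ∷ []
labBits pop  = true ∷ false ∷ []
labBits eps  = false ∷ true ∷ []

encEdge : ∀ {n} → Fin n × Label × Fin n → List Bool
encEdge (u , l , v) = true ∷ unary (toℕ u) ++ unary (toℕ v) ++ labBits l

encode : Instance → List Bool
encode (mkInstance n s t E) =
  unary n ++ unary (toℕ s) ++ unary (toℕ t) ++ concatMap encEdge E ++ [ false ]

Problem1LogCFL : Language
Problem1LogCFL x = Σ Instance λ I → encode I ≡ x × YesInstance I

OneLogCFL : Language → Set
OneLogCFL L = Σ (List Bool → List Bool) λ f → LogspaceComputable f ×
  (∀ x → (L x → Problem1LogCFL (f x)) × (Problem1LogCFL (f x) → L x))

{-# OPTIONS --safe #-}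
-- From NL to 1LogCFL: a machine with work space s = O(log n) has polynomially many
-- configurations. Numbering them in mixed radix by state, input position, head
-- position and value of the tape, a step changes a number by a few loop counters,
-- so the configuration graph can be printed in logarithmic space; all its edges
-- are labelled ε.
--
-- From 1LogCFL to NL: the path is guessed edge by edge, remembering only the
-- current vertex and the number of unmatched pushes. Pumping nested derivations
-- shows that height n² suffices, so this number fits in logarithmic space too. The
-- instance is never stored: the transducer is rerun for every edge, its output
-- being parsed in one pass.
--
-- Both machines are register programs compiled to Turing machines. Since choices
-- are an explicit list of bits, compilation only has to be shown to simulate
-- terminating runs forwards; determinism gives the converse.

module Submission where

open import Defs
open import Function.Base using (_∘_; id; case_of_)
open import Function.Bundles using (_⇔_; mk⇔)
open import Data.Bool.Base using (Bool; true; false; not; if_then_else_; _∧_)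
open import Data.Nat.Base
  using (ℕ; zero; suc; pred; _+_; _*_; _∸_; _^_; _≤_; _<_; z≤n; s≤s; z<s; s<s; ⌊_/2⌋; _⊔_; >-nonZero)
open import Data.Nat.Properties
open import Data.Nat.Logarithm using (⌊log₂_⌋; ⌊log₂⌊n/2⌋⌋≡⌊log₂n⌋∸1; ⌊log₂⌋-mono-≤)
open import Data.Nat.Induction using (<-wellFounded; <-rec)
open import Induction.WellFounded using (Acc) renaming (acc to wf)
open import Data.Nat.Tactic.RingSolver using (solve-∀)
open import Data.Fin.Base as Fin
  using (Fin; zero; suc; toℕ; fromℕ<; inject₁; _↑ˡ_; _↑ʳ_; join; splitAt; combine; remQuot)
open import Data.Fin.Properties as Finₚ using (toℕ<n; toℕ-fromℕ<; toℕ-injective; toℕ-inject₁)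
open import Data.List.Base as List
  using (List; []; _∷_; [_]; _++_; _ʳ++_; map; length; replicate; concatMap; reverse)
open import Data.List.Properties as Listₚ using (++-assoc; length-map; length-++; length-reverse)
import Data.List.Membership.Propositional as Membership
open Membership using (_∈_)
open import Data.List.Membership.Propositional.Properties
  using (∈-++⁺ˡ; ∈-++⁺ʳ; ∈-++⁻; ∈-map⁺; ∈-map⁻; ∈-concatMap⁺; ∈-concatMap⁻; ∈-allFin)
open import Data.List.Relation.Unary.Any as Any using (here; there)
open import Data.Vec.Base as Vec using (Vec; []; _∷_; lookup; toList; _[_]≔_)
open import Data.Vec.Properties as Vecₚ using (lookup∘update; lookup∘update′)
open import Data.Maybe.Base as Maybe using (Maybe; just; nothing; maybe)
open import Data.Maybe.Properties using (just-injective)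
open import Data.Product.Base using (Σ; ∃; _×_; _,_; proj₁; proj₂)
open import Data.Sum.Base as Sum using (_⊎_; inj₁; inj₂)
open import Data.Unit.Base using (⊤; tt)
open import Data.Empty using (⊥-elim)
open import Relation.Nullary using (¬_; Dec; yes; no)
open import Relation.Binary.Definitions using (tri<; tri≈; tri>)
open import Relation.Binary.PropositionalEquality
  using (_≡_; _≢_; refl; sym; trans; cong; cong₂; subst; subst₂)
open import Relation.Binary.Construct.Closure.ReflexiveTransitive using (Star; ε; _◅_; _◅◅_)

-- Fixing the choice list is what makes forward simulation enough. An accepting run of the compiled
-- machine determines its choices; the register program, which terminates on every choice list, is
-- run on the same ones, and confluence identifies the two final configurations. Exhausted lists
-- read as `false`, which forces the guessing loop to end.
--
-- All space bounds take one form, `(2 + n) ^ E < 2 ^ e`: registers hold numbers below `2 ^ e`,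
-- while constants, the space bound and the number of configurations are absorbed into powers of
-- `2 + n`.
--
-- The output of a transducer is an arbitrary bit string, so a pass must also check its syntax. Its
-- length is below the number of configurations of the transducer; this bounds the size of an
-- encoded instance, and hence its square, by a power of `2 + n`.
--
-- Labelling every edge ε is harmless because every word of ε's is generated: the problem on such
-- graphs is plain reachability.

-- Finite control sets

record Finite (A : Set) : Set where
  field
    card    : ℕ
    enc     : A → Fin card
    dec     : Fin card → A
    dec∘enc : ∀ a → dec (enc a) ≡ a
open Finite using (card; enc; dec∘enc) renaming (dec to decode)

-- Codes are only ever decoded after being encoded, so a one-sided inverse suffices, and a type may
-- be coded inside a larger sum or product.
retract-finite : ∀ {A B : Set} (f : A → B) (g : B → A) → (∀ a → g (f a) ≡ a) → Finite B → Finite A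
retract-finite f g gf fin = record
  { card = card fin ; enc = enc fin ∘ f ; dec = g ∘ decode fin
  ; dec∘enc = λ a → trans (cong g (dec∘enc fin (f a))) (gf a) }

Fin-finite : ∀ n → Finite (Fin n)
Fin-finite n = record { card = n ; enc = id ; dec = id ; dec∘enc = λ _ → refl }

⊤-finite : Finite ⊤
⊤-finite = retract-finite (λ _ → zero) (λ _ → tt) (λ _ → refl) (Fin-finite 1)

⊎-finite : ∀ {A B : Set} → Finite A → Finite B → Finite (A ⊎ B)
⊎-finite a b = record
  { card = card a + card b
  ; enc = λ x → join _ _ (Sum.map (enc a) (enc b) x)
  ; dec = λ i → Sum.map (decode a) (decode b) (splitAt (card a) i)
  ; dec∘enc = λ x → trans (cong (Sum.map (decode a) (decode b))
                             (Finₚ.splitAt-join (card a) (card b) (Sum.map (enc a) (enc b) x))) (lem x) }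
  where
  lem : ∀ x → Sum.map (decode a) (decode b) (Sum.map (enc a) (enc b) x) ≡ x
  lem (inj₁ x) = cong inj₁ (dec∘enc a x)
  lem (inj₂ x) = cong inj₂ (dec∘enc b x)

×-finite : ∀ {A B : Set} → Finite A → Finite B → Finite (A × B)
×-finite a b = record
  { card = card a * card b
  ; enc = λ (x , y) → combine (enc a x) (enc b y)
  ; dec = λ i → let (x , y) = remQuot {card a} (card b) i in decode a x , decode b y
  ; dec∘enc = λ (x , y) →
      trans (cong (λ (u , v) → decode a u , decode b v) (Finₚ.remQuot-combine (enc a x) (enc b y)))
            (cong₂ _,_ (dec∘enc a x) (dec∘enc b y)) }

Bool-finite : Finite Bool
Bool-finite = retract-finite {B = Fin 2} (λ { false → zero ; true → suc zero })
  (λ { zero → false ; (suc _) → true }) (λ { false → refl ; true → refl }) (Fin-finite 2)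

Maybe-finite : ∀ {A : Set} → Finite A → Finite (Maybe A)
Maybe-finite a = retract-finite (maybe inj₂ (inj₁ tt)) (λ { (inj₁ _) → nothing ; (inj₂ x) → just x })
  (λ { nothing → refl ; (just _) → refl }) (⊎-finite ⊤-finite a)

Vec-finite : ∀ {A : Set} → Finite A → ∀ n → Finite (Vec A n)
Vec-finite a zero = retract-finite (λ _ → tt) (λ _ → []) (λ { [] → refl }) ⊤-finite
Vec-finite a (suc n) = retract-finite (λ { (x ∷ v) → x , v }) (λ { (x , v) → x ∷ v })
  (λ { (_ ∷ _) → refl }) (×-finite a (Vec-finite a n))

Dir-finite : Finite Dir
Dir-finite = retract-finite {B = Fin 3}
  (λ { left → zero ; stay → suc zero ; right → suc (suc zero) })
  (λ { zero → left ; (suc zero) → stay ; (suc (suc _)) → right })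
  (λ { left → refl ; stay → refl ; right → refl }) (Fin-finite 3)

InSym-finite : Finite InSym
InSym-finite = retract-finite {B = Maybe (Maybe Bool)}
  (λ { lend → nothing ; rend → just nothing ; (bit b) → just (just b) })
  (λ { nothing → lend ; (just nothing) → rend ; (just (just b)) → bit b })
  (λ { lend → refl ; rend → refl ; (bit _) → refl }) (Maybe-finite (Maybe-finite Bool-finite))

-- Machines with explicit choices

-- A branching step consumes one bit of a choice list, so that a machine is
-- deterministic once its choices are fixed.

data Act (A : Set) : Set where
  halted : Act A
  det    : A → Act A
  branch : (Bool → A) → Act A

mapAct : ∀ {A B : Set} → (A → B) → Act A → Act B
mapAct f halted = halted
mapAct f (det a) = det (f a)
mapAct f (branch g) = branch (λ b → f (g b))

Trans : Set → Set → Set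
Trans Q C = Q × C × Dir × Dir × Maybe Bool

record Machine : Set where
  field
    nQ    : ℕ
    nS    : ℕ
    start : Fin nQ
    δ     : Fin nQ → InSym → Fin (suc nS) → Act (Trans (Fin nQ) (Fin (suc nS)))

-- the choice list is implicitly followed by infinitely many false
headω : List Bool → Bool
headω [] = false
headω (b ∷ _) = b

tailω : List Bool → List Bool
tailω [] = []
tailω (_ ∷ ω) = ω

silent : ∀ {Q C : Set} → Trans Q C → Q × C × Dir × Dir
silent (q , c , di , dw , _) = q , c , di , dw

ntmActs : ∀ {Q C : Set} → Act (Trans Q C) → List (Q × C × Dir × Dir)
ntmActs halted = []
ntmActs (det t) = [ silent t ]
ntmActs (branch f) = silent (f false) ∷ silent (f true) ∷ []

-- A branch is resolved as `false`, the value that `headω` gives on the empty list, so transducer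
-- runs are the runs without choices.
trAct : ∀ {Q C : Set} → Act (Trans Q C) → Maybe (Trans Q C)
trAct halted = nothing
trAct (det t) = just t
trAct (branch f) = just (f false)

toNTM : (M : Machine) → (Fin (Machine.nQ M) → Bool) → NTM
toNTM M acc = record { states = nQ ; symbols = nS ; start = Machine.start M ; accept = acc
                     ; δ = λ q i a → ntmActs (Machine.δ M q i a) }
  where open Machine M using (nQ; nS)

toTransducer : Machine → Transducer
toTransducer M = record { states = nQ ; symbols = nS ; start = Machine.start M
                            ; δ = λ q i a → trAct (Machine.δ M q i a) }
  where open Machine M using (nQ; nS)

module Steps (M : Machine) (x : List Bool) {s : ℕ} where
  open Machine M using (nQ; nS)

  Conf : Set
  Conf = Config nQ nS (length x) s

  -- configuration, choices not yet used, output still to be produced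
  Snap : Set
  Snap = Conf × List Bool × List Bool

  δAt : Conf → Act (Trans (Fin nQ) (Fin (suc nS)))
  δAt c = Machine.δ M (state c) (readIn x (toℕ (inHead c))) (lookup (tape c) (wHead c))

  data Fires : Conf → List Bool → Trans (Fin nQ) (Fin (suc nS)) → List Bool → Set where
    fdet : ∀ {c ω t} → δAt c ≡ det t → Fires c ω t ω
    fbr  : ∀ {c ω f t} → δAt c ≡ branch f → f (headω ω) ≡ t → Fires c ω t (tailω ω)

  data _⟶_ : Snap → Snap → Set where
    fire : ∀ {c ω ω' y q' a di dw o ih' wh'} →
           Fires c ω (q' , a , di , dw , o) ω' →
           move di (inHead c) ≡ just ih' →
           move dw (wHead c) ≡ just wh' →
           (c , ω , emit o ++ y) ⟶ (config q' ih' (tape c [ wHead c ]≔ a) wh' , ω' , y)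

  _⟶*_ : Snap → Snap → Set
  _⟶*_ = Star _⟶_

  toRun : ∀ {c y σ} → (c , [] , y) ⟶* σ → proj₂ (proj₂ σ) ≡ [] → δAt (proj₁ σ) ≡ halted →
          Run (toTransducer M) x c y
  toRun ε refl h = halt (cong trAct h)
  toRun (fire (fdet e) mi mw ◅ r) z h = step (cong trAct e) mi mw (toRun r z h)
  toRun (fire (fbr e e') mi mw ◅ r) z h = step (trans (cong trAct e) (cong just e')) mi mw (toRun r z h)

  module _ (acc : Fin nQ → Bool) where
    private N = toNTM M acc

    member : ∀ {c ω t ω'} → Fires c ω t ω' → silent t ∈ ntmActs (δAt c)
    member {c} (fdet e) = subst (λ A → _ ∈ ntmActs A) (sym e) (here refl)
    member {c} {ω} (fbr {f = f} e refl) with headω ω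
    ... | false = subst (λ A → silent (f false) ∈ ntmActs A) (sym e) (here refl)
    ... | true  = subst (λ A → silent (f true) ∈ ntmActs A) (sym e) (there (here refl))

    toStar : ∀ {σ τ} → σ ⟶* τ → Star (NStep N x) (proj₁ σ) (proj₁ τ)
    toStar ε = ε
    toStar (fire f mi mw ◅ r) = step (member f) mi mw ◅ toStar r

    unmember : ∀ {c u} → u ∈ ntmActs (δAt c) → ∀ ω →
               ∃ λ ω' → ∃ λ t → silent t ≡ u × Fires c ω' t ω
    unmember {c} m ω with δAt c in eq
    unmember (here refl) ω | det t = ω , t , refl , fdet eq
    unmember (here refl) ω | branch f = false ∷ ω , f false , refl , fbr eq refl
    unmember (there (here refl)) ω | branch f = true ∷ ω , f true , refl , fbr eq refl

    -- Choices and output are rebuilt from the end of the run: both lists are empty at the last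
    -- configuration, and a branching step prepends the bit that selects it.
    fromStar : ∀ {c a} → Star (NStep N x) c a → ∃ λ ω → ∃ λ y → (c , ω , y) ⟶* (a , [] , [])
    fromStar ε = [] , [] , ε
    fromStar (step m mi mw ◅ r) =
      let ω , y , r' = fromStar r
          ω' , (q' , a , di , dw , o) , e , f = unmember m ω
      in go e f mi mw r'
      where
      go : ∀ {c ω ω' y z q' a di dw o q₁ a₁ di₁ dw₁ ih' wh'} →
           (q' , a , di , dw) ≡ (q₁ , a₁ , di₁ , dw₁) →
           Fires c ω' (q' , a , di , dw , o) ω → move di₁ (inHead c) ≡ just ih' →
           move dw₁ (wHead c) ≡ just wh' →
           (config q₁ ih' (tape c [ wHead c ]≔ a₁) wh' , ω , y) ⟶* z →
           ∃ λ ω → ∃ λ y → (c , ω , y) ⟶* z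
      go refl f mi mw r = _ , _ , fire f mi mw ◅ r

  fires-det : ∀ {c ω t ω' t₁ ω₁} → Fires c ω t ω' → Fires c ω t₁ ω₁ → t ≡ t₁ × ω' ≡ ω₁
  fires-det (fdet e) (fdet e') with trans (sym e) e'
  ... | refl = refl , refl
  fires-det (fbr e refl) (fbr e' refl) with trans (sym e) e'
  ... | refl = refl , refl
  fires-det (fdet e) (fbr e' _) with trans (sym e) e'
  ... | ()
  fires-det (fbr e _) (fdet e') with trans (sym e) e'
  ... | ()

  no-fire : ∀ {c ω t ω'} → δAt c ≡ halted → ¬ Fires c ω t ω'
  no-fire h (fdet e) with trans (sym h) e
  ... | ()
  no-fire h (fbr e _) with trans (sym h) e
  ... | ()

  -- The outputs may differ, since output never influences a step. The shared choices fix every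
  -- transition, and halting excludes that one run is a proper prefix of the other.
  confluent : ∀ {c ω y y₁ τ τ₁} → (c , ω , y) ⟶* τ → (c , ω , y₁) ⟶* τ₁ →
              δAt (proj₁ τ) ≡ halted → δAt (proj₁ τ₁) ≡ halted → proj₁ τ ≡ proj₁ τ₁
  confluent ε ε h h₁ = refl
  confluent ε (fire f _ _ ◅ _) h h₁ = ⊥-elim (no-fire h f)
  confluent (fire f _ _ ◅ _) ε h h₁ = ⊥-elim (no-fire h₁ f)
  confluent (fire f mi mw ◅ r) (fire f₁ mi₁ mw₁ ◅ r₁) h h₁ with fires-det f f₁
  ... | refl , refl with just-injective (trans (sym mi) mi₁) | just-injective (trans (sym mw) mw₁)
  ... | refl | refl = confluent r r₁ h h₁

-- Tape contents and head moves

-- Stated for a decoding `f` because it serves twice: with the symbol decoding of the compiled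
-- machine, and with the identity for the simulated transducer.
map-toList-split : ∀ {A B : Set} (f : A → B) {s} (t : Vec A s) (h : Fin s) (pre : List B) {b rs} →
  toℕ h ≡ length pre → map f (toList t) ≡ pre ++ b ∷ rs →
  f (lookup t h) ≡ b × (∀ a → map f (toList (t [ h ]≔ a)) ≡ pre ++ f a ∷ rs)
map-toList-split f (a ∷ t) zero [] p e =
  Listₚ.∷-injectiveˡ e , λ a' → cong (f a' ∷_) (Listₚ.∷-injectiveʳ e)
map-toList-split f (a ∷ t) (suc h) (c ∷ pre) p e =
  let e₁ , e₂ = map-toList-split f t h pre (suc-injective p) (Listₚ.∷-injectiveʳ e)
  in e₁ , λ a' → cong₂ _∷_ (Listₚ.∷-injectiveˡ e) (e₂ a')

move-right : ∀ {m} (i : Fin m) → suc (toℕ i) < m → ∃ λ j → move right i ≡ just j × toℕ j ≡ suc (toℕ i)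
move-right {m} i lt with suc (toℕ i) <? m
... | yes p = fromℕ< p , refl , toℕ-fromℕ< p
... | no ¬p = ⊥-elim (¬p lt)

move-left : ∀ {m} (i : Fin m) {k} → toℕ i ≡ suc k → ∃ λ j → move left i ≡ just j × toℕ j ≡ k
move-left (suc i) e = inject₁ i , refl , trans (toℕ-inject₁ i) (suc-injective e)

-- The total form of `move`: a step off either end leaves the head in place, so input moves can
-- never block a program.
clamp : ∀ {m} → Dir → Fin m → Fin m
clamp d i = maybe id i (move d i)

readIn-lend : ∀ x (i : Fin (2 + length x)) → toℕ i ≢ 0 → readIn x (toℕ i) ≢ lend
readIn-lend x zero nz = λ _ → nz refl
readIn-lend x (suc i) nz = go x (toℕ i)
  where
  go : ∀ x k → readIn x (suc k) ≢ lend
  go [] k ()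
  go (b ∷ x) zero ()
  go (b ∷ x) (suc k) = go x k

readIn-rend : ∀ x k → k ≤ length x → readIn x k ≢ rend
readIn-rend x zero _ ()
readIn-rend (b ∷ x) (suc zero) _ ()
readIn-rend (b ∷ x) (suc (suc k)) (s≤s p) = readIn-rend x (suc k) p

readIn-last : ∀ x → readIn x (suc (length x)) ≡ rend
readIn-last [] = refl
readIn-last (b ∷ []) = refl
readIn-last (b ∷ c ∷ x) = readIn-last (c ∷ x)

clampDir : Dir → InSym → Dir
clampDir left lend = stay
clampDir right rend = stay
clampDir d _ = d

-- The symbol read reveals the ends: `lend` occurs only at position 0 and `rend` only at the last
-- one. So the finite control can clamp without knowing the position.
move-clampDir : ∀ x d (i : Fin (2 + length x)) →
                move (clampDir d (readIn x (toℕ i))) i ≡ just (clamp d i)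
move-clampDir x stay i with readIn x (toℕ i)
... | lend = refl
... | rend = refl
... | bit _ = refl
move-clampDir x left zero = refl
move-clampDir x left (suc i) with readIn x (suc (toℕ i)) in eq
... | lend = ⊥-elim (readIn-lend x (suc i) (λ ()) eq)
... | rend = refl
... | bit _ = refl
move-clampDir x right i = go (suc (toℕ i) <? 2 + length x)
  where
  inner : ∀ a → a ≢ rend → clampDir right a ≡ right
  inner lend _ = refl
  inner rend ne = ⊥-elim (ne refl)
  inner (bit _) _ = refl
  inside : ∀ {m} (i : Fin m) → suc (toℕ i) < m → move right i ≡ just (clamp right i)
  inside i p with move right i | move-right i p
  ... | just _ | _ = refl
  ... | nothing | _ , () , _
  outside : ∀ {m} (i : Fin m) → ¬ (suc (toℕ i) < m) → clamp right i ≡ i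
  outside {m} i ¬p with suc (toℕ i) <? m
  ... | yes p = ⊥-elim (¬p p)
  ... | no _ = refl
  go : Dec (suc (toℕ i) < 2 + length x) →
       move (clampDir right (readIn x (toℕ i))) i ≡ just (clamp right i)
  go (yes p) = trans (cong (λ d → move d i) (inner (readIn x (toℕ i)) (readIn-rend x (toℕ i) (≤-pred (≤-pred p)))))
                    (inside i p)
  go (no ¬p) = trans (cong (λ a → move (clampDir right a) i) (trans (cong (readIn x) last) (readIn-last x)))
                     (cong just (sym (outside i ¬p)))
    where
    last : toℕ i ≡ suc (length x)
    last = ≤-antisym (≤-pred (toℕ<n i)) (≤-pred (≮⇒≥ ¬p))

-- Sweep programs and their compilation

-- Programs over a finite control memory F and a tape of cells; a sweep walks
-- from the left end until its function answers with a new control value.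

data Prog (F C : Set) : Set where
  sweep  : (F → C → C × Maybe F) → Prog F C
  act    : (F → InSym → F × Dir × Maybe Bool) → Prog F C
  choose : (Bool → F → F) → Prog F C
  seq    : Prog F C → Prog F C → Prog F C
  cond   : (F → Bool) → Prog F C → Prog F C → Prog F C
  while  : (F → Bool) → Prog F C → Prog F C

data Sweep {F C : Set} (f : F → C → C × Maybe F) (m : F) : List C → List C → F → Set where
  stop : ∀ {c c' cs m'} → f m c ≡ (c' , just m') → Sweep f m (c ∷ cs) (c' ∷ cs) m'
  next : ∀ {c c' cs cs' m'} → f m c ≡ (c' , nothing) → Sweep f m cs cs' m' →
         Sweep f m (c ∷ cs) (c' ∷ cs') m'

module Exec₁ {F C : Set} (x : List Bool) where

  record S₁ : Set where
    constructor st₁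
    field
      ctl   : F
      cells : List C
      pos   : Fin (2 + length x)
      choices out : List Bool

  data Exec : Prog F C → S₁ → S₁ → Set where
    sweep : ∀ {f m m' cs cs' i ω y} → Sweep f m cs cs' m' →
            Exec (sweep f) (st₁ m cs i ω y) (st₁ m' cs' i ω y)
    act   : ∀ {g m m' d o cs i ω y} → g m (readIn x (toℕ i)) ≡ (m' , d , o) →
            Exec (act g) (st₁ m cs i ω (emit o ++ y)) (st₁ m' cs (clamp d i) ω y)
    choose : ∀ {g m cs i ω y} →
             Exec (choose g) (st₁ m cs i ω y) (st₁ (g (headω ω) m) cs i (tailω ω) y)
    seq   : ∀ {p q σ τ υ} → Exec p σ τ → Exec q τ υ → Exec (seq p q) σ υ
    cond-true  : ∀ {b p q σ τ} → b (S₁.ctl σ) ≡ true → Exec p σ τ → Exec (cond b p q) σ τ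
    cond-false : ∀ {b p q σ τ} → b (S₁.ctl σ) ≡ false → Exec q σ τ → Exec (cond b p q) σ τ
    while-stop : ∀ {b p σ} → b (S₁.ctl σ) ≡ false → Exec (while b p) σ σ
    while-go   : ∀ {b p σ τ υ} → b (S₁.ctl σ) ≡ true → Exec p σ τ → Exec (while b p) τ υ →
                 Exec (while b p) σ υ

module Compile {F C : Set} where

  -- For `sweep`, `true` means walking right and `false` returning. In `cond` and `while`, `nothing`
  -- is the state that evaluates the test.
  St : Prog F C → Set
  St (sweep f) = Bool
  St (act g) = ⊤
  St (choose g) = ⊤
  St (seq p q) = St p ⊎ St q
  St (cond b p q) = Maybe (St p ⊎ St q)
  St (while b p) = Maybe (St p)

  St-finite : ∀ p → Finite (St p)
  St-finite (sweep f) = Bool-finite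
  St-finite (act g) = ⊤-finite
  St-finite (choose g) = ⊤-finite
  St-finite (seq p q) = ⊎-finite (St-finite p) (St-finite q)
  St-finite (cond b p q) = Maybe-finite (⊎-finite (St-finite p) (St-finite q))
  St-finite (while b p) = Maybe-finite (St-finite p)

  entry : ∀ p → St p
  entry (sweep f) = true
  entry (act g) = tt
  entry (choose g) = tt
  entry (seq p q) = inj₁ (entry p)
  entry (cond b p q) = nothing
  entry (while b p) = nothing

  -- A successor `nothing` is the exit of the fragment; where it leads is decided by the program in
  -- which the fragment is embedded.
  Out : Set → Set
  Out S = Maybe S × F × C × Dir × Dir × Maybe Bool

  retarget : ∀ {S T : Set} → (Maybe S → Maybe T) → Act (Out S) → Act (Out T)
  retarget κ = mapAct (λ o → κ (proj₁ o) , proj₂ o)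

  seqˡ : ∀ p q → Maybe (St p) → Maybe (St (seq p q))
  seqˡ p q nothing = just (inj₂ (entry q))
  seqˡ p q (just s) = just (inj₁ s)

  seqʳ : ∀ p q → Maybe (St q) → Maybe (St (seq p q))
  seqʳ p q = Maybe.map inj₂

  condˡ : ∀ {S T : Set} → Maybe S → Maybe (Maybe (S ⊎ T))
  condˡ = Maybe.map (just ∘ inj₁)

  condʳ : ∀ {S T : Set} → Maybe T → Maybe (Maybe (S ⊎ T))
  condʳ = Maybe.map (just ∘ inj₂)

  sweepOut : F → C × Maybe F → Out Bool
  sweepOut m (c' , nothing) = just true , m , c' , stay , right , nothing
  sweepOut m (c' , just m') = just false , m' , c' , stay , stay , nothing

  actOut : C → InSym → F × Dir × Maybe Bool → Out ⊤
  actOut c a (m' , d , o) = nothing , m' , c , clampDir d a , stay , o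

  -- the Bool argument marks the leftmost cell
  trans₁ : ∀ p → St p → F → InSym → Bool → C → Act (Out (St p))
  trans₁ (sweep f) true m a k c = det (sweepOut m (f m c))
  trans₁ (sweep f) false m a true c = det (nothing , m , c , stay , stay , nothing)
  trans₁ (sweep f) false m a false c = det (just false , m , c , stay , left , nothing)
  trans₁ (act g) _ m a k c = det (actOut c a (g m a))
  trans₁ (choose g) _ m a k c = branch (λ b → nothing , g b m , c , stay , stay , nothing)
  trans₁ (seq p q) (inj₁ s) m a k c = retarget (seqˡ p q) (trans₁ p s m a k c)
  trans₁ (seq p q) (inj₂ s) m a k c = retarget (seqʳ p q) (trans₁ q s m a k c)
  trans₁ (cond b p q) nothing m a k c =
    det (just (just (if b m then inj₁ (entry p) else inj₂ (entry q))) , m , c , stay , stay , nothing)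
  trans₁ (cond b p q) (just (inj₁ s)) m a k c = retarget condˡ (trans₁ p s m a k c)
  trans₁ (cond b p q) (just (inj₂ s)) m a k c = retarget condʳ (trans₁ q s m a k c)
  trans₁ (while b p) nothing m a k c =
    det ((if b m then just (just (entry p)) else nothing) , m , c , stay , stay , nothing)
  trans₁ (while b p) (just s) m a k c = retarget just (trans₁ p s m a k c)

  retarget-∘ : ∀ {S T U : Set} (κ : Maybe T → Maybe U) (ι : Maybe S → Maybe T) a →
               retarget κ (retarget ι a) ≡ retarget (κ ∘ ι) a
  retarget-∘ κ ι halted = refl
  retarget-∘ κ ι (det _) = refl
  retarget-∘ κ ι (branch _) = refl

  module Whole (finF : Finite F) (finC : Finite C) (blank : C) (top : Prog F C) (m₀ : F) where

    -- The state `nothing` is initial, and its only step marks the leftmost cell;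
    -- `just (nothing , m)` is halted with final control `m`. The `Bool` of a symbol is the mark.
    Q Sym : Set
    Q = Maybe (Maybe (St top) × F)
    Sym = Bool × C

    finQ : Finite Q
    finQ = Maybe-finite (×-finite (Maybe-finite (St-finite top)) finF)

    finS : Finite Sym
    finS = ×-finite Bool-finite finC

    -- Symbol 0 fills the fresh tape and is never written: encoded symbols are shifted by one.
    decS : Fin (suc (card finS)) → Sym
    decS zero = false , blank
    decS (suc i) = decode finS i

    encT : Trans Q Sym → Trans (Fin (card finQ)) (Fin (suc (card finS)))
    encT (q , a , r) = enc finQ q , suc (enc finS a) , r

    fromOut : Bool → Out (St top) → Trans Q Sym
    fromOut k (s , m , c , r) = just (s , m) , (k , c) , r

    δQ : Q → InSym → Sym → Act (Trans Q Sym)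
    δQ nothing a (k , c) = det (just (just (entry top) , m₀) , (true , c) , stay , stay , nothing)
    δQ (just (nothing , m)) a (k , c) = halted
    δQ (just (just s , m)) a (k , c) = mapAct (fromOut k) (trans₁ top s m a k c)

    machine : Machine
    machine = record
      { nQ = card finQ ; nS = card finS ; start = enc finQ nothing
      ; δ = λ q a c → mapAct encT (δQ (decode finQ q) a (decS c)) }

    module _ (x : List Bool) {e : ℕ} where
      open Exec₁ {F} {C} x
      open Steps machine x {suc e}

      record At (c : Conf) (q : Q) (i : Fin (2 + length x)) (ls rs : List Sym) : Set where
        constructor at
        field
          state≡ : decode finQ (state c) ≡ q
          pos≡   : inHead c ≡ i
          head≡  : toℕ (wHead c) ≡ length ls
          cells≡ : map decS (toList (tape c)) ≡ ls ʳ++ rs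

      data Shift : Dir → List Sym → Sym → List Sym → List Sym → List Sym → Set where
        sh-stay  : ∀ {ls a rs} → Shift stay ls a rs ls (a ∷ rs)
        sh-right : ∀ {ls a b rs} → Shift right ls a (b ∷ rs) (a ∷ ls) (b ∷ rs)
        sh-left  : ∀ {b ls a rs} → Shift left (b ∷ ls) a rs ls (b ∷ a ∷ rs)

      data StepsTo (q : Q) (i : Fin (2 + length x)) (a : Sym) (ω : List Bool) :
                   Trans Q Sym → List Bool → Set where
        sdet : ∀ {t} → δQ q (readIn x (toℕ i)) a ≡ det t → StepsTo q i a ω t ω
        sbr  : ∀ {f t} → δQ q (readIn x (toℕ i)) a ≡ branch f → f (headω ω) ≡ t →
               StepsTo q i a ω t (tailω ω)

      at-split : ∀ {c q i ls a rs} → At c q i ls (a ∷ rs) →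
        decS (lookup (tape c) (wHead c)) ≡ a ×
        (∀ v → map decS (toList (tape c [ wHead c ]≔ v)) ≡ ls ʳ++ decS v ∷ rs)
      at-split {c} {ls = ls} {a} {rs} (at _ _ h≡ c≡) =
        let e₁ , e₂ = map-toList-split decS (tape c) (wHead c) (reverse ls)
                        (trans h≡ (sym (length-reverse ls))) (trans c≡ (Listₚ.ʳ++-defn ls))
        in e₁ , λ v → trans (e₂ v) (sym (Listₚ.ʳ++-defn ls))

      at-bound : ∀ {c q i ls rs} → At c q i ls rs → length ls + length rs ≡ suc e
      at-bound {c} {ls = ls} (at _ _ _ c≡) =
        trans (sym (Listₚ.length-ʳ++ ls))
          (trans (cong length (sym c≡)) (trans (length-map decS (toList (tape c))) (Vecₚ.length-toList (tape c))))

      shift-head : ∀ {c q i ls a rs dw ls' rs' b} → At c q i ls (b ∷ rs) → Shift dw ls a rs ls' rs' →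
        ∃ λ w → move dw (wHead c) ≡ just w × toℕ w ≡ length ls' × ls ʳ++ a ∷ rs ≡ ls' ʳ++ rs'
      shift-head {c} A sh-stay = wHead c , refl , At.head≡ A , refl
      shift-head {c} {ls = ls} A (sh-right {rs = rs}) =
        let w , e₁ , e₂ = move-right (wHead c) (subst (λ k → suc k < suc e) (sym (At.head≡ A))
                  (subst (suc (length ls) <_) (at-bound A)
                    (subst (_≤ length ls + suc (suc (length rs))) (+-comm (length ls) 2)
                      (+-monoʳ-≤ (length ls) (s≤s (s≤s z≤n))))))
        in w , e₁ , trans e₂ (cong suc (At.head≡ A)) , refl
      shift-head {c} A sh-left =
        let w , e₁ , e₂ = move-left (wHead c) (At.head≡ A) in w , e₁ , e₂ , refl

      at-step : ∀ {c q i ls a rs ω ω' q' a' di dw o ls' rs' i'} → At c q i ls (a ∷ rs) →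
        StepsTo q i a ω (q' , a' , di , dw , o) ω' → move di i ≡ just i' →
        Shift dw ls a' rs ls' rs' → ∀ y →
        ∃ λ c' → (c , ω , emit o ++ y) ⟶ (c' , ω' , y) × At c' q' i' ls' rs'
      at-step {c} {q} {i} {ls} {a} {rs} {ω} {ω'} {q'} {a'} A@(at s≡ refl h≡ c≡) S mi sh y =
        let ea , eu = at-split A
            w , mw , ew , ec = shift-head A sh
        in _ , fire (fires ea S) mi mw ,
           at (dec∘enc finQ q') refl ew
              (trans (eu _) (trans (cong (λ v → ls ʳ++ v ∷ rs) (dec∘enc finS a')) ec))
        where
        fires : ∀ {t ω'} → decS (lookup (tape c) (wHead c)) ≡ a → StepsTo q i a ω t ω' →
                Fires c ω (encT t) ω'
        fires ea (sdet e) = fdet (trans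
          (cong₂ (λ q a → mapAct encT (δQ q (readIn x (toℕ i)) a)) s≡ ea) (cong (mapAct encT) e))
        fires ea (sbr e refl) = fbr (trans
          (cong₂ (λ q a → mapAct encT (δQ q (readIn x (toℕ i)) a)) s≡ ea) (cong (mapAct encT) e)) refl

      marked : List C → List Sym
      marked [] = []
      marked (c ∷ cs) = (true , c) ∷ map (false ,_) cs

      Home : Conf → Maybe (St top) → F → Fin (2 + length x) → List C → Set
      Home c s m i cs = At c (just (s , m)) i [] (marked cs)

      home-cons : ∀ {c s m i cs} → Home c s m i cs → ∃ λ c₀ → ∃ λ cs₀ → cs ≡ c₀ ∷ cs₀
      home-cons {cs = []} H with at-bound H
      ... | ()
      home-cons {cs = c₀ ∷ cs₀} H = c₀ , cs₀ , refl

      δ* : Maybe (St top) → F → InSym → Bool → C → Act (Out (St top))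
      δ* nothing m a k c = halted
      δ* (just s) m a k c = trans₁ top s m a k c

      -- `ι` places the states of `p` inside the whole program and sends the exit `nothing` to the
      -- continuation of `p`. Quantifying over `ι` is what lets the simulation descend into
      -- subprograms.
      Agrees : ∀ p → (Maybe (St p) → Maybe (St top)) → Set
      Agrees p ι = ∀ s m a k c → δ* (ι (just s)) m a k c ≡ retarget ι (trans₁ p s m a k c)

      δ*-δQ : ∀ s m a k c → δQ (just (s , m)) a (k , c) ≡ mapAct (fromOut k) (δ* s m a k c)
      δ*-δQ nothing m a k c = refl
      δ*-δQ (just s) m a k c = refl

      frag-det : ∀ p ι → Agrees p ι → ∀ {s m i k c ω o} →
        trans₁ p s m (readIn x (toℕ i)) k c ≡ det o →
        StepsTo (just (ι (just s) , m)) i (k , c) ω (fromOut k (ι (proj₁ o) , proj₂ o)) ω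
      frag-det p ι ag e = sdet (trans (δ*-δQ (ι (just _)) _ _ _ _)
        (cong (mapAct _) (trans (ag _ _ _ _ _) (cong (retarget ι) e))))

      Reaches : Conf → List Bool → List Bool → Maybe (St top) → F → Fin (2 + length x) → List C →
                List Bool → List Bool → Set
      Reaches c ω y s m i cs ω' y' = ∃ λ c' → (c , ω , y) ⟶* (c' , ω' , y') × Home c' s m i cs

      -- A returning sweep stops at the mark; a cell that has a neighbour on its left carries none,
      -- so the sweep stops at the left end and nowhere else.
      unmarked : ∀ {l ls a ss} cs → (l ∷ ls) ʳ++ (a ∷ ss) ≡ marked cs → proj₁ a ≡ false
      unmarked {l} {ls} {a} {ss} cs e = go (reverse ls) cs (trans (sym (Listₚ.ʳ++-defn ls)) e)
        where
        inMap : ∀ (pre : List Sym) cs → pre ++ a ∷ ss ≡ map (false ,_) cs → proj₁ a ≡ false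
        inMap [] (c ∷ cs) refl = refl
        inMap (_ ∷ pre) (c ∷ cs) e = inMap pre cs (Listₚ.∷-injectiveʳ e)
        go : ∀ (pre : List Sym) cs → pre ++ l ∷ a ∷ ss ≡ marked cs → proj₁ a ≡ false
        go [] (c ∷ cs) e = inMap [] cs (Listₚ.∷-injectiveʳ e)
        go (_ ∷ pre) (c ∷ cs) e = inMap (pre ++ [ l ]) cs
          (trans (++-assoc pre [ l ] (a ∷ ss)) (Listₚ.∷-injectiveʳ e))

      return : ∀ f ι → Agrees (sweep f) ι → ∀ cs {m i ω y} ls a ss {c} → ls ʳ++ a ∷ ss ≡ marked cs →
        At c (just (ι (just false) , m)) i ls (a ∷ ss) → Reaches c ω y (ι nothing) m i cs ω y
      return f ι ag (_ ∷ cs) {y = y} [] a ss refl A =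
        let c' , s , A' = at-step A (frag-det (sweep f) ι ag refl) refl sh-stay y in c' , s ◅ ε , A'
      return f ι ag cs {y = y} (l ∷ ls) (k , a) ss eq A with unmarked {ls = ls} {a = k , a} cs eq
      ... | refl =
        let c' , s , A' = at-step A (frag-det (sweep f) ι ag refl) refl sh-left y
            c'' , r , H = return f ι ag cs ls l ((false , a) ∷ ss) eq A'
        in c'' , s ◅ r , H

      forth : ∀ f ι → Agrees (sweep f) ι → ∀ {m m' b cs cs' i ω y} ls {c k} →
        Sweep f m (b ∷ cs) cs' m' →
        At c (just (ι (just true) , m)) i ls ((k , b) ∷ map (false ,_) cs) →
        ∃ λ c' → ∃ λ ls' → ∃ λ a' → ∃ λ ss' → ∃ λ b' → ∃ λ bs →
          (c , ω , y) ⟶* (c' , ω , y) × At c' (just (ι (just false) , m')) i ls' (a' ∷ ss') ×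
          cs' ≡ b' ∷ bs × ls' ʳ++ a' ∷ ss' ≡ ls ʳ++ (k , b') ∷ map (false ,_) bs
      forth f ι ag {m} {i = i} {y = y} ls {k = k} (stop {c = b} e) A =
        let c' , s , A' = at-step A (frag-det (sweep f) ι ag (cong (det ∘ sweepOut m) e)) refl sh-stay y
        in c' , ls , _ , _ , _ , _ , s ◅ ε , A' , refl , refl
      forth f ι ag {m} {y = y} ls (next {cs = b ∷ cs} e S) A =
        let c' , s , A' = at-step A (frag-det (sweep f) ι ag (cong (det ∘ sweepOut m) e)) refl sh-right y
            c'' , ls' , a' , ss' , b' , bs , r , A'' , e₁ , e₂ = forth f ι ag (_ ∷ ls) S A'
        in c'' , ls' , a' , ss' , _ , _ , s ◅ r , A'' , refl ,
           trans e₂ (cong (λ z → ls ʳ++ _ ∷ map (false ,_) z) (sym e₁))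

      -- Every fragment starts and ends with the work head on the leftmost cell, which is why
      -- fragments compose. The induction is on the execution, so `while` needs no separate
      -- termination argument.
      simulate : ∀ p ι → Agrees p ι → ∀ {m cs i ω y m' cs' i' ω' y' c} →
        Exec p (st₁ m cs i ω y) (st₁ m' cs' i' ω' y') → Home c (ι (just (entry p))) m i cs →
        Reaches c ω y (ι nothing) m' i' cs' ω' y'
      simulate (sweep f) ι ag {ω = ω} {y = y} (sweep S) H with home-cons H
      ... | _ , _ , refl with forth f ι ag {ω = ω} {y = y} [] S H
      ... | c' , ls' , a' , ss' , b' , bs , r , A , refl , e =
        let c'' , r' , H' = return f ι ag (b' ∷ bs) ls' a' ss' e A in c'' , r ◅◅ r' , H'
      simulate (act g) ι ag {i = i} {y' = y'} (act {d = d} e) H with home-cons H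
      ... | c₀ , _ , refl =
        let c' , s , A = at-step H (frag-det (act g) ι ag (cong (det ∘ actOut c₀ (readIn x (toℕ i))) e))
                           (move-clampDir x d i) sh-stay y'
        in c' , s ◅ ε , A
      simulate (choose g) ι ag {y = y} choose H with home-cons H
      ... | _ , _ , refl =
        let c' , s , A = at-step H (sbr (trans (δ*-δQ (ι (just _)) _ _ _ _)
                           (cong (mapAct _) (ag tt _ _ _ _))) refl) refl sh-stay y
        in c' , s ◅ ε , A
      simulate (seq p q) ι ag (seq E₁ E₂) H =
        let c' , r , H' = simulate p (ι ∘ seqˡ p q)
              (λ s m a k c → trans (ag (inj₁ s) m a k c) (retarget-∘ ι _ (trans₁ p s m a k c))) E₁ H
            c'' , r' , H'' = simulate q (ι ∘ seqʳ p q)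
              (λ s m a k c → trans (ag (inj₂ s) m a k c) (retarget-∘ ι _ (trans₁ q s m a k c))) E₂ H'
        in c'' , r ◅◅ r' , H''
      simulate (cond b p q) ι ag {m} {y = y} (cond-true t E) H with home-cons H
      ... | _ , _ , refl =
        let c' , s , A = at-step H (frag-det (cond b p q) ι ag
                           (cong (λ t → det (just (just (if t then _ else _)) , m , _ , stay , stay , nothing)) t))
                           refl sh-stay y
            c'' , r , H' = simulate p (ι ∘ condˡ)
              (λ s m a k c → trans (ag (just (inj₁ s)) m a k c) (retarget-∘ ι _ (trans₁ p s m a k c))) E A
        in c'' , s ◅ r , H'
      simulate (cond b p q) ι ag {m} {y = y} (cond-false t E) H with home-cons H
      ... | _ , _ , refl =
        let c' , s , A = at-step H (frag-det (cond b p q) ι ag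
                           (cong (λ t → det (just (just (if t then _ else _)) , m , _ , stay , stay , nothing)) t))
                           refl sh-stay y
            c'' , r , H' = simulate q (ι ∘ condʳ)
              (λ s m a k c → trans (ag (just (inj₂ s)) m a k c) (retarget-∘ ι _ (trans₁ q s m a k c))) E A
        in c'' , s ◅ r , H'
      simulate (while b p) ι ag {m} {y = y} (while-stop t) H with home-cons H
      ... | _ , _ , refl =
        let c' , s , A = at-step H (frag-det (while b p) ι ag
                           (cong (λ t → det ((if t then _ else nothing) , m , _ , stay , stay , nothing)) t))
                           refl sh-stay y
        in c' , s ◅ ε , A
      simulate (while b p) ι ag {m} {y = y} (while-go t E E') H with home-cons H
      ... | _ , _ , refl =
        let c' , s , A = at-step H (frag-det (while b p) ι ag
                           (cong (λ t → det ((if t then _ else nothing) , m , _ , stay , stay , nothing)) t))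
                           refl sh-stay y
            c'' , r , H' = simulate p (ι ∘ just)
              (λ s m a k c → trans (ag (just s) m a k c) (retarget-∘ ι _ (trans₁ p s m a k c))) E A
            c''' , r' , H'' = simulate (while b p) ι ag E' H'
        in c''' , (s ◅ r) ◅◅ r' , H''

      initial : Conf
      initial = config (enc finQ nothing) zero (Vec.replicate (suc e) zero) zero

      run-whole : ∀ {ω y m i cs ω' y'} →
        Exec top (st₁ m₀ (replicate (suc e) blank) zero ω y) (st₁ m cs i ω' y') →
        Reaches initial ω y nothing m i cs ω' y'
      run-whole {y = y} E =
        let c , s , A = at-step {c = initial} (at (dec∘enc finQ nothing) refl refl (blanks (suc e)))
                          (sdet refl) refl sh-stay y
            c' , r , H = simulate top id (λ s m a k c → sym (retarget-id (trans₁ top s m a k c))) E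
                           (subst (λ z → At c _ zero [] ((true , blank) ∷ z)) (sym (marks e)) A)
        in c' , s ◅ r , H
        where
        blanks : ∀ n → map decS (toList (Vec.replicate n zero)) ≡ replicate n (false , blank)
        blanks zero = refl
        blanks (suc n) = cong (_ ∷_) (blanks n)
        marks : ∀ n → map (false ,_) (replicate n blank) ≡ replicate n (false , blank)
        marks zero = refl
        marks (suc n) = cong (_ ∷_) (marks n)
        retarget-id : ∀ {S : Set} (a : Act (Out S)) → retarget id a ≡ a
        retarget-id halted = refl
        retarget-id (det _) = refl
        retarget-id (branch _) = refl

      final-halted : ∀ {c m} → decode finQ (state c) ≡ just (nothing , m) → δAt c ≡ halted
      final-halted {c} e = cong (λ q → mapAct encT (δQ q (readIn x (toℕ (inHead c))) (decS (lookup (tape c) (wHead c))))) e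

-- Binary registers on tape columns

-- Registers are columns of binary digits, least significant first; a number
-- below 2 ^ e occupies a column of e + 1 cells, so a blank always ends it.

Digit : Set
Digit = Maybe Bool

bitVal : Bool → ℕ
bitVal false = 0
bitVal true = 1

-- Leading zeros are allowed. The value in `digit` is given by an equation, so that matching still
-- works when the index has the form `suc v`.
data Rep : ℕ → List Digit → ℕ → Set where
  blanks : ∀ {e} → Rep e (nothing ∷ replicate e nothing) 0
  digit  : ∀ {e b ds v w} → Rep e ds v → w ≡ bitVal b + 2 * v → Rep (suc e) (just b ∷ ds) w

isZero : ℕ → Bool
isZero zero = true
isZero (suc _) = false

module Columns {K : ℕ} (G : Set) where

  Cell : Set
  Cell = Vec Digit K

  col : Fin K → List Cell → List Digit
  col r = map (λ c → lookup c r)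

  colSweep : Fin K → (Cell → Digit × Maybe Bool) → G × Bool → Cell → Cell × Maybe (G × Bool)
  colSweep r φ (g , _) c = (c [ r ]≔ proj₁ (φ c)) , Maybe.map (g ,_) (proj₂ (φ c))

  record Swept (r : Fin K) (φ : Cell → Digit × Maybe Bool) (m : G × Bool) (cs : List Cell)
               (fl : Bool) (P : List Digit → Set) : Set where
    constructor swept
    field
      cs'   : List Cell
      run   : Sweep (colSweep r φ) m cs cs' (proj₁ m , fl)
      this  : P (col r cs')
      other : ∀ r' → r' ≢ r → col r' cs' ≡ col r' cs

  swept-stop : ∀ {r φ m c cs d fl P} → φ c ≡ (d , just fl) → P (d ∷ col r cs) →
               Swept r φ m (c ∷ cs) fl P
  swept-stop {r} {c = c} {cs} {d} {P = P} e p = swept (c [ r ]≔ d ∷ cs)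
    (stop (cong (λ (d , o) → (c [ r ]≔ d) , Maybe.map (_ ,_) o) e))
    (subst (λ z → P (z ∷ col r cs)) (sym (lookup∘update r c d)) p)
    (λ r' ne → cong (_∷ col r' cs) (lookup∘update′ ne c d))

  swept-next : ∀ {r φ m c cs d fl P P'} → φ c ≡ (d , nothing) → Swept r φ m cs fl P →
               (∀ ds → P ds → P' (d ∷ ds)) → Swept r φ m (c ∷ cs) fl P'
  swept-next {r} {c = c} {cs} {d} {P' = P'} e (swept cs' R t o) f = swept (c [ r ]≔ d ∷ cs')
    (next (cong (λ (d , o) → (c [ r ]≔ d) , Maybe.map (_ ,_) o) e) R)
    (subst (λ z → P' (z ∷ col r cs')) (sym (lookup∘update r c d)) (f _ t))
    (λ r' ne → cong₂ _∷_ (lookup∘update′ ne c d) (o r' ne))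

  -- A carry that reaches a blank makes it a new leading digit. The `Bool` answered is the zero
  -- flag, informative only for `testφ`; `borrowφ` is meant for positive numbers.
  incφ testφ borrowφ : Digit → Digit × Maybe Bool
  incφ (just true) = just false , nothing
  incφ _ = just true , just false
  testφ nothing = nothing , just true
  testφ (just true) = just true , just false
  testφ (just false) = just false , nothing
  borrowφ (just false) = just true , nothing
  borrowφ _ = just false , just false

  -- Copying goes on until source and target are both blank: stopping at the end of a shorter source
  -- would leave old digits of the target in place.
  movφ : Digit → Digit → Digit × Maybe Bool
  movφ nothing nothing = nothing , just false
  movφ s t = s , nothing

  at-col : Fin K → (Digit → Digit × Maybe Bool) → Cell → Digit × Maybe Bool
  at-col r φ c = φ (lookup c r)

  ∷-inv : ∀ {A : Set} {a b : A} {as bs : List A} → a ∷ as ≡ b ∷ bs → b ≡ a × as ≡ bs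
  ∷-inv refl = refl , refl

  inc-swept : ∀ r {m e ds v} cs → Rep e ds v → ds ≡ col r cs → suc v < 2 ^ e →
              Swept r (at-col r incφ) m cs false (λ ds' → Rep e ds' (suc v))
  inc-swept r {e = zero} _ blanks _ (s≤s ())
  inc-swept r {e = suc e} (c ∷ cs) blanks eq lt =
    let e₁ , e₂ = ∷-inv eq in
    swept-stop (cong incφ e₁) (subst (λ z → Rep (suc e) (just true ∷ z) 1) e₂ (digit blanks refl))
  inc-swept r (c ∷ cs) (digit {b = false} R refl) eq lt =
    let e₁ , e₂ = ∷-inv eq in
    swept-stop (cong incφ e₁) (subst (λ z → Rep _ (just true ∷ z) _) e₂ (digit R refl))
  inc-swept r (c ∷ cs) (digit {e = e} {b = true} {v = v} R refl) eq lt =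
    let e₁ , e₂ = ∷-inv eq in
    swept-next (cong incφ e₁)
      -- The bound passes along the carry: `2 * suc v < 2 ^ suc e` gives `suc v < 2 ^ e`, so the
      -- last blank is never overwritten.
      (inc-swept r cs R e₂ (*-cancelˡ-< 2 _ _ (subst (_< 2 ^ suc e) (sym (double v)) lt)))
      (λ ds R' → digit R' (sym (double v)))
    where
    double : ∀ v → 2 * suc v ≡ suc (1 + 2 * v)
    double v = *-suc 2 v

  borrow-swept : ∀ r {m e ds v} cs → Rep e ds (suc v) → ds ≡ col r cs →
                 Swept r (at-col r borrowφ) m cs false (λ ds' → Rep e ds' v)
  borrow-swept r (c ∷ cs) (digit {b = true} R p) eq =
    let e₁ , e₂ = ∷-inv eq in
    swept-stop (cong borrowφ e₁)
      (subst (λ z → Rep _ (just false ∷ z) _) e₂ (digit R (suc-injective p)))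
  borrow-swept r (c ∷ cs) (digit {b = false} {v = suc v} R p) eq =
    let e₁ , e₂ = ∷-inv eq in
    swept-next (cong borrowφ e₁) (borrow-swept r cs R e₂)
      (λ ds R' → digit R' (suc-injective (trans p (*-suc 2 v))))

  test-swept : ∀ r {m e ds v} cs → Rep e ds v → ds ≡ col r cs →
               Swept r (at-col r testφ) m cs (isZero v) (λ ds' → ds' ≡ ds)
  test-swept r (c ∷ cs) blanks eq =
    let e₁ , e₂ = ∷-inv eq in swept-stop (cong testφ e₁) (cong (nothing ∷_) (sym e₂))
  test-swept r (c ∷ cs) (digit {b = true} R refl) eq =
    let e₁ , e₂ = ∷-inv eq in swept-stop (cong testφ e₁) (cong (just true ∷_) (sym e₂))
  test-swept r {m} (c ∷ cs) (digit {b = false} {ds = ds} {v = v} R refl) eq =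
    let e₁ , e₂ = ∷-inv eq in
    subst (λ z → Swept r (at-col r testφ) m (c ∷ cs) z (λ ds' → ds' ≡ just false ∷ ds)) (isZero-double v)
      (swept-next (cong testφ e₁) (test-swept r cs R e₂) (λ ds' p → cong (just false ∷_) p))
    where
    isZero-double : ∀ v → isZero v ≡ isZero (2 * v)
    isZero-double zero = refl
    isZero-double (suc v) = refl

  mov-swept : ∀ r (src : Cell → Digit) {m e ds v ds₁ u} cs → Rep e ds v → ds ≡ map src cs →
              Rep e ds₁ u → ds₁ ≡ col r cs →
              Swept r (λ c → movφ (src c) (lookup c r)) m cs false (λ ds' → ds' ≡ ds)
  mov-swept r src (c ∷ cs) blanks eq blanks eq₁ =
    let e₁ , e₂ = ∷-inv eq ; e₃ , e₄ = ∷-inv eq₁ in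
    swept-stop (cong₂ movφ e₁ e₃) (cong (nothing ∷_) (sym e₄))
  mov-swept r src (c ∷ cs) blanks eq (digit R₁ _) eq₁ =
    let e₁ , e₂ = ∷-inv eq ; e₃ , e₄ = ∷-inv eq₁ in
    swept-next (cong₂ movφ e₁ e₃) (mov-swept r src cs blanks e₂ R₁ e₄) (λ _ → cong (nothing ∷_))
  mov-swept r src (c ∷ cs) (digit {b = b} R _) eq blanks eq₁ =
    let e₁ , e₂ = ∷-inv eq ; e₃ , e₄ = ∷-inv eq₁ in
    swept-next (cong₂ movφ e₁ e₃) (mov-swept r src cs R e₂ blanks e₄) (λ _ → cong (just b ∷_))
  mov-swept r src (c ∷ cs) (digit {b = b} R _) eq (digit R₁ _) eq₁ =
    let e₁ , e₂ = ∷-inv eq ; e₃ , e₄ = ∷-inv eq₁ in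
    swept-next (cong₂ movφ e₁ e₃) (mov-swept r src cs R e₂ R₁ e₄) (λ _ → cong (just b ∷_))

-- Register programs and their translation

-- Register programs; the index bounds the nesting depth of for-loops.

data RProg (G : Set) (k : ℕ) : ℕ → Set where
  skip   : ∀ {d} → RProg G k d
  inc    : ∀ {d} → Fin k → RProg G k d
  dec    : ∀ {d} → Fin k → RProg G k d
  mov    : ∀ {d} → Fin k → Maybe (Fin k) → RProg G k d
  ifz    : ∀ {d} → Fin k → RProg G k d → RProg G k d → RProg G k d
  for    : ∀ {d} → Fin k → RProg G k d → RProg G k (suc d)
  act    : ∀ {d} → (G → InSym → G × Dir × Maybe Bool) → RProg G k d
  choose : ∀ {d} → (Bool → G → G) → RProg G k d
  seq    : ∀ {d} → RProg G k d → RProg G k d → RProg G k d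
  cond   : ∀ {d} → (G → Bool) → RProg G k d → RProg G k d → RProg G k d
  while  : ∀ {d} → (G → Bool) → RProg G k d → RProg G k d

module Exec₂ {G : Set} {k : ℕ} (x : List Bool) (e : ℕ) where

  record S₂ : Set where
    constructor st₂
    field
      ctl  : G
      regs : Vec ℕ k
      pos  : Fin (2 + length x)
      choices out : List Bool

  data Exec : ∀ {d} → RProg G k d → S₂ → S₂ → Set
  data Iter {d} (p : RProg G k d) : ℕ → S₂ → S₂ → Set

  data Exec where
    skip : ∀ {d σ} → Exec (skip {d = d}) σ σ
    inc  : ∀ {d r g rs i ω y} → suc (lookup rs r) < 2 ^ e →
           Exec (inc {d = d} r) (st₂ g rs i ω y) (st₂ g (rs [ r ]≔ suc (lookup rs r)) i ω y)
    dec  : ∀ {d r g rs i ω y} →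
           Exec (dec {d = d} r) (st₂ g rs i ω y) (st₂ g (rs [ r ]≔ pred (lookup rs r)) i ω y)
    mov  : ∀ {d r s g rs i ω y} →
           Exec (mov {d = d} r s) (st₂ g rs i ω y) (st₂ g (rs [ r ]≔ maybe (lookup rs) 0 s) i ω y)
    ifz-zero : ∀ {d r} {p q : RProg G k d} {σ τ} → lookup (S₂.regs σ) r ≡ 0 →
               Exec p σ τ → Exec (ifz r p q) σ τ
    ifz-suc  : ∀ {d r} {p q : RProg G k d} {σ τ v} → lookup (S₂.regs σ) r ≡ suc v →
               Exec q σ τ → Exec (ifz r p q) σ τ
    for    : ∀ {d r} {p : RProg G k d} {σ τ} → Iter p (lookup (S₂.regs σ) r) σ τ → Exec (for r p) σ τ
    act    : ∀ {d g m m' di o rs i ω y} → g m (readIn x (toℕ i)) ≡ (m' , di , o) →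
             Exec (act {d = d} g) (st₂ m rs i ω (emit o ++ y)) (st₂ m' rs (clamp di i) ω y)
    choose : ∀ {d g m rs i ω y} →
             Exec (choose {d = d} g) (st₂ m rs i ω y) (st₂ (g (headω ω) m) rs i (tailω ω) y)
    seq    : ∀ {d} {p q : RProg G k d} {σ τ υ} → Exec p σ τ → Exec q τ υ → Exec (seq p q) σ υ
    cond-true  : ∀ {d b} {p q : RProg G k d} {σ τ} → b (S₂.ctl σ) ≡ true → Exec p σ τ →
                 Exec (cond b p q) σ τ
    cond-false : ∀ {d b} {p q : RProg G k d} {σ τ} → b (S₂.ctl σ) ≡ false → Exec q σ τ →
                 Exec (cond b p q) σ τ
    while-stop : ∀ {d b} {p : RProg G k d} {σ} → b (S₂.ctl σ) ≡ false → Exec (while b p) σ σ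
    while-go   : ∀ {d b} {p : RProg G k d} {σ τ υ} → b (S₂.ctl σ) ≡ true → Exec p σ τ →
                 Exec (while b p) τ υ → Exec (while b p) σ υ

  data Iter p where
    done : ∀ {σ} → Iter p 0 σ σ
    more : ∀ {n σ τ υ} → Exec p σ τ → Iter p n τ υ → Iter p (suc n) σ υ

module Translate {G : Set} {k : ℕ} (D : ℕ) where
  open Columns {D + k} G

  private F = G × Bool

  main : Fin k → Fin (D + k)
  main r = D ↑ʳ r

  -- A `for` whose body has depth `d` counts in scratch column `d`; loops inside the body use
  -- smaller columns.
  scratch : ∀ {d} → d < D → Fin (D + k)
  scratch lt = fromℕ< lt ↑ˡ k

  onCol : Fin (D + k) → (Digit → Digit × Maybe Bool) → Prog F Cell
  onCol r φ = sweep (colSweep r (at-col r φ))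

  copyCol : Fin (D + k) → (Cell → Digit) → Prog F Cell
  copyCol r src = sweep (colSweep r (λ c → movφ (src c) (lookup c r)))

  source : Maybe (Fin k) → Cell → Digit
  source nothing c = nothing
  source (just s) c = lookup c (main s)

  idle : Prog F Cell
  idle = act (λ m _ → m , stay , nothing)

  translate : ∀ {d} → RProg G k d → d ≤ D → Prog F Cell
  translate skip le = idle
  translate (inc r) le = onCol (main r) incφ
  -- Decrementing 0 must change nothing, while a borrow would turn its zeros into ones; hence the
  -- test.
  translate (dec r) le = seq (onCol (main r) testφ) (cond proj₂ idle (onCol (main r) borrowφ))
  translate (mov r s) le = copyCol (main r) (source s)
  translate (ifz r p q) le =
    seq (onCol (main r) testφ) (cond proj₂ (translate p le) (translate q le))
  translate (for r p) le =
    seq (copyCol (scratch le) (λ c → lookup c (main r)))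
        (seq (onCol (scratch le) testφ)
             (while (not ∘ proj₂)
                (seq (onCol (scratch le) borrowφ)
                     (seq (translate p (≤-trans (n≤1+n _) le)) (onCol (scratch le) testφ)))))
  translate (act g) le = act (λ (m , fl) a → let (m' , r) = g m a in (m' , fl) , r)
  translate (choose g) le = choose (λ b (m , fl) → g b m , fl)
  translate (seq p q) le = seq (translate p le) (translate q le)
  translate (cond b p q) le = cond (b ∘ proj₁) (translate p le) (translate q le)
  translate (while b p) le = while (b ∘ proj₁) (translate p le)

  module _ (x : List Bool) (e : ℕ) where
    open Exec₁ {F} {Cell} x renaming (Exec to Exec¹)
    open Exec₂ {G} {k} x e renaming (Exec to Exec²)

    record Holds (cs : List Cell) (rs : Vec ℕ k) (sc : Fin D → ℕ) : Set where
      constructor holds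
      field
        inMain    : ∀ r → Rep e (col (main r) cs) (lookup rs r)
        inScratch : ∀ j → Rep e (col (j ↑ˡ k) cs) (sc j)
    open Holds

    ↑ˡ≢↑ʳ : ∀ (j : Fin D) (r : Fin k) → j ↑ˡ k ≢ D ↑ʳ r
    ↑ˡ≢↑ʳ j r eq with trans (sym (Finₚ.splitAt-↑ˡ D j k)) (trans (cong (splitAt D) eq) (Finₚ.splitAt-↑ʳ D k r))
    ... | ()

    set : (Fin D → ℕ) → Fin D → ℕ → Fin D → ℕ
    set sc j v j' with j' Finₚ.≟ j
    ... | yes _ = v
    ... | no _ = sc j'

    set-eq : ∀ sc j v → set sc j v j ≡ v
    set-eq sc j v with j Finₚ.≟ j
    ... | yes _ = refl
    ... | no ne = ⊥-elim (ne refl)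

    set-ne : ∀ sc {j j'} v → j' ≢ j → set sc j v j' ≡ sc j'
    set-ne sc {j} {j'} v ne with j' Finₚ.≟ j
    ... | yes eq = ⊥-elim (ne eq)
    ... | no _ = refl

    holds-main : ∀ {cs rs sc cs' r v} → Holds cs rs sc → Rep e (col (main r) cs') v →
      (∀ r' → r' ≢ main r → col r' cs' ≡ col r' cs) → Holds cs' (rs [ r ]≔ v) sc
    holds-main {cs} {rs} {sc} {cs'} {r} {v} H R o = holds m (λ j →
      subst (λ z → Rep e z _) (sym (o _ (↑ˡ≢↑ʳ j r))) (inScratch H j))
      where
      m : ∀ r' → Rep e (col (main r') cs') (lookup (rs [ r ]≔ v) r')
      m r' with r' Finₚ.≟ r
      ... | yes refl = subst (Rep e _) (sym (lookup∘update r rs v)) R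
      ... | no ne = subst₂ (Rep e) (sym (o _ (ne ∘ Finₚ.↑ʳ-injective D _ _)))
                      (sym (lookup∘update′ ne rs v)) (inMain H r')

    holds-scratch : ∀ {cs rs sc cs' j v} → Holds cs rs sc → Rep e (col (j ↑ˡ k) cs') v →
      (∀ r' → r' ≢ j ↑ˡ k → col r' cs' ≡ col r' cs) → Holds cs' rs (set sc j v)
    holds-scratch {cs} {rs} {sc} {cs'} {j} {v} H R o = holds
      (λ r → subst (λ z → Rep e z _) (sym (o _ (λ eq → ↑ˡ≢↑ʳ j r (sym eq)))) (inMain H r)) s
      where
      s : ∀ j' → Rep e (col (j' ↑ˡ k) cs') (set sc j v j')
      s j' with j' Finₚ.≟ j
      ... | yes refl = R
      ... | no ne = subst (λ z → Rep e z _) (sym (o _ (ne ∘ Finₚ.↑ˡ-injective k _ _))) (inScratch H j')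

    holds-same : ∀ {cs rs sc cs' r} → Holds cs rs sc → col r cs' ≡ col r cs →
      (∀ r' → r' ≢ r → col r' cs' ≡ col r' cs) → Holds cs' rs sc
    holds-same {cs} {rs} {sc} {cs'} {r} H t o = holds
      (λ r' → subst (λ z → Rep e z _) (sym (all _)) (inMain H r'))
      (λ j → subst (λ z → Rep e z _) (sym (all _)) (inScratch H j))
      where
      all : ∀ r' → col r' cs' ≡ col r' cs
      all r' with r' Finₚ.≟ r
      ... | yes refl = t
      ... | no ne = o r' ne

    -- `kept` is the invariant for nested loops: code of depth `d` preserves the counters of the
    -- enclosing loops, which occupy columns `d` and above.
    record After {d} (p : RProg G k d) (le : d ≤ D) (g : G) (fl : Bool) (cs : List Cell)
                 (sc : Fin D → ℕ) (i : Fin (2 + length x)) (ω y : List Bool) (σ : S₂) : Set where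
      constructor after
      field
        fl' : Bool
        cs' : List Cell
        sc' : Fin D → ℕ
        run : Exec¹ (translate p le) (st₁ (g , fl) cs i ω y)
                (st₁ (S₂.ctl σ , fl') cs' (S₂.pos σ) (S₂.choices σ) (S₂.out σ))
        hold : Holds cs' (S₂.regs σ) sc'
        kept : ∀ j → d ≤ toℕ j → sc' j ≡ sc j

    test-run : ∀ {rs sc cs m i ω y} r {v} → Holds cs rs sc → Rep e (col r cs) v →
      ∃ λ cs' → Exec¹ (onCol r testφ) (st₁ m cs i ω y) (st₁ (proj₁ m , isZero v) cs' i ω y) ×
        Holds cs' rs sc
    test-run {cs = cs} r H R =
      let swept cs' S t o = test-swept r cs R refl in cs' , sweep S , holds-same H t o

    translate-sound : ∀ {d} {p : RProg G k d} le {g rs i ω y τ} →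
      Exec² p (st₂ g rs i ω y) τ → ∀ {fl cs sc} → Holds cs rs sc → After p le g fl cs sc i ω y τ

    -- the flag tells whether the loop counter sc j has reached zero
    loop-sound : ∀ {d} {p : RProg G k d} (lt : d < D) {n g rs i ω y τ} →
      Iter p n (st₂ g rs i ω y) τ → ∀ {fl cs sc} → Holds cs rs sc → sc (fromℕ< lt) ≡ n → fl ≡ isZero n →
      ∃ λ fl' → ∃ λ cs' → ∃ λ sc' →
        Exec¹ (while (not ∘ proj₂)
                (seq (onCol (scratch lt) borrowφ)
                     (seq (translate p (≤-trans (n≤1+n _) lt)) (onCol (scratch lt) testφ))))
          (st₁ (g , fl) cs i ω y)
          (st₁ (S₂.ctl τ , fl') cs' (S₂.pos τ) (S₂.choices τ) (S₂.out τ)) ×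
        Holds cs' (S₂.regs τ) sc' × (∀ j → d < toℕ j → sc' j ≡ sc j)
    loop-sound lt done H _ refl = _ , _ , _ , while-stop refl , H , λ _ _ → refl
    loop-sound {d} {p} lt (more {n = n} E I) {cs = cs} {sc} H e₀ refl =
      let j = fromℕ< lt
          swept cs₁ S₁ R₁ o₁ = borrow-swept (scratch lt) cs
            (subst (Rep e _) e₀ (inScratch H j)) refl
          H₁ = holds-scratch H R₁ o₁
          after fl₂ cs₂ sc₂ run₂ H₂ k₂ = translate-sound (≤-trans (n≤1+n _) lt) E H₁
          j₂ = trans (k₂ j (≤-reflexive (sym (toℕ-fromℕ< lt)))) (set-eq sc j n)
          cs₃ , run₃ , H₃ = test-run (scratch lt) H₂ (subst (Rep e _) j₂ (inScratch H₂ j))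
          fl₄ , cs₄ , sc₄ , run₄ , H₄ , k₄ = loop-sound lt I H₃ j₂ refl
      in fl₄ , cs₄ , sc₄ , while-go refl (seq (sweep S₁) (seq run₂ run₃)) run₄ , H₄ ,
         λ j' d<j' → trans (k₄ j' d<j') (trans (k₂ j' (<⇒≤ d<j'))
           (set-ne sc n (λ eq → <-irrefl (trans (sym (toℕ-fromℕ< lt)) (cong toℕ (sym eq))) d<j')))

    translate-sound le skip H = after _ _ _ (act refl) H (λ _ _ → refl)
    translate-sound le (inc {r = r} lt) {cs = cs} H =
      let swept cs' S R o = inc-swept (main r) cs (inMain H r) refl lt
      in after _ cs' _ (sweep S) (holds-main H R o) (λ _ _ → refl)
    translate-sound le (dec {r = r} {rs = rs}) {cs = cs} {sc} H with lookup rs r in eq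
    ... | zero =
      let cs' , run , H' = test-run (main r) H (subst (Rep e _) eq (inMain H r))
      in after _ cs' _ (seq run (cond-true refl (act refl)))
           (subst (λ z → Holds cs' z _) (sym (trans (cong (rs [ r ]≔_) (sym eq)) (Vecₚ.[]≔-lookup rs r))) H')
           (λ _ _ → refl)
    ... | suc v =
      let cs' , run , H' = test-run (main r) H (subst (Rep e _) eq (inMain H r))
          swept cs'' S R o = borrow-swept (main r) cs' (subst (Rep e _) eq (inMain H' r)) refl
      in after _ cs'' _ (seq run (cond-false refl (sweep S))) (holds-main H' R o) (λ _ _ → refl)
    translate-sound le (mov {r = r} {s = nothing}) {cs = cs} H =
      -- Clearing is copying from an imaginary column of blanks, which represents 0.
      let swept cs' S t o = mov-swept (main r) (λ _ → nothing) cs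
            (subst (λ z → Rep e z 0) (sym (constant cs (inMain H r))) blanks) refl (inMain H r) refl
      in after _ cs' _ (sweep S)
           (holds-main H (subst (λ z → Rep e z 0) (sym (trans t (constant cs (inMain H r)))) blanks) o)
           (λ _ _ → refl)
      where
      rep-length : ∀ {e ds v} → Rep e ds v → length ds ≡ suc e
      rep-length (blanks {e}) = cong suc (Listₚ.length-replicate e)
      rep-length (digit R _) = cong suc (rep-length R)
      map-const : ∀ (cs : List Cell) → map (λ _ → nothing) cs ≡ replicate (length cs) (nothing {A = Bool})
      map-const [] = refl
      map-const (c ∷ cs) = cong (nothing ∷_) (map-const cs)
      constant : ∀ cs {r v} → Rep e (col r cs) v → map (λ _ → nothing) cs ≡ replicate (suc e) nothing
      constant cs R = trans (map-const cs)
        (cong (λ n → replicate n nothing) (trans (sym (length-map _ cs)) (rep-length R)))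
    translate-sound le (mov {r = r} {s = just s}) {cs = cs} H =
      let swept cs' S t o = mov-swept (main r) (source (just s)) cs (inMain H s) refl (inMain H r) refl
      in after _ cs' _ (sweep S) (holds-main H (subst (λ z → Rep e z _) (sym t) (inMain H s)) o)
           (λ _ _ → refl)
    translate-sound le (ifz-zero {r = r} eq E) H =
      let cs' , run , H' = test-run (main r) H (subst (Rep e _) eq (inMain H r))
          after fl₁ cs₁ sc₁ run₁ H₁ k₁ = translate-sound le E H'
      in after fl₁ cs₁ sc₁ (seq run (cond-true refl run₁)) H₁ k₁
    translate-sound le (ifz-suc {r = r} eq E) H =
      let cs' , run , H' = test-run (main r) H (subst (Rep e _) eq (inMain H r))
          after fl₁ cs₁ sc₁ run₁ H₁ k₁ = translate-sound le E H'
      in after fl₁ cs₁ sc₁ (seq run (cond-false refl run₁)) H₁ k₁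
    translate-sound le {rs = rs} (for {r = r} I) {cs = cs} {sc} H =
      let j = fromℕ< le
          swept cs₁ S₁ t₁ o₁ = mov-swept (scratch le) (λ c → lookup c (main r)) cs
            (inMain H r) refl (inScratch H j) refl
          H₁ = holds-scratch H (subst (λ z → Rep e z _) (sym t₁) (inMain H r)) o₁
          j₁ = set-eq sc j (lookup rs r)
          cs₂ , run₂ , H₂ = test-run (scratch le) H₁ (subst (Rep e _) j₁ (inScratch H₁ j))
          fl₃ , cs₃ , sc₃ , run₃ , H₃ , k₃ = loop-sound le I H₂ j₁ refl
      in after fl₃ cs₃ sc₃ (seq (sweep S₁) (seq run₂ run₃)) H₃
           λ j' d<j' → trans (k₃ j' d<j')
             (set-ne sc _ (λ eq → <-irrefl (trans (sym (toℕ-fromℕ< le)) (cong toℕ (sym eq))) d<j'))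
    translate-sound le (act eq) H =
      after _ _ _ (act (cong (λ z → (proj₁ z , _) , proj₂ z) eq)) H (λ _ _ → refl)
    translate-sound le choose H = after _ _ _ choose H (λ _ _ → refl)
    translate-sound le (seq E E') H =
      let after fl₁ cs₁ sc₁ run₁ H₁ k₁ = translate-sound le E H
          after fl₂ cs₂ sc₂ run₂ H₂ k₂ = translate-sound le E' H₁
      in after fl₂ cs₂ sc₂ (seq run₁ run₂) H₂ (λ j p → trans (k₂ j p) (k₁ j p))
    translate-sound le (cond-true t E) H =
      let after fl₁ cs₁ sc₁ run₁ H₁ k₁ = translate-sound le E H
      in after fl₁ cs₁ sc₁ (cond-true t run₁) H₁ k₁
    translate-sound le (cond-false t E) H =
      let after fl₁ cs₁ sc₁ run₁ H₁ k₁ = translate-sound le E H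
      in after fl₁ cs₁ sc₁ (cond-false t run₁) H₁ k₁
    translate-sound le (while-stop t) H = after _ _ _ (while-stop t) H (λ _ _ → refl)
    translate-sound le (while-go t E E') H =
      let after fl₁ cs₁ sc₁ run₁ H₁ k₁ = translate-sound le E H
          after fl₂ cs₂ sc₂ run₂ H₂ k₂ = translate-sound le E' H₁
      in after fl₂ cs₂ sc₂ (while-go t run₁ run₂) H₂ (λ j p → trans (k₂ j p) (k₁ j p))

    translate-initial : ∀ {p : RProg G k D} {g fl i ω y τ} →
      Exec² p (st₂ g (Vec.replicate k 0) i ω y) τ →
      ∃ λ fl' → ∃ λ cs' → Exec¹ (translate p ≤-refl)
        (st₁ (g , fl) (replicate (suc e) (Vec.replicate (D + k) nothing)) i ω y)
        (st₁ (S₂.ctl τ , fl') cs' (S₂.pos τ) (S₂.choices τ) (S₂.out τ))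
    translate-initial E =
      let after fl' cs' _ run _ _ = translate-sound ≤-refl E {sc = λ _ → 0}
            (holds (λ r → subst₂ (Rep e) (sym (blank-col (main r) (suc e))) (sym (Vecₚ.lookup-replicate r 0)) blanks)
                   (λ j → subst (λ z → Rep e z 0) (sym (blank-col (j ↑ˡ k) (suc e))) blanks))
      in fl' , cs' , run
      where
      blank-col : ∀ r n → col r (replicate n (Vec.replicate (D + k) nothing)) ≡ replicate n nothing
      blank-col r zero = refl
      blank-col r (suc n) = cong₂ _∷_ (Vecₚ.lookup-replicate r nothing) (blank-col r n)

-- Logarithms and sufficient space

log₂-half : ∀ n → 2 ≤ n → ⌊log₂ n ⌋ ≡ suc ⌊log₂ ⌊ n /2⌋ ⌋
log₂-half n 2≤n rewrite ⌊log₂⌊n/2⌋⌋≡⌊log₂n⌋∸1 n =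
  sym (m+[n∸m]≡n {1} (⌊log₂⌋-mono-≤ 2≤n))

n≤1+2*half : ∀ n → n ≤ 1 + 2 * ⌊ n /2⌋
n≤1+2*half zero = z≤n
n≤1+2*half (suc zero) = ≤-refl
n≤1+2*half (suc (suc n)) =
  subst (2 + n ≤_) (cong suc (sym (*-suc 2 ⌊ n /2⌋))) (s≤s (s≤s (n≤1+2*half n)))

n<2^log₂ : ∀ n → n < 2 ^ suc ⌊log₂ n ⌋
n<2^log₂ = <-rec _ go
  where
  go : ∀ n → (∀ {m} → m < n → m < 2 ^ suc ⌊log₂ m ⌋) → n < 2 ^ suc ⌊log₂ n ⌋
  go zero _ = z<s
  go (suc zero) _ = s<s z<s
  go n@(suc (suc m)) rec = begin-strict
    n                                  ≤⟨ n≤1+2*half n ⟩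
    1 + 2 * ⌊ n /2⌋                    <⟨ n<1+n _ ⟩
    2 + 2 * ⌊ n /2⌋                    ≡⟨ *-suc 2 ⌊ n /2⌋ ⟨
    2 * suc ⌊ n /2⌋                    ≤⟨ *-monoʳ-≤ 2 (rec (⌊n/2⌋<n (suc m))) ⟩
    2 * 2 ^ suc ⌊log₂ ⌊ n /2⌋ ⌋        ≡⟨ cong (λ k → 2 * 2 ^ k) (log₂-half n (s≤s (s≤s z≤n))) ⟨
    2 ^ suc ⌊log₂ n ⌋                  ∎
    where open ≤-Reasoning

2+n≤2^2l : ∀ n → 2 + n ≤ 2 ^ (2 * suc ⌊log₂ n ⌋)
2+n≤2^2l n = begin
  2 + n                          ≤⟨ s≤s (n<2^log₂ n) ⟩
  1 + 2 ^ l                      ≤⟨ +-monoˡ-≤ (2 ^ l) (m^n>0 2 l) ⟩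
  2 ^ l + 2 ^ l                  ≡⟨ cong (2 ^ l +_) (+-identityʳ (2 ^ l)) ⟨
  2 ^ suc l                      ≤⟨ ^-monoʳ-≤ 2 (+-monoˡ-≤ l (s≤s (z≤n {⌊log₂ n ⌋}))) ⟩
  2 ^ (l + l)                    ≡⟨ cong (λ k → 2 ^ (l + k)) (+-identityʳ l) ⟨
  2 ^ (2 * l)                    ∎
  where
  open ≤-Reasoning
  l = suc ⌊log₂ n ⌋

enough-space : ∀ E → ∃ λ c → ∀ n → ∃ λ e → logSpace c n ≡ suc e × (2 + n) ^ E < 2 ^ e
-- The exponent `2 * l * E` already bounds the power; the extra `2 * l`, at least 2, pays for
-- strictness and for the cell lost in passing from `suc e` to `e`.
enough-space E = 2 + 2 * E , λ n →
  let l = suc ⌊log₂ n ⌋ in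
  pred (logSpace (2 + 2 * E) n) , refl , (begin-strict
    (2 + n) ^ E                ≤⟨ ^-monoˡ-≤ E (2+n≤2^2l n) ⟩
    (2 ^ (2 * l)) ^ E          ≡⟨ ^-*-assoc 2 (2 * l) E ⟩
    2 ^ (2 * l * E)            <⟨ ^-monoʳ-< 2 (s≤s (s≤s z≤n)) {2 * l * E} ≤-refl ⟩
    2 ^ suc (2 * l * E)        ≤⟨ ^-monoʳ-≤ 2 (≤-pred (begin
      2 + 2 * l * E              ≤⟨ +-monoˡ-≤ (2 * l * E) (*-monoʳ-≤ 2 (s≤s (z≤n {⌊log₂ n ⌋}))) ⟩
      2 * l + 2 * l * E          ≡⟨ regroup l E ⟩
      (2 + 2 * E) * l            ∎)) ⟩
    2 ^ pred (logSpace (2 + 2 * E) n) ∎)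
  where
  open ≤-Reasoning
  regroup : ∀ l E → 2 * l + 2 * l * E ≡ (2 + 2 * E) * l
  regroup = solve-∀

-- From register programs to machines

module Realise {G : Set} (finG : Finite G) {k D : ℕ} (p : RProg G k D) (g₀ : G) where
  open Translate {G} {k} D
  open Columns {D + k} G using (Cell)

  init : ∀ x e → List Bool → List Bool → Exec₂.S₂ {G} {k} x e
  init x e ω y = Exec₂.st₂ g₀ (Vec.replicate k 0) zero ω y

  private
    F = G × Bool
    module W = Compile.Whole {F} {Cell} (×-finite finG Bool-finite)
      (Vec-finite (Maybe-finite Bool-finite) (D + k)) (Vec.replicate (D + k) nothing)
      (translate p ≤-refl) (g₀ , false)

  transducer : ∀ (f : List Bool → List Bool) E →
    (∀ x e → (2 + length x) ^ E < 2 ^ e →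
       ∃ λ τ → Exec₂.Exec x e p (init x e [] (f x)) τ × Exec₂.S₂.out τ ≡ []) →
    LogspaceComputable f
  transducer f E H =
    let c , space = enough-space E in
    toTransducer W.machine , c , λ x →
    let e , eq , lt = space (length x) in
    intro eq (computes x e (H x e lt))
    where
    intro : ∀ {T x y s e} → s ≡ suc e → ComputesInSpace T x (suc e) y → ComputesInSpace T x s y
    intro refl r = r
    computes : ∀ x e → (∃ λ τ → Exec₂.Exec x e p (init x e [] (f x)) τ × Exec₂.S₂.out τ ≡ []) →
               ComputesInSpace (toTransducer W.machine) x (suc e) (f x)
    computes x e (τ , run , o) =
      let fl , cs , run₁ = translate-initial x e run
          c , steps , home = W.run-whole x {e} run₁
      in Steps.toRun W.machine x steps o (W.final-halted x {c = c} (W.At.state≡ home))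

  accepting : (G → Bool) → Fin (Machine.nQ W.machine) → Bool
  accepting acc q with Finite.dec W.finQ q
  ... | just (nothing , (g , _)) = acc g
  ... | _ = false

  accepting-inv : ∀ acc q → accepting acc q ≡ true →
    ∃ λ m → Finite.dec W.finQ q ≡ just (nothing , m) × acc (proj₁ m) ≡ true
  accepting-inv acc q t with Finite.dec W.finQ q
  ... | just (nothing , m) = m , refl , t

  accepting-intro : ∀ acc q {m} → Finite.dec W.finQ q ≡ just (nothing , m) → acc (proj₁ m) ≡ true →
    accepting acc q ≡ true
  accepting-intro acc q e t with Finite.dec W.finQ q
  accepting-intro acc q refl t | just (nothing , m) = t

  recogniser : ∀ (acc : G → Bool) (L : Language) E →
    (∀ x e → (2 + length x) ^ E < 2 ^ e → L x →
       ∃ λ ω → ∃ λ τ → Exec₂.Exec x e p (init x e ω []) τ × acc (Exec₂.S₂.ctl τ) ≡ true) →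
    (∀ x e → (2 + length x) ^ E < 2 ^ e → ∀ ω →
       ∃ λ τ → Exec₂.Exec x e p (init x e ω []) τ × (acc (Exec₂.S₂.ctl τ) ≡ true → L x)) →
    NL L
  recogniser acc L E complete sound =
    let c , space = enough-space E in
    N , c , λ x →
    let e , eq , lt = space (length x) in
    (λ l → intro eq (accepts x e (complete x e lt l))) ,
    (λ a → rejects x e (sound x e lt) (elim eq a))
    where
    N = toNTM W.machine (accepting acc)
    intro : ∀ {x s e} → s ≡ suc e → AcceptsInSpace N x (suc e) → AcceptsInSpace N x s
    intro refl r = r
    elim : ∀ {x s e} → s ≡ suc e → AcceptsInSpace N x s → AcceptsInSpace N x (suc e)
    elim refl r = r
    accepts : ∀ x e → (∃ λ ω → ∃ λ τ → Exec₂.Exec x e p (init x e ω []) τ × acc (Exec₂.S₂.ctl τ) ≡ true) →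
      AcceptsInSpace N x (suc e)
    accepts x e (ω , τ , run , t) =
      let fl , cs , run₁ = translate-initial x e run
          c , steps , home = W.run-whole x {e} run₁
      in c , Steps.toStar W.machine x (accepting acc) steps ,
         accepting-intro acc (state c) (W.At.state≡ home) t
    rejects : ∀ x e →
      (∀ ω → ∃ λ τ → Exec₂.Exec x e p (init x e ω []) τ × (acc (Exec₂.S₂.ctl τ) ≡ true → L x)) →
      AcceptsInSpace N x (suc e) → L x
    rejects x e sound (c , star , t) =
      let ω , y , steps = Steps.fromStar W.machine x (accepting acc) star
          τ , run , imp = sound ω
          fl , cs , run₁ = translate-initial x e run
          c₁ , steps₁ , home = W.run-whole x {e} run₁
          m , ex , acc-t = accepting-inv acc (state c) t
          -- Both runs use the same choices and both end halted, so acceptance by the machine is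
          -- acceptance by the program.
          same = Steps.confluent W.machine x steps₁ steps
                   (W.final-halted x {c = c₁} (W.At.state≡ home)) (W.final-halted x {c = c} ex)
      in imp (subst (λ z → acc (proj₁ z) ≡ true)
               (exit-injective (trans (sym ex)
                 (trans (cong (λ c → Finite.dec W.finQ (state c)) (sym same)) (W.At.state≡ home)))) acc-t)
      where
      exit-injective : ∀ {S : Set} {m m' : F} → just {A = Maybe S × F} (nothing , m) ≡ just (nothing , m') → m ≡ m'
      exit-injective refl = refl

-- Mixed radix numbers of configurations

mixed-< : ∀ {A N a b} → a < A → b < N → a + A * b < A * N
mixed-< {A} {N} {a} {b} a<A b<N = begin-strict
  a + A * b   <⟨ +-monoˡ-< (A * b) a<A ⟩
  A + A * b   ≡⟨ *-suc A b ⟨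
  A * suc b   ≤⟨ *-monoʳ-≤ A b<N ⟩
  A * N       ∎
  where open ≤-Reasoning

-- Only the low digits are bounded. The free quotients allow a comparison with numbers that do not
-- belong to any configuration.
mixed-inj : ∀ {A a a'} b b' → a < A → a' < A → a + A * b ≡ a' + A * b' → a ≡ a' × b ≡ b'
mixed-inj {A} {a} {a'} zero zero _ _ eq =
  trans (sym (+-identityʳ a)) (trans (cong (a +_) (sym (*-zeroʳ A)))
    (trans eq (trans (cong (a' +_) (*-zeroʳ A)) (+-identityʳ a')))) , refl
mixed-inj {A} {a} {a'} zero (suc b') a<A _ eq = ⊥-elim (<-irrefl eq (begin-strict
  a + A * 0           ≡⟨ cong (a +_) (*-zeroʳ A) ⟩
  a + 0               ≡⟨ +-identityʳ a ⟩
  a                   <⟨ a<A ⟩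
  A                   ≤⟨ m≤m*n A (suc b') ⟩
  A * suc b'          ≤⟨ m≤n+m _ a' ⟩
  a' + A * suc b'     ∎))
  where open ≤-Reasoning
mixed-inj {A} {a} {a'} (suc b) zero a<A a'<A eq =
  let e₁ , e₂ = mixed-inj zero (suc b) a'<A a<A (sym eq) in sym e₁ , sym e₂
mixed-inj {A} {a} {a'} (suc b) (suc b') a<A a'<A eq =
  let e₁ , e₂ = mixed-inj b b' a<A a'<A (+-cancelˡ-≡ A _ _
                  (trans (sym (shift A a b)) (trans eq (shift A a' b'))))
  in e₁ , cong suc e₂
  where
  shift : ∀ A a b → a + A * suc b ≡ A + (a + A * b)
  shift = solve-∀

module Base (w : ℕ) where

  private B = suc w

  val : ∀ {s} → Vec (Fin B) s → ℕ
  val [] = 0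
  val (d ∷ t) = toℕ d + B * val t

  lo hi : ∀ {s} → Vec (Fin B) s → Fin s → ℕ
  lo (d ∷ t) zero = 0
  lo (d ∷ t) (suc h) = toℕ d + B * lo t h
  hi (d ∷ t) zero = val t
  hi (d ∷ t) (suc h) = hi t h

  val-split : ∀ {s} (t : Vec (Fin B) s) h →
              val t ≡ lo t h + B ^ toℕ h * (toℕ (lookup t h) + B * hi t h)
  val-split (d ∷ t) zero = sym (+-identityʳ _)
  val-split (d ∷ t) (suc h) = trans (cong (λ v → toℕ d + B * v) (val-split t h))
    (rearrange (toℕ d) B (lo t h) (B ^ toℕ h) _)
    where
    rearrange : ∀ d b l p z → d + b * (l + p * z) ≡ d + b * l + b * p * z
    rearrange = solve-∀

  val< : ∀ {s} (t : Vec (Fin B) s) → val t < B ^ s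
  val< [] = z<s
  val< (d ∷ t) = mixed-< (toℕ<n d) (val< t)

  lo< : ∀ {s} (t : Vec (Fin B) s) h → lo t h < B ^ toℕ h
  lo< (d ∷ t) zero = z<s
  lo< (d ∷ t) (suc h) = mixed-< (toℕ<n d) (lo< t h)

  -- A bound that does not depend on `h`, so that one loop bound serves all head positions.
  hi< : ∀ {s} (t : Vec (Fin B) s) h → hi t h < B ^ s
  hi< {suc s} (d ∷ t) zero = <-≤-trans (val< t) (m≤n*m (B ^ s) B)
  hi< {suc s} (d ∷ t) (suc h) = <-≤-trans (hi< t h) (m≤n*m (B ^ s) B)

  lo-update : ∀ {s} (t : Vec (Fin B) s) h a → lo (t [ h ]≔ a) h ≡ lo t h
  lo-update (d ∷ t) zero a = refl
  lo-update (d ∷ t) (suc h) a = cong (λ v → toℕ d + B * v) (lo-update t h a)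

  hi-update : ∀ {s} (t : Vec (Fin B) s) h a → hi (t [ h ]≔ a) h ≡ hi t h
  hi-update (d ∷ t) zero a = refl
  hi-update (d ∷ t) (suc h) a = hi-update t h a

  val-blank : ∀ s → val (Vec.replicate s zero) ≡ 0
  val-blank zero = refl
  val-blank (suc s) = trans (cong (B *_) (val-blank s)) (*-zeroʳ B)

  val-injective : ∀ {s} (t u : Vec (Fin B) s) → val t ≡ val u → t ≡ u
  val-injective [] [] _ = refl
  val-injective (d ∷ t) (d' ∷ u) eq =
    let e₁ , e₂ = mixed-inj (val t) (val u) (toℕ<n d) (toℕ<n d') eq
    in cong₂ _∷_ (toℕ-injective e₁) (val-injective t u e₂)

  module _ {q n s : ℕ} where

    number : ℕ → ℕ → ℕ → ℕ → ℕ
    number k i p v = k + q * (i + (2 + n) * (p + s * v))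

    index : Config q w n s → ℕ
    index c = number (toℕ (state c)) (toℕ (inHead c)) (toℕ (wHead c)) (val (tape c))

    number< : ∀ {k i p v V} → k < q → i < 2 + n → p < s → v < V →
              number k i p v < q * ((2 + n) * (s * V))
    number< k< i< p< v< = mixed-< k< (mixed-< i< (mixed-< p< v<))

    number-injective : ∀ {k i p k' i' p'} v v' → k < q → i < 2 + n → p < s →
      k' < q → i' < 2 + n → p' < s → number k i p v ≡ number k' i' p' v' →
      k ≡ k' × i ≡ i' × p ≡ p' × v ≡ v'
    number-injective v v' k< i< p< k'< i'< p'< eq =
      let e₁ , r₁ = mixed-inj _ _ k< k'< eq
          e₂ , r₂ = mixed-inj _ _ i< i'< r₁
          e₃ , e₄ = mixed-inj v v' p< p'< r₂
      in e₁ , e₂ , e₃ , e₄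

    index< : ∀ c → index c < q * ((2 + n) * (s * B ^ s))
    index< c = number< (toℕ<n (state c)) (toℕ<n (inHead c)) (toℕ<n (wHead c)) (val< (tape c))

    index-injective : ∀ c c' → index c ≡ index c' → c ≡ c'
    index-injective c@(config _ _ t _) c'@(config _ _ t' _) eq
      with number-injective (val t) (val t') (toℕ<n (state c)) (toℕ<n (inHead c)) (toℕ<n (wHead c))
             (toℕ<n (state c')) (toℕ<n (inHead c')) (toℕ<n (wHead c')) eq
    ... | e₁ , e₂ , e₃ , e₄
      with toℕ-injective e₁ | toℕ-injective e₂ | toℕ-injective e₃ | val-injective t t' e₄
    ... | refl | refl | refl | refl = refl

-- Polynomial bounds on configurations and run lengths

2^log₂≤ : ∀ n → 2 ^ ⌊log₂ suc n ⌋ ≤ suc n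
2^log₂≤ = <-rec _ go
  where
  go : ∀ n → (∀ {m} → m < n → 2 ^ ⌊log₂ suc m ⌋ ≤ suc m) → 2 ^ ⌊log₂ suc n ⌋ ≤ suc n
  go zero _ = ≤-refl
  go (suc n) rec = begin
    2 ^ ⌊log₂ suc (suc n) ⌋           ≡⟨ cong (2 ^_) (log₂-half (suc (suc n)) (s≤s (s≤s z≤n))) ⟩
    2 * 2 ^ ⌊log₂ suc ⌊ n /2⌋ ⌋       ≤⟨ *-monoʳ-≤ 2 (rec (s≤s (⌊n/2⌋≤n n))) ⟩
    2 * suc ⌊ n /2⌋                   ≡⟨ *-suc 2 ⌊ n /2⌋ ⟩
    2 + 2 * ⌊ n /2⌋                   ≤⟨ +-monoʳ-≤ 2 (double-half n) ⟩
    2 + n                             ∎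
    where
    open ≤-Reasoning
    double-half : ∀ n → 2 * ⌊ n /2⌋ ≤ n
    double-half zero = z≤n
    double-half (suc zero) = z≤n
    double-half (suc (suc n)) = subst (_≤ 2 + n) (sym (*-suc 2 ⌊ n /2⌋)) (s≤s (s≤s (double-half n)))

2^l≤ : ∀ n → 2 ^ suc ⌊log₂ n ⌋ ≤ (2 + n) ^ 2
2^l≤ zero = s≤s (s≤s z≤n)
2^l≤ (suc n) = *-mono-≤ {2} {3 + n} (s≤s (s≤s z≤n))
  (≤-trans (2^log₂≤ n) (≤-trans (m≤n+m (suc n) 2) (≤-reflexive (sym (*-identityʳ (3 + n))))))

n<2^n : ∀ n → n < 2 ^ n
n<2^n zero = z<s
n<2^n (suc n) = begin-strict
  suc n            ≤⟨ n<2^n n ⟩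
  2 ^ n            <⟨ m<m+n (2 ^ n) (m^n>0 2 n) ⟩
  2 ^ n + 2 ^ n    ≡⟨ cong (2 ^ n +_) (+-identityʳ (2 ^ n)) ⟨
  2 ^ suc n        ∎
  where open ≤-Reasoning

-- Turns a constant factor into a summand of the exponent.
n≤pow : ∀ n m → n ≤ (2 + m) ^ n
n≤pow n m = ≤-trans (<⇒≤ (n<2^n n)) (^-monoˡ-≤ n (s≤s (s≤s (z≤n {m}))))

power-bound : ∀ b c n → b ^ logSpace c n ≤ (2 + n) ^ (2 * (b * c))
power-bound b c n = begin
  b ^ (c * l)              ≤⟨ ^-monoˡ-≤ (c * l) (<⇒≤ (n<2^n b)) ⟩
  (2 ^ b) ^ (c * l)        ≡⟨ ^-*-assoc 2 b (c * l) ⟩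
  2 ^ (b * (c * l))        ≡⟨ cong (2 ^_) (trans (sym (*-assoc b c l)) (*-comm (b * c) l)) ⟩
  2 ^ (l * (b * c))        ≡⟨ ^-*-assoc 2 l (b * c) ⟨
  (2 ^ l) ^ (b * c)        ≤⟨ ^-monoˡ-≤ (b * c) (2^l≤ n) ⟩
  ((2 + n) ^ 2) ^ (b * c)  ≡⟨ ^-*-assoc (2 + n) 2 (b * c) ⟩
  (2 + n) ^ (2 * (b * c))  ∎
  where
  open ≤-Reasoning
  l = suc ⌊log₂ n ⌋

-- The exponent has one summand per factor: `q` for the states, 1 for the input position, then `s`
-- through `s ≤ 2 ^ s`, and `b ^ s`, both by `power-bound`.
configs-bound : ∀ q b c n → q * ((2 + n) * (logSpace c n * b ^ logSpace c n)) ≤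
                            (2 + n) ^ (q + (1 + (2 * (2 * c) + 2 * (b * c))))
configs-bound q b c n = begin
  q * (m * (s * b ^ s))                                     ≤⟨ *-mono-≤ (n≤pow q n)
    (*-mono-≤ (≤-reflexive (sym (^-identityʳ m)))
      (*-mono-≤ (≤-trans (<⇒≤ (n<2^n s)) (power-bound 2 c n)) (power-bound b c n))) ⟩
  m ^ q * (m ^ 1 * (m ^ (2 * (2 * c)) * m ^ (2 * (b * c))))   ≡⟨ cong (λ z → m ^ q * (m ^ 1 * z))
    (^-distribˡ-+-* m (2 * (2 * c)) (2 * (b * c))) ⟨
  m ^ q * (m ^ 1 * m ^ (2 * (2 * c) + 2 * (b * c)))           ≡⟨ cong (m ^ q *_)
    (^-distribˡ-+-* m 1 (2 * (2 * c) + 2 * (b * c))) ⟨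
  m ^ q * m ^ (1 + (2 * (2 * c) + 2 * (b * c)))               ≡⟨
    ^-distribˡ-+-* m q (1 + (2 * (2 * c) + 2 * (b * c))) ⟨
  m ^ (q + (1 + (2 * (2 * c) + 2 * (b * c))))                 ∎
  where
  open ≤-Reasoning
  m = 2 + n
  s = logSpace c n

-- A halting deterministic run never repeats a configuration.
module _ {T : Transducer} {x : List Bool} {s : ℕ} where

  runLength : ∀ {c : TConfig T x s} {y} → Run T x c y → ℕ
  runLength (halt _) = 0
  runLength (step _ _ _ r) = suc (runLength r)

  length≤runLength : ∀ {c : TConfig T x s} {y} (r : Run T x c y) → length y ≤ runLength r
  length≤runLength (halt _) = z≤n
  length≤runLength (step {o = nothing} _ _ _ r) = m≤n⇒m≤1+n (length≤runLength r)
  length≤runLength (step {o = just _} _ _ _ r) = s≤s (length≤runLength r)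

  runLength-unique : ∀ {c : TConfig T x s} {y y'} (r : Run T x c y) (r' : Run T x c y') →
                     runLength r ≡ runLength r'
  runLength-unique (halt _) (halt _) = refl
  runLength-unique (halt e) (step e' _ _ _) with trans (sym e) e'
  ... | ()
  runLength-unique (step e _ _ _) (halt e') with trans (sym e) e'
  ... | ()
  runLength-unique (step e mi mw r) (step e' mi' mw' r') with trans (sym e) e'
  ... | refl with just-injective (trans (sym mi) mi') | just-injective (trans (sym mw) mw')
  ... | refl | refl = cong suc (runLength-unique r r')

  visit : ∀ {c : TConfig T x s} {y} (r : Run T x c y) i → i ≤ runLength r →
          ∃ λ c' → ∃ λ y' → Σ (Run T x c' y') λ r' → i + runLength r' ≡ runLength r
  visit r zero _ = _ , _ , r , refl
  visit (step _ _ _ r) (suc i) (s≤s le) =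
    let c' , y' , r' , e = visit r i le in c' , y' , r' , cong suc e

  -- If steps `i` and `j` met the same configuration, determinism would make the remaining runs
  -- equally long, hence `i` and `j` equal. So the visits inject into the configuration numbers.
  runLength-bound : ∀ {c : TConfig T x s} {y} (r : Run T x c y) →
    let b = suc (Transducer.symbols T) in
    runLength r < Transducer.states T * ((2 + length x) * (s * b ^ s))
  runLength-bound {c} r with runLength r <? K
    where K = Transducer.states T * ((2 + length x) * (s * suc (Transducer.symbols T) ^ s))
  ... | yes lt = lt
  ... | no ¬lt =
    let i , j , i<j , eq = Finₚ.pigeonhole (s≤s (≮⇒≥ ¬lt))
          (λ i → fromℕ< (index< (proj₁ (visit r (toℕ i) (≤-pred (toℕ<n i))))))
        ci , _ , ri , ei = visit r (toℕ i) (≤-pred (toℕ<n i))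
        cj , _ , rj , ej = visit r (toℕ j) (≤-pred (toℕ<n j))
        same = index-injective ci cj (Finₚ.fromℕ<-injective _ _ (index< ci) (index< cj) eq)
    in ⊥-elim (<⇒≢ i<j (+-cancelʳ-≡ (runLength rj) (toℕ i) (toℕ j)
         (trans (cong (toℕ i +_) (sym (equal-lengths same ri rj))) (trans ei (sym ej)))))
    where
    open Base (Transducer.symbols T)
    equal-lengths : ∀ {c c' : TConfig T x s} {y y'} → c ≡ c' → (r : Run T x c y) (r' : Run T x c' y') →
                    runLength r ≡ runLength r'
    equal-lengths refl = runLength-unique

-- Balanced walks of bounded height

-- Nested derivations give a walk of height at most n²: on a deepest branch
-- with more nestings two of them join the same pair of vertices, and the outer
-- one may be replaced by the inner one.
module Dyck {n : ℕ} (E : List (Fin n × Label × Fin n)) where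

  data Balanced : Fin n → Fin n → Set where
    nil  : ∀ {u} → Balanced u u
    flat : ∀ {u v} → (u , eps , v) ∈ E → Balanced u v
    _∙_  : ∀ {u v w} → Balanced u v → Balanced v w → Balanced u w
    wrap : ∀ {u a b v} → (u , push , a) ∈ E → Balanced a b → (b , pop , v) ∈ E → Balanced u v

  split-walk : ∀ w {w' u t} → Walk E u t (w ++ w') → ∃ λ v → Walk E u v w × Walk E v t w'
  split-walk [] W = _ , here , W
  split-walk (l ∷ w) (edge e W) = let v , W₁ , W₂ = split-walk w W in v , edge e W₁ , W₂

  balance : ∀ {w u v} → Gen w → Walk E u v w → Balanced u v
  balance empty here = nil
  balance ε-rule (edge e here) = flat e
  balance (cat {u = w} g g') W =
    let _ , W₁ , W₂ = split-walk w W in balance g W₁ ∙ balance g' W₂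
  balance (nest {u = w} g) (edge e W) with split-walk w W
  ... | _ , W₁ , edge e' here = wrap e (balance g W₁) e'

  size : ∀ {u v} → Balanced u v → ℕ
  size nil = 0
  size (flat _) = 0
  size (t ∙ t') = suc (size t + size t')
  size (wrap _ t _) = suc (size t)

  depth : ∀ {u v} → Balanced u v → ℕ
  depth nil = 0
  depth (flat _) = 0
  depth (t ∙ t') = depth t ⊔ depth t'
  depth (wrap _ t _) = suc (depth t)

  -- The endpoints of the nestings along a deepest branch, outermost first.
  spine : ∀ {u v} → Balanced u v → List (Fin n × Fin n)
  spine nil = []
  spine (flat _) = []
  spine (t ∙ t') with ≤-total (depth t) (depth t')
  ... | inj₁ _ = spine t'
  ... | inj₂ _ = spine t
  spine (wrap {u} {_} {_} {v} _ t _) = (u , v) ∷ spine t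

  length-spine : ∀ {u v} (t : Balanced u v) → length (spine t) ≡ depth t
  length-spine nil = refl
  length-spine (flat _) = refl
  length-spine (t ∙ t') with ≤-total (depth t) (depth t')
  ... | inj₁ le = trans (length-spine t') (sym (m≤n⇒m⊔n≡n le))
  ... | inj₂ le = trans (length-spine t) (sym (m≥n⇒m⊔n≡m le))
  length-spine (wrap _ t _) = cong suc (length-spine t)

  subtree : ∀ {u v} (t : Balanced u v) i → let (a , b) = List.lookup (spine t) i in
            Σ (Balanced a b) λ t' → size t' ≤ size t
  subtree (t ∙ t') i with ≤-total (depth t) (depth t')
  ... | inj₁ _ = let s , le = subtree t' i in s , m≤n⇒m≤1+n (≤-trans le (m≤n+m _ (size t)))
  ... | inj₂ _ = let s , le = subtree t i in s , m≤n⇒m≤1+n (≤-trans le (m≤m+n _ (size t')))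
  subtree t@(wrap _ _ _) zero = t , ≤-refl
  subtree (wrap _ t _) (suc i) = let s , le = subtree t i in s , m≤n⇒m≤1+n le

  cut : ∀ {u v} (t : Balanced u v) i j → i Fin.< j → List.lookup (spine t) i ≡ List.lookup (spine t) j →
        Σ (Balanced u v) λ t' → size t' < size t
  cut (t ∙ t') i j lt eq with ≤-total (depth t) (depth t')
  ... | inj₁ _ = let s , le = cut t' i j lt eq in t ∙ s , s≤s (+-monoʳ-< (size t) le)
  ... | inj₂ _ = let s , le = cut t i j lt eq in s ∙ t' , s≤s (+-monoˡ-< (size t') le)
  cut (wrap {u} {_} {_} {v} _ t _) zero (suc j) lt eq =
    let s , le = subtree t j in
    subst (λ (a , b) → Σ (Balanced a b) λ t' → size t' < suc (size t)) (sym eq) (s , s≤s le)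
  cut (wrap e t e') (suc i) (suc j) (s≤s lt) eq =
    let s , le = cut t i j lt eq in wrap e s e' , s≤s le

  -- A cut need not lower the depth, as another branch may be equally deep, so the recursion is on
  -- the size. The pigeonholes are the `n * n` pairs of vertices.
  shallow : ∀ {u v} → Balanced u v → Σ (Balanced u v) λ t → depth t ≤ n * n
  shallow t = go t (<-wellFounded (size t))
    where
    go : ∀ {u v} (t : Balanced u v) → Acc _<_ (size t) → Σ (Balanced u v) λ t → depth t ≤ n * n
    go t (wf rec) with n * n <? depth t
    ... | no ¬lt = t , ≮⇒≥ ¬lt
    ... | yes lt =
      let pair = λ i → List.lookup (spine t) i
          i , j , i<j , eq = Finₚ.pigeonhole (subst (n * n <_) (sym (length-spine t)) lt)
                               (λ i → combine (proj₁ (pair i)) (proj₂ (pair i)))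
          e₁ , e₂ = Finₚ.combine-injective (proj₁ (pair i)) (proj₂ (pair i)) (proj₁ (pair j)) (proj₂ (pair j)) eq
          t' , smaller = cut t i j i<j (cong₂ _,_ e₁ e₂)
      in go t' (rec smaller)

  -- The second component counts unmatched pushes; with the cap `H`, membership in the grammar
  -- becomes reachability with a bounded counter.
  data Climb (H : ℕ) : Fin n × ℕ → Fin n × ℕ → Set where
    level : ∀ {u v h} → (u , eps , v) ∈ E → Climb H (u , h) (v , h)
    up    : ∀ {u v h} → h < H → (u , push , v) ∈ E → Climb H (u , h) (v , suc h)
    down  : ∀ {u v h} → (u , pop , v) ∈ E → Climb H (u , suc h) (v , h)

  climb : ∀ {H u v} (t : Balanced u v) h → h + depth t ≤ H → Star (Climb H) (u , h) (v , h)
  climb nil h le = ε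
  climb (flat e) h le = level e ◅ ε
  climb (t ∙ t') h le =
    climb t h (≤-trans (+-monoʳ-≤ h (m≤m⊔n (depth t) (depth t'))) le) ◅◅
    climb t' h (≤-trans (+-monoʳ-≤ h (m≤n⊔m (depth t) (depth t'))) le)
  climb {H} (wrap e t e') h le =
    let le' = subst (_≤ H) (+-suc h (depth t)) le in
    up (≤-trans (s≤s (m≤m+n h (depth t))) le') e ◅ (climb t (suc h) le' ◅◅ down e' ◅ ε)

  climbable : ∀ {w u v} → Gen w → Walk E u v w → Star (Climb (n * n)) (u , 0) (v , 0)
  climbable g W = let t , le = shallow (balance g W) in climb t 0 le

  -- words that become balanced after h opening pushes
  data Closing : ℕ → List Label → Set where
    last : ∀ {w} → Gen w → Closing 0 w
    pop  : ∀ {h w w'} → Gen w → Closing h w' → Closing (suc h) (w ++ pop ∷ w')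

  prepend : ∀ {h l w} → Gen l → Closing h w → Closing h (l ++ w)
  prepend g (last g') = last (cat g g')
  prepend {l = l} g (pop {w = w} {w'} g' C) =
    subst (Closing _) (++-assoc l w (pop ∷ w')) (pop (cat g g') C)

  -- A tail of a climb is not balanced by itself, so the induction carries `Closing`: a push put in
  -- front is matched with the first unmatched pop of the tail.
  walk-of-climb : ∀ {H u h v} → Star (Climb H) (u , h) (v , 0) → ∃ λ w → Walk E u v w × Closing h w
  walk-of-climb ε = [] , here , last empty
  walk-of-climb (level e ◅ S) =
    let w , W , C = walk-of-climb S in eps ∷ w , edge e W , prepend ε-rule C
  walk-of-climb (down e ◅ S) =
    let w , W , C = walk-of-climb S in pop ∷ w , edge e W , pop empty C
  walk-of-climb (up _ e ◅ S) with walk-of-climb S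
  ... | _ , W , pop {w = w} {w'} g C =
    push ∷ w ++ pop ∷ w' , edge e W ,
    subst (Closing _) (cong (push ∷_) (++-assoc w [ pop ] w')) (prepend (nest g) C)

  yes-of-climb : ∀ {H u v} → Star (Climb H) (u , 0) (v , 0) → ∃ λ w → Walk E u v w × Gen w
  yes-of-climb S with walk-of-climb S
  ... | w , W , last g = w , W , g

-- Loops and unary output

module Macros {G : Set} {k : ℕ} (x : List Bool) (e : ℕ) where
  open Exec₂ {G} {k} x e public

  -- A loop invariant given as a family: `f j` is the entire state after `j` rounds.
  iter-family : ∀ {d} {p : RProg G k d} n (f : ℕ → S₂) → (∀ j → j < n → Exec p (f j) (f (suc j))) →
                Iter p n (f 0) (f n)
  iter-family zero f E = done
  iter-family (suc n) f E = more (E 0 z<s) (iter-family n (f ∘ suc) (λ j lt → E (suc j) (s<s lt)))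

  with-out : ∀ {d} {p : RProg G k d} {g rs i ω y y' τ} → y ≡ y' →
             Exec p (st₂ g rs i ω y) τ → Exec p (st₂ g rs i ω y') τ
  with-out refl E = E

repeat : ∀ {G k d} → ℕ → RProg G k d → RProg G k d
repeat zero p = skip
repeat (suc n) p = seq p (repeat n p)

putBit : ∀ {G k d} → Bool → RProg G k d
putBit b = act (λ g _ → g , stay , just b)

putBits : ∀ {G k d} → List Bool → RProg G k d
putBits [] = skip
putBits (b ∷ bs) = seq (putBit b) (putBits bs)

silently : ∀ {G k d} → (G → G) → RProg G k d
silently f = act (λ g _ → f g , stay , nothing)

shiftHead : ∀ {G k d} → Dir → RProg G k d
shiftHead d = act (λ g _ → g , d , nothing)

-- d is the loop depth needed to evaluate the polynomial
data Poly (k : ℕ) : ℕ → Set where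
  one : ∀ {d} → Poly k d
  _⊕_ : ∀ {d} → Poly k d → Poly k d → Poly k d
  _·_ : ∀ {d} → ℕ → Poly k d → Poly k d
  _⊛_ : ∀ {d} → Fin k → Poly k d → Poly k (suc d)

infixr 6 _⊕_
infixr 7 _·_ _⊛_

evalPoly : ∀ {k d} → Poly k d → Vec ℕ k → ℕ
evalPoly one rs = 1
evalPoly (p ⊕ q) rs = evalPoly p rs + evalPoly q rs
evalPoly (m · p) rs = m * evalPoly p rs
evalPoly (r ⊛ p) rs = lookup rs r * evalPoly p rs

-- The value is counted out by nested loops and never stored, so it need not fit into a register.
-- `a` is polymorphic because it ends up under different numbers of loops.
times : ∀ {G k d d'} → Poly k d' → (∀ {d} → RProg G k d) → d' ≤ d → RProg G k d
times one a le = a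
times (p ⊕ q) a le = seq (times p a le) (times q a le)
times (m · p) a le = repeat m (times p a le)
times (r ⊛ p) a (s≤s le) = for r (times p a le)

putUnary : ∀ {G k d} → Poly k d → RProg G k d
putUnary p = seq (times p (putBit true) ≤-refl) (putBit false)

replicate-+ : ∀ {A : Set} {a : A} m n → replicate (m + n) a ≡ replicate m a ++ replicate n a
replicate-+ zero n = refl
replicate-+ (suc m) n = cong (_ ∷_) (replicate-+ m n)

bigcat : ∀ {A : Set} → ℕ → (ℕ → List A) → List A
bigcat zero f = []
bigcat (suc n) f = f 0 ++ bigcat n (f ∘ suc)

∈-bigcat⁺ : ∀ {A : Set} {a : A} n (f : ℕ → List A) {j} → j < n → a ∈ f j → a ∈ bigcat n f
∈-bigcat⁺ (suc n) f {zero} lt m = ∈-++⁺ˡ m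
∈-bigcat⁺ (suc n) f {suc j} (s≤s lt) m = ∈-++⁺ʳ (f 0) (∈-bigcat⁺ n (f ∘ suc) lt m)

∈-bigcat⁻ : ∀ {A : Set} {a : A} n (f : ℕ → List A) → a ∈ bigcat n f → ∃ λ j → j < n × a ∈ f j
∈-bigcat⁻ (suc n) f m with ∈-++⁻ (f 0) m
... | inj₁ m' = 0 , z<s , m'
... | inj₂ m' = let j , lt , m'' = ∈-bigcat⁻ n (f ∘ suc) m' in suc j , s<s lt , m''

concatMap-bigcat : ∀ {A B : Set} (g : A → List B) n f →
                   concatMap g (bigcat n f) ≡ bigcat n (λ j → concatMap g (f j))
concatMap-bigcat g zero f = refl
concatMap-bigcat g (suc n) f =
  trans (Listₚ.concatMap-++ g (f 0) (bigcat n (f ∘ suc)))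
        (cong (concatMap g (f 0) ++_) (concatMap-bigcat g n (f ∘ suc)))

module Output {G : Set} {k : ℕ} (x : List Bool) (e : ℕ) where
  open Macros {G} {k} x e

  -- The state records the output still due, so printing `l` means removing it as a prefix of an
  -- arbitrary rest.
  Emits : ∀ {d} → RProg G k d → G → Vec ℕ k → Fin (2 + length x) → List Bool → Set
  Emits p g rs i l = ∀ {ω} y → Exec p (st₂ g rs i ω (l ++ y)) (st₂ g rs i ω y)

  emits-skip : ∀ {d g rs i} → Emits (skip {d = d}) g rs i []
  emits-skip y = skip

  emits-bit : ∀ {d} b {g rs i} → Emits (putBit {d = d} b) g rs i [ b ]
  emits-bit b y = act {o = just b} refl

  emits-seq : ∀ {d g rs i l l'} {p q : RProg G k d} → Emits p g rs i l → Emits q g rs i l' →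
              Emits (seq p q) g rs i (l ++ l')
  emits-seq {l = l} {l'} P Q y =
    seq (with-out (sym (++-assoc l l' y)) (P (l' ++ y))) (Q y)

  emits-bits : ∀ {d g rs i} bs → Emits (putBits {d = d} bs) g rs i bs
  emits-bits [] = emits-skip
  emits-bits (b ∷ bs) = emits-seq (emits-bit b) (emits-bits bs)

  emits-repeat : ∀ {d g rs i m} n {p : RProg G k d} → Emits p g rs i (replicate m true) →
                 Emits (repeat n p) g rs i (replicate (n * m) true)
  emits-repeat zero P y = skip
  emits-repeat {d} {g} {rs} {i} {m} (suc n) P =
    subst (Emits _ g rs i) (sym (replicate-+ m (n * m))) (emits-seq P (emits-repeat n P))

  emits-for : ∀ {d g rs i r m} {p : RProg G k d} → Emits p g rs i (replicate m true) →
              Emits (for r p) g rs i (replicate (lookup rs r * m) true)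
  emits-for {d} {g} {rs} {i} {r} {m} {p} P y = for (go (lookup rs r))
    where
    go : ∀ {ω} n → Iter p n (st₂ g rs i ω (replicate (n * m) true ++ y)) (st₂ g rs i ω y)
    go zero = done
    go (suc n) = more (with-out
      (trans (sym (++-assoc (replicate m true) _ y))
        (cong (_++ y) (sym (replicate-+ m (n * m))))) (P _)) (go n)

  emits-times : ∀ {d d' g rs i} (p : Poly k d') (le : d' ≤ d) →
                Emits (times p (putBit true) le) g rs i (replicate (evalPoly p rs) true)
  emits-times one le = emits-bit true
  emits-times {g = g} {rs} {i} (p ⊕ q) le =
    subst (Emits _ g rs i) (sym (replicate-+ (evalPoly p rs) _))
      (emits-seq (emits-times p le) (emits-times q le))
  emits-times (m · p) le = emits-repeat m (emits-times p le)
  emits-times (r ⊛ p) (s≤s le) = emits-for {r = r} (emits-times p le)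

  emits-unary : ∀ {d g rs i} (p : Poly k d) → Emits (putUnary p) g rs i (unary (evalPoly p rs))
  emits-unary p = emits-seq (emits-times p ≤-refl) (emits-bit false)

  iter-emits : ∀ {d g ω} {p : RProg G k d} n (rs : ℕ → Vec ℕ k) (i : ℕ → Fin (2 + length x))
    (l : ℕ → List Bool) →
    (∀ j → j < n → ∀ y → Exec p (st₂ g (rs j) (i j) ω (l j ++ y)) (st₂ g (rs (suc j)) (i (suc j)) ω y)) →
    ∀ y → Iter p n (st₂ g (rs 0) (i 0) ω (bigcat n l ++ y)) (st₂ g (rs n) (i n) ω y)
  iter-emits zero rs i l E y = done
  iter-emits {p = p} (suc n) rs i l E y =
    more (with-out (sym (++-assoc (l 0) _ y)) (E 0 z<s _))
         (iter-emits n (rs ∘ suc) (i ∘ suc) (l ∘ suc) (λ j lt → E (suc j) (s<s lt)) y)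

-- Head moves as arithmetic, and graphs of numbered arcs

infixr 5 _⨾_

_⨾_ : ∀ {G k d} → RProg G k d → RProg G k d → RProg G k d
_⨾_ = seq

atLend atRend : InSym → Bool
atLend lend = true
atLend _ = false
atRend rend = true
atRend _ = false

blocked : Dir → Bool → Bool → Bool
blocked left l r = l
blocked stay l r = false
blocked right l r = r

shifted : Dir → ℕ → ℕ
shifted left k = pred k
shifted stay k = k
shifted right k = suc k

-- `move` on numbers, with both ends given as flags. For the input head the flags come from the
-- symbol read, for the work head from zero tests of registers.
shift : Dir → Bool → Bool → ℕ → Maybe ℕ
shift d l r k = if blocked d l r then nothing else just (shifted d k)

move-shift : ∀ {m} d (i : Fin m) →
  Maybe.map toℕ (move d i) ≡ shift d (isZero (toℕ i)) (isZero (m ∸ suc (toℕ i))) (toℕ i)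
move-shift left zero = refl
move-shift left (suc i) = cong just (toℕ-inject₁ i)
move-shift stay i = refl
move-shift {m} right i with suc (toℕ i) <? m
... | yes lt = trans (cong just (toℕ-fromℕ< lt)) (sym (cong (λ z → if isZero z then nothing else just (suc (toℕ i))) (room lt)))
  where
  room : ∀ {k} → suc k < m → m ∸ suc k ≡ suc (m ∸ suc (suc k))
  room {k} lt = +-∸-assoc 1 lt
... | no ¬lt = sym (cong (λ z → if isZero z then nothing else just (suc (toℕ i)))
                 (m≤n⇒m∸n≡0 {m} (≮⇒≥ ¬lt)))

atLend-readIn : ∀ x (i : Fin (2 + length x)) → atLend (readIn x (toℕ i)) ≡ isZero (toℕ i)
atLend-readIn x zero = refl
atLend-readIn x (suc i) with readIn x (suc (toℕ i)) in eq
... | lend = ⊥-elim (readIn-lend x (suc i) (λ ()) eq)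
... | rend = refl
... | bit _ = refl

atRend-readIn : ∀ x (i : Fin (2 + length x)) →
                atRend (readIn x (toℕ i)) ≡ isZero (2 + length x ∸ suc (toℕ i))
atRend-readIn x i with toℕ i ≤? length x
... | no ¬le = trans (cong atRend (trans (cong (readIn x) last) (readIn-last x)))
                 (cong isZero (sym (m≤n⇒m∸n≡0 (≤-reflexive (cong suc (sym last))))))
  where
  last : toℕ i ≡ suc (length x)
  last = ≤-antisym (≤-pred (toℕ<n i)) (≰⇒> ¬le)
... | yes le = trans (inner (readIn x (toℕ i)) (readIn-rend x (toℕ i) le))
                 (sym (cong isZero (+-∸-assoc 1 le)))
  where
  inner : ∀ a → a ≢ rend → atRend a ≡ false
  inner lend _ = refl
  inner rend ne = ⊥-elim (ne refl)
  inner (bit _) _ = refl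

encArc : ℕ × ℕ → List Bool
encArc (u , v) = true ∷ unary u ++ unary v ++ labBits eps

-- Vertices are the numbers up to `V`; `V` itself is the target and stands for acceptance.
module ArcGraph (V src : ℕ) (arcs : List (ℕ × ℕ)) (bound : ∀ {u v} → (u , v) ∈ arcs → u ≤ V × v ≤ V) where

  -- Total, because the bound is available only for numbers that occur in `arcs`.
  clampTo : ℕ → Fin (suc V)
  clampTo u = fromℕ< (s≤s (m⊓n≤n u V))

  toℕ-clampTo : ∀ {u} → u ≤ V → toℕ (clampTo u) ≡ u
  toℕ-clampTo le = trans (toℕ-fromℕ< _) (m≤n⇒m⊓n≡m le)

  clampTo-injective : ∀ {u v} → u ≤ V → v ≤ V → clampTo u ≡ clampTo v → u ≡ v
  clampTo-injective u≤ v≤ eq = trans (sym (toℕ-clampTo u≤)) (trans (cong toℕ eq) (toℕ-clampTo v≤))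

  arcToEdge : ℕ × ℕ → Fin (suc V) × Label × Fin (suc V)
  arcToEdge (u , v) = clampTo u , eps , clampTo v

  edges : List (Fin (suc V) × Label × Fin (suc V))
  edges = map arcToEdge arcs

  graph : Instance
  graph = mkInstance (suc V) (clampTo src) (clampTo V) edges

  encode-arcs : ∀ l → (∀ {u v} → (u , v) ∈ l → u ≤ V × v ≤ V) →
                concatMap encEdge (map arcToEdge l) ≡ concatMap encArc l
  encode-arcs [] b = refl
  encode-arcs ((u , v) ∷ l) b =
    cong₂ _++_ (cong₂ (λ a c → true ∷ unary a ++ unary c ++ labBits eps)
                 (toℕ-clampTo (proj₁ (b (here refl)))) (toℕ-clampTo (proj₂ (b (here refl)))))
               (encode-arcs l (b ∘ there))

  encode-graph : src ≤ V → encode graph ≡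
    unary (suc V) ++ unary src ++ unary V ++ concatMap encArc arcs ++ [ false ]
  encode-graph le = cong₂ (λ a b → unary (suc V) ++ unary a ++ b)
    (toℕ-clampTo le) (cong₂ (λ a b → unary a ++ b ++ [ false ]) (toℕ-clampTo ≤-refl) (encode-arcs arcs bound))

  eps-gen : ∀ {u v w} → Walk edges u v w → Gen w
  eps-gen here = empty
  eps-gen (edge m W) with ∈-map⁻ arcToEdge m
  ... | _ , _ , refl = cat ε-rule (eps-gen W)

  module Runs {C : Set} (_⇒_ : C → C → Set) (acc : C → Bool) (num : C → ℕ)
    (num<    : ∀ c → num c < V)
    (forward : ∀ {c c'} → c ⇒ c' → (num c , num c') ∈ arcs)
    (accepts : ∀ c → acc c ≡ true → (num c , V) ∈ arcs)
    (sound   : ∀ c {v} → (num c , v) ∈ arcs → (v ≡ V × acc c ≡ true) ⊎ ∃ λ c' → c ⇒ c' × v ≡ num c')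
    where

    walk-of-run : ∀ {c c'} → Star _⇒_ c c' → acc c' ≡ true →
                  ∃ λ w → Walk edges (clampTo (num c)) (clampTo V) w
    walk-of-run {c} ε t = _ , edge (∈-map⁺ arcToEdge (accepts c t)) here
    walk-of-run (st ◅ r) t =
      let _ , W = walk-of-run r t in _ , edge (∈-map⁺ arcToEdge (forward st)) W

    -- `arcs` may join numbers that name no configuration. A walk from a configuration does not meet
    -- them before acceptance: by `sound`, each arc leads to a configuration number again or
    -- witnesses acceptance.
    run-of-walk : ∀ c {u t w} → Walk edges u t w → u ≡ clampTo (num c) → t ≡ clampTo V →
                  ∃ λ c' → Star _⇒_ c c' × acc c' ≡ true
    run-of-walk c here eu et =
      -- An empty walk would identify `num c` with the target `V`, but `num c < V`.
      ⊥-elim (<-irrefl (clampTo-injective (<⇒≤ (num< c)) ≤-refl (trans (sym eu) et)) (num< c))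
    run-of-walk c (edge m W) eu et with ∈-map⁻ arcToEdge m
    ... | (a , b) , m' , refl with clampTo-injective (proj₁ (bound m')) (<⇒≤ (num< c)) eu
    ... | refl with sound c m'
    ... | inj₁ (_ , t) = c , ε , t
    ... | inj₂ (c' , st , refl) =
      let c'' , r , t = run-of-walk c' W refl et in c'' , st ◅ r , t

    reachable : ∀ c → num c ≡ src →
      (YesInstance graph → ∃ λ c' → Star _⇒_ c c' × acc c' ≡ true) ×
      ((∃ λ c' → Star _⇒_ c c' × acc c' ≡ true) → YesInstance graph)
    reachable c refl =
      (λ (w , W , _) → run-of-walk c W refl refl) ,
      (λ (c' , r , t) → let w , W = walk-of-run r t in w , W , eps-gen W)

-- The configuration graph

data Rule (N : NTM) : Set where
  final : Fin (NTM.states N) → Fin (suc (NTM.symbols N)) → Rule N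
  go    : Fin (NTM.states N) → Fin (suc (NTM.symbols N)) →
          Fin (NTM.states N) × Fin (suc (NTM.symbols N)) × Dir × Dir → Rule N

module ConfigGraph (N : NTM) where

  Q B : ℕ
  Q = NTM.states N
  B = suc (NTM.symbols N)

  open Base (NTM.symbols N)

  finals : Fin Q → Fin B → List (Rule N)
  finals q b = if NTM.accept N q then [ final q b ] else []

  rulesAt : InSym → Fin Q → Fin B → List (Rule N)
  rulesAt a q b = finals q b ++ map (go q b) (NTM.δ N q a b)

  rulesFrom : InSym → Fin Q → List (Rule N)
  rulesFrom a q = concatMap (rulesAt a q) (List.allFin B)

  -- States and tape symbols are enumerated here, when the printing program is built, and not by its
  -- loops.
  rules : InSym → List (Rule N)
  rules a = concatMap (rulesFrom a) (List.allFin Q)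

  rule⁺ : ∀ a q b {r} → r ∈ rulesAt a q b → r ∈ rules a
  rule⁺ a q b m = ∈-concatMap⁺ (rulesFrom a) (Any.map
    (λ { refl → ∈-concatMap⁺ (rulesAt a q) (Any.map (λ { refl → m }) (∈-allFin b)) }) (∈-allFin q))

  go⁺ : ∀ a q b {t} → t ∈ NTM.δ N q a b → go q b t ∈ rules a
  go⁺ a q b m = rule⁺ a q b (∈-++⁺ʳ (finals q b) (∈-map⁺ (go q b) m))

  final⁺ : ∀ a q b → NTM.accept N q ≡ true → final q b ∈ rules a
  final⁺ a q b t = rule⁺ a q b (∈-++⁺ˡ {xs = finals q b} in-finals)
    where
    in-finals : final q b ∈ finals q b
    in-finals rewrite t = here refl

  Sound : InSym → Rule N → Set
  Sound a (final q b) = NTM.accept N q ≡ true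
  Sound a (go q b t) = t ∈ NTM.δ N q a b

  rule⁻ : ∀ {a r} → r ∈ rules a → Sound a r
  rule⁻ {a} m with Any.satisfied (∈-concatMap⁻ (rulesFrom a) {xs = List.allFin Q} m)
  ... | q , m' with Any.satisfied (∈-concatMap⁻ (rulesAt a q) {xs = List.allFin B} m')
  ... | b , m'' with ∈-++⁻ (finals q b) m''
  ... | inj₁ f with NTM.accept N q in t
  rule⁻ m | q , m' | b , m'' | inj₁ (here refl) | true = t
  rule⁻ m | q , m' | b , m'' | inj₂ g with ∈-map⁻ (go q b) g
  ... | t , t∈ , refl = t∈

  module _ (n s : ℕ) where

    W : ℕ → ℕ
    W p = B ^ p

    -- There is one factor `B ^ s` more than for configurations: `hi` runs up to `B ^ s` at every
    -- head position, so the loops also produce numbers of no actual tape.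
    V : ℕ
    V = Q * ((2 + n) * (s * (B ^ s * B ^ s)))

    node : ℕ → ℕ → ℕ → ℕ → ℕ → ℕ → ℕ → ℕ
    node W hi lo q i p b = number {Q} {n} {s} q i p (lo + W * (b + B * hi))

    connect : ℕ → (ℕ → ℕ → ℕ) → Maybe ℕ → Maybe ℕ → List (ℕ × ℕ)
    connect u v (just i) (just p) = [ (u , v i p) ]
    connect u v _ _ = []

    ruleEdges : InSym → (p hi lo i : ℕ) → Rule N → List (ℕ × ℕ)
    ruleEdges a p hi lo i (final q b) = [ (node (W p) hi lo (toℕ q) i p (toℕ b) , V) ]
    ruleEdges a p hi lo i (go q b (q' , b' , di , dw)) =
      connect (node (W p) hi lo (toℕ q) i p (toℕ b)) (λ i' p' → node (W p) hi lo (toℕ q') i' p' (toℕ b'))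
        (shift di (atLend a) (atRend a) i) (shift dw (isZero p) (isZero (s ∸ suc p)) p)

    cellEdges : InSym → (p hi lo i : ℕ) → List (ℕ × ℕ)
    cellEdges a p hi lo i = concatMap (ruleEdges a p hi lo i) (rules a)

    arcs₁ : List Bool → (p hi lo : ℕ) → List (ℕ × ℕ)
    arcs₁ x p hi lo = bigcat (2 + n) (λ i → cellEdges (readIn x i) p hi lo i)

    arcs₂ : List Bool → (p hi : ℕ) → List (ℕ × ℕ)
    arcs₂ x p hi = bigcat (W p) (arcs₁ x p hi)

    arcs₃ : List Bool → ℕ → List (ℕ × ℕ)
    arcs₃ x p = bigcat (B ^ s) (arcs₂ x p)

    arcs : List Bool → List (ℕ × ℕ)
    arcs x = bigcat s (arcs₃ x)

    record Origin (x : List Bool) (uv : ℕ × ℕ) : Set where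
      constructor origin
      field
        {p₀ hi₀ lo₀ i₀} : ℕ
        p₀<  : p₀ < s
        hi₀< : hi₀ < B ^ s
        lo₀< : lo₀ < W p₀
        i₀<  : i₀ < 2 + n
        rule : Rule N
        ok   : Sound (readIn x i₀) rule
        from : uv ∈ ruleEdges (readIn x i₀) p₀ hi₀ lo₀ i₀ rule

    arcs⁻ : ∀ {x uv} → uv ∈ arcs x → Origin x uv
    arcs⁻ {x} m =
      let p , p< , m₁ = ∈-bigcat⁻ s (arcs₃ x) m
          hi , hi< , m₂ = ∈-bigcat⁻ (B ^ s) (arcs₂ x p) m₁
          lo , lo< , m₃ = ∈-bigcat⁻ (W p) (arcs₁ x p hi) m₂
          i , i< , m₄ = ∈-bigcat⁻ (2 + n) (λ i → cellEdges (readIn x i) p hi lo i) m₃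
          r , r∈ , m₅ = find∈ (ruleEdges (readIn x i) p hi lo i) (rules (readIn x i)) m₄
      in origin p< hi< lo< i< r (rule⁻ r∈) m₅
      where
      find∈ : ∀ {A C : Set} (f : A → List C) {c} as → c ∈ concatMap f as → ∃ λ a → a ∈ as × c ∈ f a
      find∈ f as m = Membership.find (∈-concatMap⁻ f {xs = as} m)

    arcs⁺ : ∀ {x uv p hi lo i r} → p < s → hi < B ^ s → lo < W p → i < 2 + n →
      r ∈ rules (readIn x i) → uv ∈ ruleEdges (readIn x i) p hi lo i r → uv ∈ arcs x
    arcs⁺ {x} {p = p} {hi} {lo} {i} p< hi< lo< i< r∈ m =
      ∈-bigcat⁺ s (arcs₃ x) p< (∈-bigcat⁺ (B ^ s) (arcs₂ x p) hi< (∈-bigcat⁺ (W p) (arcs₁ x p hi) lo<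
        (∈-bigcat⁺ (2 + n) (λ i → cellEdges (readIn x i) p hi lo i) i<
          (∈-concatMap⁺ (ruleEdges (readIn x i) p hi lo i) (Any.map (λ { refl → m }) r∈)))))

    node< : ∀ {p hi lo q i p' b} → p < s → hi < B ^ s → lo < W p → q < Q → i < 2 + n → p' < s → b < B →
            node (W p) hi lo q i p' b < V
    node< {p} {hi} {lo} {b = b} p< hi< lo< q< i< p'< b< = number< q< i< p'< (begin-strict
      lo + W p * (b + B * hi)   <⟨ mixed-< lo< (mixed-< b< hi<) ⟩
      W p * (B * B ^ s)         ≡⟨ trans (sym (*-assoc (W p) B (B ^ s))) (cong (_* B ^ s) (*-comm (W p) B)) ⟩
      B ^ suc p * B ^ s         ≤⟨ *-monoˡ-≤ (B ^ s) (^-monoʳ-≤ B p<) ⟩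
      B ^ s * B ^ s             ∎)
      where open ≤-Reasoning

    shift-toℕ : ∀ {m} d (i : Fin m) {k} →
      shift d (isZero (toℕ i)) (isZero (m ∸ suc (toℕ i))) (toℕ i) ≡ just k →
      ∃ λ j → move d i ≡ just j × toℕ j ≡ k
    shift-toℕ d i eq with move d i | move-shift d i
    ... | just j | e = j , refl , just-injective (trans e eq)
    ... | nothing | e with trans e eq
    ... | ()

    connect⁻ : ∀ {u v uv} mi mp → uv ∈ connect u v mi mp →
               ∃ λ i → ∃ λ p → mi ≡ just i × mp ≡ just p × uv ≡ (u , v i p)
    connect⁻ (just i) (just p) (here refl) = i , p , refl , refl , refl

  module _ (x : List Bool) {s : ℕ} where

    private n = length x

    nodeOf : ∀ (c : NConfig N x s) → ℕ → Fin B → ℕ → ℕ → ℕ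
    nodeOf c q b i p = node n s (B ^ toℕ (wHead c)) (hi (tape c) (wHead c)) (lo (tape c) (wHead c)) q i p (toℕ b)

    index-node : ∀ (c : NConfig N x s) → index c ≡
      nodeOf c (toℕ (state c)) (lookup (tape c) (wHead c)) (toℕ (inHead c)) (toℕ (wHead c))
    index-node c = cong (number {Q} {n} {s} (toℕ (state c)) (toℕ (inHead c)) (toℕ (wHead c))) (val-split (tape c) (wHead c))

    index-update : ∀ (c : NConfig N x s) (q : Fin Q) b (i : Fin (2 + n)) (p : Fin s) →
      index (config q i (tape c [ wHead c ]≔ b) p) ≡ nodeOf c (toℕ q) b (toℕ i) (toℕ p)
    index-update (config _ _ t h) q b i p = cong (number {Q} {n} {s} (toℕ q) (toℕ i) (toℕ p))
      (trans (val-split (t [ h ]≔ b) h)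
        (cong₂ (λ l z → l + B ^ toℕ h * z) (lo-update t h b)
          (cong₂ (λ d z → toℕ d + B * z) (lookup∘update h t b) (hi-update t h b))))

    input-shift : ∀ d (i : Fin (2 + n)) → let a = readIn x (toℕ i) in
      shift d (atLend a) (atRend a) (toℕ i) ≡
      shift d (isZero (toℕ i)) (isZero (2 + n ∸ suc (toℕ i))) (toℕ i)
    input-shift d i = cong₂ (λ l r → shift d l r (toℕ i)) (atLend-readIn x i) (atRend-readIn x i)

    arc-step : ∀ {c c' : NConfig N x s} → NStep N x c c' → (index c , index c') ∈ arcs n s x
    arc-step {c} (step {q' = q'} {a} {di} {dw} {ih'} {wh'} m mi mw) =
      arcs⁺ n s (toℕ<n (wHead c)) (hi< (tape c) (wHead c)) (lo< (tape c) (wHead c)) (toℕ<n (inHead c))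
        (go⁺ (readIn x (toℕ (inHead c))) (state c) (lookup (tape c) (wHead c)) m)
        (subst (_ ∈_) (sym (cong₂ (connect n s _ _)
           (trans (input-shift di (inHead c)) (trans (sym (move-shift di (inHead c))) (cong (Maybe.map toℕ) mi)))
           (trans (sym (move-shift dw (wHead c))) (cong (Maybe.map toℕ) mw))))
          (here (cong₂ _,_ (index-node c) (index-update c q' a ih' wh'))))

    arc-accept : ∀ (c : NConfig N x s) → NTM.accept N (state c) ≡ true → (index c , V n s) ∈ arcs n s x
    arc-accept c t =
      arcs⁺ n s (toℕ<n (wHead c)) (hi< (tape c) (wHead c)) (lo< (tape c) (wHead c)) (toℕ<n (inHead c))
        (final⁺ (readIn x (toℕ (inHead c))) (state c) (lookup (tape c) (wHead c)) t) (here (cong (_, V n s) (index-node c)))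

    input-shift-< : ∀ {i i' d} → i < 2 + n →
      shift d (atLend (readIn x i)) (atRend (readIn x i)) i ≡ just i' → i' < 2 + n
    input-shift-< {i' = i'} {d} i< e =
      let i = fromℕ< i<
          j , _ , ej = shift-toℕ n s d i (trans (sym (input-shift d i))
            (subst (λ z → shift d (atLend (readIn x z)) (atRend (readIn x z)) z ≡ just i') (sym (toℕ-fromℕ< i<)) e))
      in subst (_< 2 + n) ej (toℕ<n j)

    shift-< : ∀ {p p' d} → p < s → shift d (isZero p) (isZero (s ∸ suc p)) p ≡ just p' → p' < s
    shift-< {p' = p'} {d} p< e =
      let j , _ , ej = shift-toℕ n s d (fromℕ< p<)
            (subst (λ z → shift d (isZero z) (isZero (s ∸ suc z)) z ≡ just p') (sym (toℕ-fromℕ< p<)) e)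
      in subst (_< s) ej (toℕ<n j)

    arc-bound : ∀ {u v} → (u , v) ∈ arcs n s x → u ≤ V n s × v ≤ V n s
    arc-bound {u} {v} m = bounds (arcs⁻ n s {x} m)
      where
      bounds : Origin n s x (u , v) → u ≤ V n s × v ≤ V n s
      bounds (origin p< hi< lo< i< (final q b) ok (here e)) =
        subst (_≤ V n s) (sym (cong proj₁ e)) (<⇒≤ (node< n s p< hi< lo< (toℕ<n q) i< p< (toℕ<n b))) ,
        ≤-reflexive (cong proj₂ e)
      bounds (origin {p} {i₀ = i} p< hi< lo< i< (go q b (q' , b' , di , dw)) ok e) =
        let i' , p' , ei , ep , e' = connect⁻ n s (shift di (atLend (readIn x i)) (atRend (readIn x i)) i)
              (shift dw (isZero p) (isZero (s ∸ suc p)) p) e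
        in subst (_≤ V n s) (sym (cong proj₁ e')) (<⇒≤ (node< n s p< hi< lo< (toℕ<n q) i< p< (toℕ<n b))) ,
           subst (_≤ V n s) (sym (cong proj₂ e'))
             (<⇒≤ (node< n s p< hi< lo< (toℕ<n q') (input-shift-< {d = di} i< ei) (shift-< {d = dw} p< ep) (toℕ<n b')))

    -- The source number of an arc determines the loop values that produced it: the outer digits
    -- give the head position, and there the tape number splits uniquely.
    origin-unique : ∀ (c : NConfig N x s) {p hi' lo' i} {q : Fin Q} {b : Fin B} →
      p < s → lo' < B ^ p → i < 2 + n →
      index c ≡ node n s (B ^ p) hi' lo' (toℕ q) i p (toℕ b) →
      state c ≡ q × toℕ (inHead c) ≡ i × toℕ (wHead c) ≡ p × lookup (tape c) (wHead c) ≡ b ×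
      lo (tape c) (wHead c) ≡ lo' × hi (tape c) (wHead c) ≡ hi'
    origin-unique (config st ih t h) {p} {hi'} {lo'} {q = q} {b} p< lo'< i< eq =
      let e₁ , e₂ , e₃ , e₄ = number-injective {Q} {n} {s} (val t) (lo' + B ^ p * (toℕ b + B * hi'))
            (toℕ<n st) (toℕ<n ih) (toℕ<n h) (toℕ<n q) i< p< eq
          e₅ , e₆ = mixed-inj (toℕ (lookup t h) + B * hi t h) (toℕ b + B * hi')
            (subst (λ z → lo t h < B ^ z) e₃ (lo< t h)) lo'<
            (trans (cong (λ z → lo t h + B ^ z * _) (sym e₃)) (trans (sym (val-split t h)) e₄))
          e₇ , e₈ = mixed-inj (hi t h) hi' (toℕ<n (lookup t h)) (toℕ<n b) e₆
      in toℕ-injective e₁ , e₂ , e₃ , toℕ-injective e₇ , e₅ , e₈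

    move-sound : ∀ (c : NConfig N x s) {q b q' b' di dw hi' lo' i p i' p'} →
      state c ≡ q × toℕ (inHead c) ≡ i × toℕ (wHead c) ≡ p × lookup (tape c) (wHead c) ≡ b ×
        lo (tape c) (wHead c) ≡ lo' × hi (tape c) (wHead c) ≡ hi' →
      (q' , b' , di , dw) ∈ NTM.δ N q (readIn x i) b →
      shift di (atLend (readIn x i)) (atRend (readIn x i)) i ≡ just i' →
      shift dw (isZero p) (isZero (s ∸ suc p)) p ≡ just p' →
      ∃ λ c' → NStep N x c c' × node n s (B ^ p) hi' lo' (toℕ q') i' p' (toℕ b') ≡ index c'
    move-sound c {q' = q'} {b'} {di} {dw} (refl , refl , refl , refl , refl , refl) ok ei ep =
      let ih' , mi , e₁ = shift-toℕ n s di (inHead c) (trans (sym (input-shift di (inHead c))) ei)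
          wh' , mw , e₂ = shift-toℕ n s dw (wHead c) ep
      in _ , step ok mi mw ,
         trans (cong₂ (λ i p → nodeOf c (toℕ q') b' i p) (sym e₁) (sym e₂))
               (sym (index-update c q' b' ih' wh'))

    arc-sound : ∀ (c : NConfig N x s) {v} → (index c , v) ∈ arcs n s x →
      (v ≡ V n s × NTM.accept N (state c) ≡ true) ⊎ ∃ λ c' → NStep N x c c' × v ≡ index c'
    arc-sound c {v} m = cases (arcs⁻ n s {x} m)
      where
      cases : Origin n s x (index c , v) →
              (v ≡ V n s × NTM.accept N (state c) ≡ true) ⊎ ∃ λ c' → NStep N x c c' × v ≡ index c'
      cases (origin {p} {h} {l} p< hi< lo< i< (final q b) ok (here e)) =
        let e₁ , _ = origin-unique c {hi' = h} {l} {q = q} {b} p< lo< i< (cong proj₁ e)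
        in inj₁ (cong proj₂ e , trans (cong (NTM.accept N) e₁) ok)
      cases (origin {p} {h} {l} {i} p< hi< lo< i< (go q b (q' , b' , di , dw)) ok e) =
        let i' , p' , ei , ep , e' = connect⁻ n s (shift di (atLend (readIn x i)) (atRend (readIn x i)) i)
               (shift dw (isZero p) (isZero (s ∸ suc p)) p) e
            c' , st , e'' = move-sound c (origin-unique c {hi' = h} {l} {q = q} {b} p< lo< i< (cong proj₁ e'))
               ok ei ep
        in inj₂ (c' , st , trans (cong proj₂ e') e'')

    index<V : ∀ (c : NConfig N x s) → index c < V n s
    index<V c = number< {Q} {n} {s} (toℕ<n (state c)) (toℕ<n (inHead c)) (toℕ<n (wHead c))
      (<-≤-trans (val< (tape c)) (m≤m*n (B ^ s) (B ^ s) {{m^n≢0 B s}}))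

-- Printing the configuration graph

clamp-right : ∀ {m} (i : Fin m) → suc (toℕ i) < m → toℕ (clamp right i) ≡ suc (toℕ i)
clamp-right i lt with move right i | move-right i lt
... | just _ | _ , refl , e = e

seqs : ∀ {G k d} → List (RProg G k d) → RProg G k d
seqs [] = skip
seqs (p ∷ ps) = seq p (seqs ps)

-- t must hold 0
mulReg : ∀ {G k d} → Fin k → Fin k → ℕ → RProg G k (suc d)
mulReg r t b = for r (repeat b (inc t)) ⨾ mov r (just t) ⨾ mov t nothing

module Runs {G : Set} {k : ℕ} (x : List Bool) (e : ℕ) where
  open Output {G} {k} x e public
  open Macros {G} {k} x e public

  run-silently : ∀ {d f g rs i ω y} → Exec (silently {d = d} f) (st₂ g rs i ω y) (st₂ (f g) rs i ω y)
  run-silently = act {o = nothing} refl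

  run-shift : ∀ {d dir g rs i ω y} →
    Exec (shiftHead {d = d} dir) (st₂ g rs i ω y) (st₂ g rs (clamp dir i) ω y)
  run-shift = act {o = nothing} refl

  run-rewind : ∀ {d g rs ω y} n (i : Fin (2 + length x)) → toℕ i ≤ n →
    Iter (shiftHead {d = d} left) n (st₂ g rs i ω y) (st₂ g rs zero ω y)
  run-rewind zero zero le = done
  run-rewind (suc n) zero le = more run-shift (run-rewind n zero z≤n)
  run-rewind (suc n) (suc i) (s≤s le) =
    more run-shift (run-rewind n (inject₁ i) (subst (_≤ n) (sym (toℕ-inject₁ i)) le))

  to-regs : ∀ {d} {p : RProg G k d} {σ g rs rs' i ω y} → rs ≡ rs' →
            Exec p σ (st₂ g rs i ω y) → Exec p σ (st₂ g rs' i ω y)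
  to-regs refl E = E

  for-count : ∀ {d r n} {p : RProg G k d} {σ τ} → lookup (S₂.regs σ) r ≡ n →
              Iter p n σ τ → Exec (for r p) σ τ
  for-count refl I = for I

  -- The register file as a function of one register; for concrete vectors `get` and `put` hold by
  -- computation.
  module View (r : Fin k) (R : ℕ → Vec ℕ k)
    (get : ∀ v → lookup (R v) r ≡ v) (put : ∀ v u → R v [ r ]≔ u ≡ R u) where

    run-inc : ∀ {d g i ω y} v → suc v < 2 ^ e →
              Exec (inc {d = d} r) (st₂ g (R v) i ω y) (st₂ g (R (suc v)) i ω y)
    run-inc v lt = to-regs (trans (put v _) (cong (R ∘ suc) (get v))) (inc (subst (λ z → suc z < 2 ^ e) (sym (get v)) lt))

    run-incs : ∀ {d g i ω y} m v → m + v < 2 ^ e →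
               Exec (repeat m (inc {d = d} r)) (st₂ g (R v) i ω y) (st₂ g (R (m + v)) i ω y)
    run-incs zero v lt = skip
    run-incs (suc m) v lt = seq (run-inc v (≤-trans (s≤s (s≤s (m≤n+m v m))) lt))
      (to-regs (cong R (+-suc m v)) (run-incs m (suc v) (subst (_< 2 ^ e) (sym (+-suc m v)) lt)))

  module View₂ (r t : Fin k) (R : ℕ → ℕ → Vec ℕ k)
    (get₁ : ∀ v u → lookup (R v u) r ≡ v) (put₁ : ∀ v u z → R v u [ r ]≔ z ≡ R z u)
    (get₂ : ∀ v u → lookup (R v u) t ≡ u) (put₂ : ∀ v u z → R v u [ t ]≔ z ≡ R v z) where

    run-mul : ∀ {d g i ω y} v b → v * b < 2 ^ e →
              Exec (mulReg {d = d} r t b) (st₂ g (R v 0) i ω y) (st₂ g (R (v * b) 0) i ω y)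
    run-mul {g = g} {i} {ω} {y} v b lt =
      seq (for-count (get₁ v 0) (iter-family v (λ j → st₂ g (R v (j * b)) i ω y) λ j j< →
            View.run-incs t (R v) (get₂ v) (put₂ v) b (j * b) (≤-<-trans (*-monoˡ-≤ b j<) lt)))
      (seq (to-regs (trans (put₁ v _ _) (cong (λ z → R z _) (get₂ v (v * b)))) mov)
           (to-regs (put₂ _ _ 0) mov))

odd : ℕ → Bool
odd zero = false
odd (suc n) = not (odd n)

half-suc : ∀ n → ⌊ suc n /2⌋ ≡ (if odd n then suc ⌊ n /2⌋ else ⌊ n /2⌋)
half-suc zero = refl
half-suc (suc zero) = refl
half-suc (suc (suc n)) with odd n | half-suc n
... | true | eq = cong suc eq
... | false | eq = cong suc eq

log₂-small : ∀ n → ⌊ n /2⌋ ≡ 0 → ⌊log₂ n ⌋ ≡ 0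
log₂-small zero _ = refl
log₂-small (suc zero) _ = refl

-- A tape is a number whose digits above, at and below the head position p form
-- hi, b and lo; a step replaces b only, so looping over hi and lo separately
-- makes both ends of an edge polynomials in the loop counters.
module GraphProgram (N : NTM) (c : ℕ) where

  open ConfigGraph N

  -- The input symbol last loaded, the parity bit of `halve`, and the flag that keeps `powers`
  -- running.
  G : Set
  G = InSym × Bool × Bool

  G-finite : Finite G
  G-finite = ×-finite InSym-finite (×-finite Bool-finite Bool-finite)

  Program : ℕ → Set
  Program = RProg G 13

  pattern rX = zero
  pattern rS = suc zero
  pattern rP = suc (suc zero)
  pattern rM = suc (suc (suc zero))
  pattern rT = suc (suc (suc (suc zero)))
  pattern rW = suc (suc (suc (suc (suc zero))))
  pattern rRem = suc (suc (suc (suc (suc (suc zero)))))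
  pattern rp = suc (suc (suc (suc (suc (suc (suc zero))))))
  pattern rhi = suc (suc (suc (suc (suc (suc (suc (suc zero)))))))
  pattern rlo = suc (suc (suc (suc (suc (suc (suc (suc (suc zero))))))))
  pattern ri = suc (suc (suc (suc (suc (suc (suc (suc (suc (suc zero)))))))))
  pattern ri' = suc (suc (suc (suc (suc (suc (suc (suc (suc (suc (suc zero))))))))))
  pattern rp' = suc (suc (suc (suc (suc (suc (suc (suc (suc (suc (suc (suc zero)))))))))))

  -- `unload` restores a fixed symbol, so that each round of a loop starts with the same control
  -- value.
  load unload : ∀ {d} → Program d
  load = act (λ (_ , b) a → (a , b) , stay , nothing)
  unload = silently (λ (_ , b) → lend , b)

  countInput : ∀ {d} → Program d
  countInput = while (not ∘ atRend ∘ proj₁) (shiftHead right ⨾ load ⨾ inc rX)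

  halve : ∀ {d} → Program (suc d)
  halve = for rM (cond (proj₁ ∘ proj₂)
                    (seq (inc rT) (silently (λ (a , _ , m) → a , false , m)))
                    (silently (λ (a , _ , m) → a , true , m)))
          ⨾ mov rM (just rT) ⨾ mov rT nothing ⨾ silently (λ (a , _ , m) → a , false , m)

  -- Halving `n` down to 0 takes `suc ⌊log₂ n ⌋` rounds. Adding `suc c` and multiplying by
  -- `B ^ suc c` in each of them gives the space bound and the number of tapes without computing a
  -- logarithm.
  powers : ∀ {d} → Program (suc d)
  powers = while (proj₂ ∘ proj₂)
    (repeat (suc c) (inc rS) ⨾ mulReg rP rT (B ^ suc c) ⨾ halve ⨾
     ifz rM (silently (λ (a , b , _) → a , b , false)) skip)

  setup : ∀ {d} → Program (suc d)
  -- Counting ends at the right endmarker with `n + 1`; a decrement gives `n` for the halving, an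
  -- increment the `n + 2` input positions.
  setup = countInput ⨾ mov rM (just rX) ⨾ dec rM ⨾ inc rX ⨾ inc rP ⨾ powers ⨾
          for rX (shiftHead left) ⨾ unload

  vertices : ∀ {d} → Poly 13 (4 + d)
  vertices = rP ⊛ rP ⊛ rS ⊛ rX ⊛ Q · one

  header : ∀ {d} → Program (4 + d)
  header = putUnary (one ⊕ vertices) ⨾ putUnary (toℕ (NTM.start N) · one) ⨾ putUnary vertices

  -- The nested mixed radix expression multiplied out, since output loops need a sum of products of
  -- registers.
  nodePoly : ∀ {d} → Fin Q → Fin 13 → Fin 13 → Fin B → Poly 13 (4 + d)
  nodePoly q i p b = toℕ q · one ⊕ i ⊛ Q · one ⊕ p ⊛ rX ⊛ Q · one ⊕ rlo ⊛ rS ⊛ rX ⊛ Q · one ⊕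
    toℕ b · rW ⊛ rS ⊛ rX ⊛ Q · one ⊕ rhi ⊛ B · rW ⊛ rS ⊛ rX ⊛ Q · one

  edgeProg : ∀ {d} → Poly 13 (4 + d) → Poly 13 (4 + d) → Program (4 + d)
  edgeProg u v = putBit true ⨾ putUnary u ⨾ putUnary v ⨾ putBits (labBits eps)

  setTo : ∀ {d} → Fin 13 → Fin 13 → Dir → Program d
  setTo r r' left = seq (mov r' (just r)) (dec r')
  setTo r r' stay = mov r' (just r)
  setTo r r' right = seq (mov r' (just r)) (inc r')

  -- The work head may be at an end only at run time, so registers are tested; for the input head,
  -- the symbol decides when the program is built.
  guard : ∀ {d} → Dir → Program d → Program d
  guard left p = ifz rp skip p
  guard stay p = p
  guard right p = ifz rRem skip p

  moved : ∀ {d} → Fin Q → Fin B → Fin Q → Fin B → Dir → Dir → Program (4 + d)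
  moved q b q' b' di dw = setTo ri ri' di ⨾ setTo rp rp' dw ⨾
    edgeProg (nodePoly q ri rp b) (nodePoly q' ri' rp' b') ⨾ mov ri' nothing ⨾ mov rp' nothing

  ruleProg : ∀ {d} → InSym → Rule N → Program (4 + d)
  ruleProg a (final q b) = edgeProg (nodePoly q ri rp b) vertices
  ruleProg a (go q b (q' , b' , di , dw)) =
    if blocked di (atLend a) (atRend a) then skip else guard dw (moved q b q' b' di dw)

  isOne : InSym → Bool
  isOne (bit b) = b
  isOne _ = false

  caseSym : ∀ {d} → (InSym → Program d) → Program d
  caseSym f = cond (atLend ∘ proj₁) (f lend) (cond (atRend ∘ proj₁) (f rend)
                (cond (isOne ∘ proj₁) (f (bit true)) (f (bit false))))

  cellProg : Program 4
  cellProg = load ⨾ caseSym (λ a → seqs (map (ruleProg a) (rules a))) ⨾ unload ⨾ shiftHead right ⨾ inc ri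

  inputLoop : Program 5
  inputLoop = for rX cellProg ⨾ for rX (shiftHead left) ⨾ mov ri nothing ⨾ inc rlo

  lowLoop : Program 6
  lowLoop = for rW inputLoop ⨾ mov rlo nothing ⨾ inc rhi

  highLoop : Program 7
  -- `rRem` enters as `S ∸ p` and must become `S ∸ suc p`, the room to the right of the head.
  highLoop = dec rRem ⨾ for rP lowLoop ⨾ mov rhi nothing ⨾ inc rp ⨾ mulReg rW rT B

  program : Program 8
  program = setup ⨾ header ⨾ inc rW ⨾ mov rRem (just rS) ⨾ for rS highLoop ⨾ putBit false

  g₀ : G
  g₀ = lend , false , true

  module _ (x : List Bool) (e : ℕ) where
    open Runs {G} {13} x e

    private
      n = length x
      X = 2 + n
      S = logSpace (suc c) n
      P = B ^ S

    run-load : ∀ {d a b rs i ω y} →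
      Exec (load {d = d}) (st₂ (a , b) rs i ω y) (st₂ (readIn x (toℕ i) , b) rs i ω y)
    run-load = act {o = nothing} refl

    run-caseSym : ∀ {d} (f : InSym → Program d) a {b rs i ω y τ} →
      Exec (f a) (st₂ (a , b) rs i ω y) τ → Exec (caseSym f) (st₂ (a , b) rs i ω y) τ
    run-caseSym f lend E = cond-true refl E
    run-caseSym f rend E = cond-false refl (cond-true refl E)
    run-caseSym f (bit true) E = cond-false refl (cond-false refl (cond-true refl E))
    run-caseSym f (bit false) E = cond-false refl (cond-false refl (cond-false refl E))

    early : (X S P m t : ℕ) → Vec ℕ 13
    early X S P m t = X ∷ S ∷ P ∷ m ∷ t ∷ Vec.replicate 8 0

    regs : (W rem p hi lo i i' p' : ℕ) → Vec ℕ 13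
    regs W rem p hi lo i i' p' =
      X ∷ S ∷ P ∷ 0 ∷ 0 ∷ W ∷ rem ∷ p ∷ hi ∷ lo ∷ i ∷ i' ∷ p' ∷ []

    module Bounds (X< : X < 2 ^ e) (S< : S < 2 ^ e) (P< : P < 2 ^ e) where

      run-count : ∀ {d b ω y} m (i : Fin X) → toℕ i + m ≡ suc n →
        ∃ λ i' → Exec (countInput {d}) (st₂ (readIn x (toℕ i) , b) (early (toℕ i) 0 0 0 0) i ω y)
                      (st₂ (rend , b) (early (suc n) 0 0 0 0) i' ω y)
      run-count {b = b} {ω} {y} zero i eq =
        i , subst (λ z → Exec countInput (st₂ (readIn x z , b) (early z 0 0 0 0) i ω y)
                           (st₂ (rend , b) (early (suc n) 0 0 0 0) i ω y))
              (sym (trans (sym (+-identityʳ (toℕ i))) eq))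
              (subst (λ a → Exec countInput (st₂ (a , b) (early (suc n) 0 0 0 0) i ω y)
                              (st₂ (rend , b) (early (suc n) 0 0 0 0) i ω y))
                (sym (readIn-last x)) (while-stop refl))
      run-count {b = b} {ω} {y} (suc m) i eq =
        let i₁ = clamp right i
            lt : suc (toℕ i) < X
            lt = s≤s (subst (toℕ i <_) eq (m<m+n (toℕ i) z<s))
            e₁ = clamp-right i lt
            i' , E = run-count m i₁ (trans (cong (_+ m) e₁) (trans (sym (+-suc (toℕ i) m)) eq))
        in i' , while-go (cong not (trans (atRend-readIn x i)
                   (cong isZero (trans (cong (_∸ toℕ i) (sym eq)) (m+n∸m≡n (toℕ i) (suc m))))))
                 (seq run-shift (seq run-load
                   (to-regs (cong (λ z → early z 0 0 0 0) (sym e₁)) (inc (<-trans lt X<))))) E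

      run-halve : ∀ {d a k ω y i S' P'} m → m < 2 ^ e →
        Exec (halve {d}) (st₂ (a , false , k) (early X S' P' m 0) i ω y)
             (st₂ (a , false , k) (early X S' P' ⌊ m /2⌋ 0) i ω y)
      run-halve {a = a} {k} {ω} {y} {i} {S'} {P'} m m< =
        seq (for (iter-family m (λ j → st₂ (a , odd j , k) (early X S' P' m ⌊ j /2⌋) i ω y) round))
          (seq mov (seq mov run-silently))
        where
        round : ∀ j → j < m → Exec _ (st₂ (a , odd j , k) (early X S' P' m ⌊ j /2⌋) i ω y)
                                     (st₂ (a , odd (suc j) , k) (early X S' P' m ⌊ suc j /2⌋) i ω y)
        round j j< with odd j in o | half-suc j
        ... | true | eq = cond-true refl (seq
                (to-regs (cong (early X S' P' m) (sym eq)) (inc (≤-<-trans (s≤s (⌊n/2⌋≤n j)) (≤-<-trans j< m<)))) run-silently)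
        ... | false | eq = cond-false refl (to-regs (cong (early X S' P' m) (sym eq)) run-silently)

      -- The two equations are the loop invariant: the `suc ⌊log₂ m ⌋` rounds still due complete
      -- `S'` to `S` and `P'` to `P`.
      run-powers : ∀ {d a ω y i} m → Acc _<_ m → m < 2 ^ e → ∀ S' P' →
        suc c * suc ⌊log₂ m ⌋ + S' ≡ S → P' * B ^ (suc c * suc ⌊log₂ m ⌋) ≡ P →
        Exec (powers {d}) (st₂ (a , false , true) (early X S' P' m 0) i ω y)
             (st₂ (a , false , false) (early X S P 0 0) i ω y)
      run-powers {d} {a} {ω} {y} {i} m (wf rec) m< S' P' eS eP =
        while-go refl
          (seq (View.run-incs rS (λ v → early X v P' m 0) (λ _ → refl) (λ _ _ → refl) (suc c) S'
                  (≤-<-trans (≤-trans (+-monoˡ-≤ S' (m≤m*n (suc c) (suc ⌊log₂ m ⌋))) (≤-reflexive eS)) S<))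
          (seq (View₂.run-mul rP rT (λ v t → early X (suc c + S') v m t) (λ _ _ → refl) (λ _ _ _ → refl)
                  (λ _ _ → refl) (λ _ _ _ → refl) P' (B ^ suc c)
                  (≤-<-trans (≤-trans (*-monoʳ-≤ P' (^-monoʳ-≤ B (m≤m*n (suc c) (suc ⌊log₂ m ⌋)))) (≤-reflexive eP)) P<))
          (seq (run-halve m m<) (proj₁ rest))))
          (proj₂ rest)
        where
        τ : Bool → ℕ → S₂
        τ b h = st₂ (a , false , b) (early X (suc c + S') (P' * B ^ suc c) h 0) i ω y
        σ' : S₂
        σ' = st₂ (a , false , false) (early X S P 0 0) i ω y
        settled : ⌊ m /2⌋ ≡ 0 → τ false 0 ≡ σ'
        settled z = cong₂ (λ s p → st₂ (a , false , false) (early X s p 0 0) i ω y)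
          (trans (cong (_+ S') (sym (*-identityʳ (suc c)))) (trans (cong (λ l → suc c * suc l + S') (sym (log₂-small m z))) eS))
          (trans (cong (λ l → P' * B ^ l) (sym (*-identityʳ (suc c)))) (trans (cong (λ l → P' * B ^ (suc c * suc l)) (sym (log₂-small m z))) eP))
        halved : ∀ h → ⌊ m /2⌋ ≡ suc h → ⌊log₂ m ⌋ ≡ suc ⌊log₂ ⌊ m /2⌋ ⌋
        halved h z = log₂-half m (≮⇒≥ λ lt → small m lt z)
          where
          small : ∀ m {h} → m < 2 → ⌊ m /2⌋ ≢ suc h
          small zero lt ()
          small (suc zero) lt ()
          small (suc (suc m)) (s≤s (s≤s ())) _
        rest : Exec (ifz rM (silently (λ (a , b , _) → a , b , false)) skip) (τ true ⌊ m /2⌋) (τ (not (isZero ⌊ m /2⌋)) ⌊ m /2⌋) ×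
               Exec (powers {d}) (τ (not (isZero ⌊ m /2⌋)) ⌊ m /2⌋) σ'
        rest with ⌊ m /2⌋ in z
        ... | zero = ifz-zero refl run-silently , subst (Exec powers (τ false 0)) (settled z) (while-stop refl)
        ... | suc h = ifz-suc refl skip ,
            run-powers (suc h) (rec h<) (<-trans h< m<) (suc c + S') (P' * B ^ suc c)
              (trans (regroup (suc c) (suc ⌊log₂ suc h ⌋) S') (trans (cong (λ l → suc c * suc l + S') (sym lg)) eS))
              (trans (*-assoc P' (B ^ suc c) (B ^ (suc c * suc ⌊log₂ suc h ⌋))) (trans (cong (P' *_) (trans (sym (^-distribˡ-+-* B (suc c) (suc c * suc ⌊log₂ suc h ⌋)))
                (cong (B ^_) (sym (*-suc (suc c) (suc ⌊log₂ suc h ⌋)))))) (trans (cong (λ l → P' * B ^ (suc c * suc l)) (sym lg)) eP)))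
          where
          lg : ⌊log₂ m ⌋ ≡ suc ⌊log₂ suc h ⌋
          lg = subst (λ k → ⌊log₂ m ⌋ ≡ suc ⌊log₂ k ⌋) z (halved h z)
          h< : suc h < m
          h< = subst (_< m) z (half< m z)
            where
            half< : ∀ m → ⌊ m /2⌋ ≡ suc h → ⌊ m /2⌋ < m
            half< (suc m) _ = ⌊n/2⌋<n m
          regroup : ∀ c l s → c * l + (c + s) ≡ c * suc l + s
          regroup = solve-∀

      run-setup : ∀ {d ω y} → Exec (setup {d}) (st₂ g₀ (Vec.replicate 13 0) zero ω y)
        (st₂ (lend , false , false) (early X S P 0 0) zero ω y)
      run-setup =
        let i , E = run-count (suc n) zero refl in
        seq E (seq mov (seq dec (seq (inc X<) (seq (inc (≤-<-trans (m^n>0 B S) P<))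
          (seq (run-powers n (<-wellFounded n) (<-trans (s≤s (n≤1+n n)) X<) 0 1
                  (+-identityʳ _) (+-identityʳ _))
          (seq (for (run-rewind X i (<⇒≤ (toℕ<n i)))) run-silently))))))

      V-poly : ∀ Q n s p → p * (p * (s * ((2 + n) * (Q * 1)))) ≡ Q * ((2 + n) * (s * (p * p)))
      V-poly = solve-∀

      node-poly : ∀ Q B X S W q i p lo b hi →
        q * 1 + (i * (Q * 1) + (p * (X * (Q * 1)) + (lo * (S * (X * (Q * 1))) +
          (b * (W * (S * (X * (Q * 1)))) + hi * (B * (W * (S * (X * (Q * 1))))))))) ≡
        q + Q * (i + X * (p + S * (lo + W * (b + B * hi))))
      node-poly = solve-∀

      emits-edge : ∀ {d g rs i a b} (u v : Poly 13 (4 + d)) → evalPoly u rs ≡ a → evalPoly v rs ≡ b →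
        Emits (edgeProg u v) g rs i (encArc (a , b))
      emits-edge u v refl refl =
        emits-seq (emits-bit true) (emits-seq (emits-unary u) (emits-seq (emits-unary v) (emits-bits (labBits eps))))

      run-setI : ∀ {d g W rem p hi lo i pos ω y} dir → suc i < 2 ^ e →
        Exec (setTo {d} ri ri' dir) (st₂ g (regs W rem p hi lo i 0 0) pos ω y)
                                    (st₂ g (regs W rem p hi lo i (shifted dir i) 0) pos ω y)
      run-setI left lt = seq mov dec
      run-setI stay lt = mov
      run-setI right lt = seq mov (inc lt)

      run-setP : ∀ {d g W rem p hi lo i i' pos ω y} dir → suc p < 2 ^ e →
        Exec (setTo {d} rp rp' dir) (st₂ g (regs W rem p hi lo i i' 0) pos ω y)
                                    (st₂ g (regs W rem p hi lo i i' (shifted dir p)) pos ω y)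
      run-setP left lt = seq mov dec
      run-setP stay lt = mov
      run-setP right lt = seq mov (inc lt)

      module _ (a : InSym) {g : G} {p hi lo i : ℕ} {pos : Fin X} (i< : suc i < 2 ^ e) (p< : suc p < 2 ^ e) where

        private
          rem = S ∸ suc p
          rs = regs (B ^ p) rem p hi lo i 0 0

        emits-moved : ∀ {d} q b q' b' di dw → Emits (moved {d} q b q' b' di dw) g rs pos
          (concatMap encArc [ (node n S (B ^ p) hi lo (toℕ q) i p (toℕ b) ,
                               node n S (B ^ p) hi lo (toℕ q') (shifted di i) (shifted dw p) (toℕ b')) ])
        emits-moved q b q' b' di dw y =
          with-out (cong (_++ y) (sym (Listₚ.++-identityʳ _)))
            (seq (run-setI di i<) (seq (run-setP dw p<) (seq
              (emits-edge {rs = regs (B ^ p) rem p hi lo i (shifted di i) (shifted dw p)}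
                (nodePoly q ri rp b) (nodePoly q' ri' rp' b')
                (node-poly Q B X S (B ^ p) (toℕ q) i p lo (toℕ b) hi)
                (node-poly Q B X S (B ^ p) (toℕ q') (shifted di i) (shifted dw p) lo (toℕ b') hi) y)
              (seq mov mov))))

        emits-ifz : ∀ {d r l l'} {prog : Program d} v → lookup rs r ≡ v → Emits prog g rs pos l' →
          l ≡ (if isZero v then [] else l') → Emits (ifz r skip prog) g rs pos l
        emits-ifz zero eq E refl y = ifz-zero eq skip
        emits-ifz (suc v) eq E refl y = ifz-suc eq (E y)

        connect-if : ∀ u (v : ℕ → ℕ → ℕ) i' k b →
          concatMap encArc (connect n S u v (just i') (if b then nothing else just k)) ≡
          (if b then [] else concatMap encArc [ (u , v i' k) ])
        connect-if u v i' k true = refl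
        connect-if u v i' k false = refl

        emits-guard : ∀ {d} u (v : ℕ → ℕ → ℕ) i' dw (prog : Program d) →
          Emits prog g rs pos (concatMap encArc [ (u , v i' (shifted dw p)) ]) →
          Emits (guard dw prog) g rs pos
            (concatMap encArc (connect n S u v (just i') (shift dw (isZero p) (isZero rem) p)))
        emits-guard u v i' stay prog E = E
        emits-guard u v i' left prog E = emits-ifz p refl E (connect-if u v i' (pred p) (isZero p))
        emits-guard u v i' right prog E = emits-ifz rem refl E (connect-if u v i' (suc p) (isZero rem))

        emits-rule : ∀ {d} r → Emits (ruleProg {d} a r) g rs pos (concatMap encArc (ruleEdges n S a p hi lo i r))
        emits-rule (final q b) y =
          with-out (cong (_++ y) (sym (Listₚ.++-identityʳ _)))
            (emits-edge (nodePoly q ri rp b) vertices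
              (node-poly Q B X S (B ^ p) (toℕ q) i p lo (toℕ b) hi) (V-poly Q n S P) y)
        emits-rule (go q b (q' , b' , di , dw)) with blocked di (atLend a) (atRend a)
        ... | true = emits-skip
        ... | false = emits-guard _ _ (shifted di i) dw _ (emits-moved q b q' b' di dw)

        emits-rules : ∀ {d} l → Emits (seqs (map (ruleProg {d} a) l)) g rs pos
                                      (concatMap encArc (concatMap (ruleEdges n S a p hi lo i) l))
        emits-rules [] = emits-skip
        emits-rules (r ∷ l) = subst (Emits _ g rs pos)
          (sym (Listₚ.concatMap-++ encArc (ruleEdges n S a p hi lo i r) _))
          (emits-seq (emits-rule r) (emits-rules l))

      -- Defined by clamping because the loop moves right `X` times over `X` positions: its last
      -- move stays at the right endmarker.
      posAt : ℕ → Fin X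
      posAt zero = zero
      posAt (suc j) = clamp right (posAt j)

      toℕ-posAt : ∀ j → j < X → toℕ (posAt j) ≡ j
      toℕ-posAt zero _ = refl
      toℕ-posAt (suc j) lt =
        let eq = toℕ-posAt j (<-trans (n<1+n j) lt)
        in trans (clamp-right (posAt j) (subst (λ z → suc z < X) (sym eq) lt)) (cong suc eq)

      g₁ : G
      g₁ = lend , false , false

      run-cell : ∀ {ω p hi lo i} → p < S → i < X → ∀ y →
        Exec cellProg
          (st₂ g₁ (regs (B ^ p) (S ∸ suc p) p hi lo i 0 0) (posAt i) ω
            (concatMap encArc (cellEdges n S (readIn x i) p hi lo i) ++ y))
          (st₂ g₁ (regs (B ^ p) (S ∸ suc p) p hi lo (suc i) 0 0) (posAt (suc i)) ω y)
      run-cell {p = p} {hi} {lo} {i} p< i< y =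
        let a = readIn x (toℕ (posAt i)) in
        seq run-load (seq (run-caseSym (λ a → seqs (map (ruleProg a) (rules a))) a
          (with-out (cong (λ z → concatMap encArc (cellEdges n S (readIn x z) p hi lo i) ++ y) (toℕ-posAt i i<))
            (emits-rules a (≤-<-trans i< X<) (≤-<-trans p< S<) (rules a) y)))
        (seq run-silently (seq run-shift (inc (≤-<-trans i< X<)))))

      run-input : ∀ {ω p hi lo} → p < S → lo < B ^ p → ∀ y →
        Exec inputLoop
          (st₂ g₁ (regs (B ^ p) (S ∸ suc p) p hi lo 0 0 0) zero ω (concatMap encArc (arcs₁ n S x p hi lo) ++ y))
          (st₂ g₁ (regs (B ^ p) (S ∸ suc p) p hi (suc lo) 0 0 0) zero ω y)
      run-input {p = p} {hi} {lo} p< lo< y =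
        seq (for (with-iter (concatMap-bigcat encArc X (λ i → cellEdges n S (readIn x i) p hi lo i))
              (iter-emits X (λ i → regs (B ^ p) (S ∸ suc p) p hi lo i 0 0) posAt
                (λ i → concatMap encArc (cellEdges n S (readIn x i) p hi lo i)) (λ i i< y → run-cell p< i< y) y)))
        (seq (for (run-rewind X (posAt X) (<⇒≤ (toℕ<n (posAt X))))) (seq mov
          (inc (≤-<-trans lo< (≤-<-trans (^-monoʳ-≤ B (<⇒≤ p<)) P<)))))
        where
        with-iter : ∀ {m l l' σ ω τ} → l ≡ l' →
          Iter cellProg m (st₂ g₁ σ zero ω (l' ++ y)) τ → Iter cellProg m (st₂ g₁ σ zero ω (l ++ y)) τ
        with-iter refl I = I

      run-low : ∀ {ω p hi} → p < S → hi < P → ∀ y →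
        Exec lowLoop
          (st₂ g₁ (regs (B ^ p) (S ∸ suc p) p hi 0 0 0 0) zero ω (concatMap encArc (arcs₂ n S x p hi) ++ y))
          (st₂ g₁ (regs (B ^ p) (S ∸ suc p) p (suc hi) 0 0 0 0) zero ω y)
      run-low {p = p} {hi} p< hi< y =
        seq (with-out (cong (_++ y) (sym (concatMap-bigcat encArc (B ^ p) (arcs₁ n S x p hi))))
              (for (iter-emits (B ^ p) (λ lo → regs (B ^ p) (S ∸ suc p) p hi lo 0 0 0) (λ _ → zero)
                (λ lo → concatMap encArc (arcs₁ n S x p hi lo)) (λ lo lo< y → run-input p< lo< y) y)))
        (seq mov (inc (≤-<-trans hi< P<)))

      run-high : ∀ {ω p} → p < S → ∀ y →
        Exec highLoop
          (st₂ g₁ (regs (B ^ p) (S ∸ p) p 0 0 0 0 0) zero ω (concatMap encArc (arcs₃ n S x p) ++ y))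
          (st₂ g₁ (regs (B ^ suc p) (S ∸ suc p) (suc p) 0 0 0 0 0) zero ω y)
      run-high {p = p} p< y =
        seq (to-regs (cong (λ z → regs (B ^ p) z p 0 0 0 0 0) (pred[m∸n]≡m∸[1+n] S p)) dec)
        (seq (with-out (cong (_++ y) (sym (concatMap-bigcat encArc P (arcs₂ n S x p))))
              (for (iter-emits P (λ hi → regs (B ^ p) (S ∸ suc p) p hi 0 0 0 0) (λ _ → zero)
                (λ hi → concatMap encArc (arcs₂ n S x p hi)) (λ hi hi< y → run-low p< hi< y) y)))
        (seq mov (seq (inc (≤-<-trans p< S<))
          (to-regs (cong (λ z → regs z (S ∸ suc p) (suc p) 0 0 0 0 0) (*-comm (B ^ p) B))
            (View₂.run-mul rW rT (λ v t → X ∷ S ∷ P ∷ 0 ∷ t ∷ v ∷ (S ∸ suc p) ∷ suc p ∷ 0 ∷ 0 ∷ 0 ∷ 0 ∷ 0 ∷ [])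
              (λ _ _ → refl) (λ _ _ _ → refl) (λ _ _ → refl) (λ _ _ _ → refl) (B ^ p) B
              (≤-<-trans (≤-trans (≤-reflexive (*-comm (B ^ p) B)) (^-monoʳ-≤ B p<)) P<))))))

      run-program : ∃ λ τ → Exec program
        (st₂ g₀ (Vec.replicate 13 0) zero []
          (unary (suc (V n S)) ++ unary (toℕ (NTM.start N)) ++ unary (V n S) ++
            concatMap encArc (arcs n S x) ++ [ false ])) τ × S₂.out τ ≡ []
      run-program = _ ,
        seq run-setup (seq (with-out regroup (run-header _)) (seq (inc 1<) (seq mov (seq
          (with-out (cong (_++ [ false ]) (sym (concatMap-bigcat encArc S (arcs₃ n S x))))
            (for (iter-emits S (λ p → regs (B ^ p) (S ∸ p) p 0 0 0 0 0) (λ _ → zero)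
              (λ p → concatMap encArc (arcs₃ n S x p)) (λ p p< y → run-high p< y) [ false ])))
          (emits-bit false []))))) , refl
        where
        1< : 1 < 2 ^ e
        1< = ≤-<-trans (m^n>0 B S) P<
        rest = concatMap encArc (arcs n S x) ++ [ false ]
        emits-poly : ∀ {d g i m} (p : Poly 13 d) → evalPoly p (early X S P 0 0) ≡ m →
          Emits (putUnary p) g (early X S P 0 0) i (unary m)
        emits-poly p refl = emits-unary p
        run-header : ∀ {d g i} → Emits (header {d}) g (early X S P 0 0) i
          (unary (suc (V n S)) ++ unary (toℕ (NTM.start N)) ++ unary (V n S))
        run-header = emits-seq (emits-poly (one ⊕ vertices) (cong suc (V-poly Q n S P)))
          (emits-seq {l = unary (toℕ (NTM.start N))} {unary (V n S)}
            (emits-poly {m = toℕ (NTM.start N)} (toℕ (NTM.start N) · one) (*-identityʳ _)) (emits-poly vertices (V-poly Q n S P)))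
        regroup : (unary (suc (V n S)) ++ unary (toℕ (NTM.start N)) ++ unary (V n S)) ++ rest ≡
                  unary (suc (V n S)) ++ unary (toℕ (NTM.start N)) ++ unary (V n S) ++ rest
        regroup = trans (++-assoc (unary (suc (V n S))) (unary (toℕ (NTM.start N)) ++ unary (V n S)) rest)
          (cong (unary (suc (V n S)) ++_) (++-assoc (unary (toℕ (NTM.start N))) (unary (V n S)) rest))

-- From NL to 1LogCFL

-- The exponent of `configs-bound` for a single state; input positions, space and tape contents are
-- factors of the product bounded there.
space-exponent : ℕ → ℕ → ℕ
space-exponent b c = 1 + (1 + (2 * (2 * c) + 2 * (b * c)))

space-bounds : ∀ b c n → let s = logSpace (suc c) n ; m = (2 + n) ^ space-exponent (suc b) (suc c) in
               2 + n ≤ m × s ≤ m × suc b ^ s ≤ m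
space-bounds b c n =
  ≤-trans (≤-trans (m≤m*n X (s * p) {{m*n≢0 s p {{_}} {{m^n≢0 (suc b) s}}}}) (m≤n*m (X * (s * p)) 1)) bound ,
  ≤-trans (≤-trans (m≤m*n s p {{m^n≢0 (suc b) s}}) (≤-trans (m≤n*m (s * p) X) (m≤n*m (X * (s * p)) 1))) bound ,
  ≤-trans (≤-trans (m≤n*m p s) (≤-trans (m≤n*m (s * p) X) (m≤n*m (X * (s * p)) 1))) bound
  where
  X = 2 + n
  s = logSpace (suc c) n
  p = suc b ^ s
  bound = configs-bound 1 (suc b) (suc c) n

module Reduction (N : NTM) (c : ℕ) where

  open ConfigGraph N
  open Base (NTM.symbols N) using (index; val-blank)

  module _ (x : List Bool) where

    private
      n = length x
      S = logSpace (suc c) n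

    initialConfig : NConfig N x S
    initialConfig = config (NTM.start N) zero (Vec.replicate S zero) zero

    start-index : index initialConfig ≡ toℕ (NTM.start N)
    start-index = trans (cong (λ v → toℕ (NTM.start N) + Q * ((2 + n) * (S * v))) (val-blank S))
      (vanish (toℕ (NTM.start N)) Q (2 + n) S)
      where
      vanish : ∀ k q m s → k + q * (m * (s * 0)) ≡ k
      vanish = solve-∀

    open ArcGraph (V n S) (toℕ (NTM.start N)) (arcs n S x) (arc-bound x {S}) public using (graph; encode-graph)

    start≤V : toℕ (NTM.start N) ≤ V n S
    start≤V = subst (_≤ V n S) start-index (<⇒≤ (index<V x initialConfig))

    graph-correct : (YesInstance graph → AcceptsInSpace N x S) × (AcceptsInSpace N x S → YesInstance graph)
    graph-correct = ArcGraph.Runs.reachable (V n S) (toℕ (NTM.start N)) (arcs n S x) (arc-bound x {S})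
      (NStep N x) (NTM.accept N ∘ state) index (index<V x {S}) (arc-step x {S}) (arc-accept x {S}) (arc-sound x {S})
      initialConfig start-index

  reduction : List Bool → List Bool
  reduction x = encode (graph x)

  reduction-computable : LogspaceComputable reduction
  reduction-computable = Realise.transducer G-finite program g₀ reduction (space-exponent B (suc c))
    λ x e lt →
    let X≤ , S≤ , P≤ = space-bounds (NTM.symbols N) c (length x)
        τ , run , o = Bounds.run-program x e (≤-<-trans X≤ lt) (≤-<-trans S≤ lt) (≤-<-trans P≤ lt)
    in τ , Macros.with-out x e (sym (encode-graph x (start≤V x))) run , o
    where open GraphProgram N c

unary-cancel : ∀ m m' {l l'} → unary m ++ l ≡ unary m' ++ l' → m ≡ m' × l ≡ l'
unary-cancel zero zero eq = refl , Listₚ.∷-injectiveʳ eq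
unary-cancel (suc m) (suc m') eq =
  let e₁ , e₂ = unary-cancel m m' (Listₚ.∷-injectiveʳ eq) in cong suc e₁ , e₂
unary-cancel zero (suc m') ()
unary-cancel (suc m) zero ()

labBits-cancel : ∀ a b {l l'} → labBits a ++ l ≡ labBits b ++ l' → a ≡ b × l ≡ l'
labBits-cancel push push refl = refl , refl
labBits-cancel pop pop refl = refl , refl
labBits-cancel eps eps refl = refl , refl
labBits-cancel push pop ()
labBits-cancel push eps ()
labBits-cancel pop push ()
labBits-cancel pop eps ()
labBits-cancel eps push ()
labBits-cancel eps pop ()

module _ {n : ℕ} where

  encEdge-++ : ∀ (u v : Fin n) a l → encEdge (u , a , v) ++ l ≡
               true ∷ unary (toℕ u) ++ unary (toℕ v) ++ labBits a ++ l
  encEdge-++ u v a l = cong (true ∷_) (trans (++-assoc (unary (toℕ u)) _ l)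
    (cong (unary (toℕ u) ++_) (++-assoc (unary (toℕ v)) (labBits a) l)))

  encEdges-cancel : ∀ (E E' : List (Fin n × Label × Fin n)) →
    concatMap encEdge E ++ [ false ] ≡ concatMap encEdge E' ++ [ false ] → E ≡ E'
  encEdges-cancel [] [] eq = refl
  encEdges-cancel [] ((u , a , v) ∷ E') ()
  encEdges-cancel ((u , a , v) ∷ E) [] ()
  encEdges-cancel ((u , a , v) ∷ E) ((u' , a' , v') ∷ E') eq =
    let e = Listₚ.∷-injectiveʳ (trans (sym (split u a v E)) (trans eq (split u' a' v' E')))
        eu , e₁ = unary-cancel (toℕ u) (toℕ u') e
        ev , e₂ = unary-cancel (toℕ v) (toℕ v') e₁
        ea , e₃ = labBits-cancel a a' e₂
    in cong₂ _∷_ (cong₂ _,_ (toℕ-injective eu) (cong₂ _,_ ea (toℕ-injective ev))) (encEdges-cancel E E' e₃)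
    where
    split : ∀ u a v E → concatMap encEdge ((u , a , v) ∷ E) ++ [ false ] ≡
            true ∷ unary (toℕ u) ++ unary (toℕ v) ++ labBits a ++ concatMap encEdge E ++ [ false ]
    split u a v E = trans (++-assoc (encEdge (u , a , v)) (concatMap encEdge E) [ false ])
                          (encEdge-++ u v a (concatMap encEdge E ++ [ false ]))

-- A yes-input is only known to encode some yes-instance; unique decodability identifies it with the
-- graph that was printed.
encode-injective : ∀ I J → encode I ≡ encode J → I ≡ J
encode-injective (mkInstance n s t E) (mkInstance m s' t' E') eq
  with unary-cancel n m eq
... | refl , eq₁ with unary-cancel (toℕ s) (toℕ s') eq₁
... | es , eq₂ with unary-cancel (toℕ t) (toℕ t') eq₂
... | et , eq₃ with toℕ-injective es | toℕ-injective et | encEdges-cancel E E' eq₃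
... | refl | refl | refl = refl

-- With `c = 0` there is no space and nothing is accepted, so `L` is empty; a machine without
-- accepting states then serves for positive space.
NL-space-positive : ∀ {L} → NL L → Σ NTM λ N → Σ ℕ λ c → ∀ x →
  (L x → AcceptsInSpace N x (logSpace (suc c) (length x))) ×
  (AcceptsInSpace N x (logSpace (suc c) (length x)) → L x)
NL-space-positive (N , suc c , h) = N , c , h
NL-space-positive (N , zero , h) =
  record { states = NTM.states N ; symbols = NTM.symbols N ; start = NTM.start N
         ; accept = λ _ → false ; δ = NTM.δ N } , 0 ,
  λ x → (λ l → ⊥-elim (proj₁ (h x) l)) , λ { (_ , _ , ()) }

NL⇒OneLogCFL : ∀ {L} → NL L → OneLogCFL L
NL⇒OneLogCFL nl =
  let N , c , h = NL-space-positive nl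
      open Reduction N c
  in reduction , reduction-computable , λ x →
     (λ l → graph x , refl , proj₂ (graph-correct x) (proj₁ (h x) l)) ,
     (λ (I , eq , y) → proj₂ (h x) (proj₁ (graph-correct x)
        (subst YesInstance (encode-injective I (graph x) eq) y)))

-- A one-pass parser that guesses an edge

caseℕ : ∀ {G k d} m → (G → ℕ) → (Fin m → RProg G k d) → RProg G k d
caseℕ zero f p = skip
caseℕ (suc m) f p = cond (isZero ∘ f) (p zero) (caseℕ m (pred ∘ f) (p ∘ suc))

caseOf : ∀ {A : Set} {G k d} → Finite A → (G → A) → (A → RProg G k d) → RProg G k d
caseOf fin f p = caseℕ (card fin) (toℕ ∘ enc fin ∘ f) (p ∘ decode fin)

module Cases {G : Set} {k : ℕ} (x : List Bool) (e : ℕ) where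
  open Exec₂ {G} {k} x e

  run-caseℕ : ∀ {d m} f (p : Fin m → RProg G k d) (j : Fin m) {σ τ} → f (S₂.ctl σ) ≡ toℕ j →
              Exec (p j) σ τ → Exec (caseℕ m f p) σ τ
  run-caseℕ f p zero eq E = cond-true (cong isZero eq) E
  run-caseℕ f p (suc j) eq E =
    cond-false (cong isZero eq) (run-caseℕ (pred ∘ f) (p ∘ suc) j (cong pred eq) E)

  run-caseOf : ∀ {A : Set} {d} (fin : Finite A) f (p : A → RProg G k d) {σ τ} →
               Exec (p (f (S₂.ctl σ))) σ τ → Exec (caseOf fin f p) σ τ
  run-caseOf fin f p {σ} {τ} E = run-caseℕ _ _ (enc fin (f (S₂.ctl σ))) refl
    (subst (λ a → Exec (p a) σ τ) (sym (dec∘enc fin (f (S₂.ctl σ)))) E)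

  -- asking for a run of both branches avoids a case distinction on the test
  run-ifz : ∀ {A : Set} (f : A → S₂) {a b d r} {p q : RProg G k d} {σ} →
            Exec p σ (f a) → Exec q σ (f b) →
            Exec (ifz r p q) σ (f (if isZero (lookup (S₂.regs σ) r) then a else b))
  run-ifz f {r = r} {σ = σ} P Q with lookup (S₂.regs σ) r in eq
  ... | zero = ifz-zero eq P
  ... | suc _ = ifz-suc eq Q

  run-cond : ∀ {A : Set} (f : A → S₂) {a b d t} {p q : RProg G k d} {σ} →
             Exec p σ (f a) → Exec q σ (f b) →
             Exec (cond t p q) σ (f (if t (S₂.ctl σ) then a else b))
  run-cond f {t = t} {σ = σ} P Q with t (S₂.ctl σ) in eq
  ... | true = cond-true eq P
  ... | false = cond-false eq Q

-- The phases of a one-pass parser for encoded instances: inN, inS, inT read the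
-- size, source and target, inU and inV the ends of an edge, and second b the
-- second label bit after b.

data Phase : Set where
  inN inS inT between inU inV first ended : Phase
  second : Bool → Phase

Phase-finite : Finite Phase
Phase-finite = retract-finite {B = Fin 8 ⊎ Bool} f g (λ
  { inN → refl ; inS → refl ; inT → refl ; between → refl ; inU → refl ; inV → refl
  ; first → refl ; ended → refl ; (second b) → refl }) (⊎-finite (Fin-finite 8) Bool-finite)
  where
  f : Phase → Fin 8 ⊎ Bool
  f inN = inj₁ zero
  f inS = inj₁ (suc zero)
  f inT = inj₁ (suc (suc zero))
  f between = inj₁ (suc (suc (suc zero)))
  f inU = inj₁ (suc (suc (suc (suc zero))))
  f inV = inj₁ (suc (suc (suc (suc (suc zero)))))
  f first = inj₁ (suc (suc (suc (suc (suc (suc zero))))))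
  f ended = inj₁ (suc (suc (suc (suc (suc (suc (suc zero)))))))
  f (second b) = inj₂ b
  g : Fin 8 ⊎ Bool → Phase
  g (inj₁ zero) = inN
  g (inj₁ (suc zero)) = inS
  g (inj₁ (suc (suc zero))) = inT
  g (inj₁ (suc (suc (suc zero)))) = between
  g (inj₁ (suc (suc (suc (suc zero))))) = inU
  g (inj₁ (suc (suc (suc (suc (suc zero)))))) = inV
  g (inj₁ (suc (suc (suc (suc (suc (suc zero))))))) = first
  g (inj₁ (suc (suc (suc (suc (suc (suc (suc _)))))))) = ended
  g (inj₂ b) = second b

-- `match` says that the source of the edge being read agrees with `cur` so far, `taken` that no
-- further edge may be followed in this pass; `coin` is the last choice.
record Flags : Set where
  constructor flags
  field
    phase : Phase
    match taken bad coin : Bool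

-- lim counts down from the size while a vertex is read, cmp counts down from
-- the current vertex cur while the source of an edge is read; h is the number
-- of unmatched pushes on the path guessed so far and room what h may still gain.
record Parser : Set where
  constructor parser
  field
    flag : Flags
    vN vS vT lim cmp cur w h room : ℕ
    coins : List Bool
  open Flags flag public

record Small (e : ℕ) (c : Parser) : Set where
  constructor small
  open Parser c
  field
    vN< : suc vN < 2 ^ e
    vS< : suc vS < 2 ^ e
    vT< : suc vT < 2 ^ e
    w<  : suc w < 2 ^ e
    h<  : suc h < 2 ^ e
    room< : suc room < 2 ^ e

module Consume where
  open Parser

  setPhase : Phase → Parser → Parser
  setPhase p c = record c { flag = record (flag c) { phase = p } }

  fail unmatch toss : Parser → Parser
  fail c = record c { flag = record (flag c) { bad = true } }
  unmatch c = record c { flag = record (flag c) { match = false } }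
  toss c = record c { flag = record (flag c) { coin = headω (coins c) } ; coins = tailω (coins c) }

  -- `lim` is the size minus the ones read so far, and a number may end only while it is positive;
  -- this makes every vertex smaller than the size.
  nonzero limited : (Parser → Parser) → Parser → Parser
  nonzero k c = if isZero (lim c) then fail c else k c
  limited k c = if isZero (lim c) then fail c else k (record c { lim = pred (lim c) })

  tickCmp testCmp : Parser → Parser
  tickCmp c = if isZero (cmp c) then unmatch c else record c { cmp = pred (cmp c) }
  testCmp c = if isZero (cmp c) then c else unmatch c

  effect : Label → Parser → Parser
  effect push c = if isZero (room c) then fail c else record c { room = pred (room c) ; h = suc (h c) }
  effect pop c = if isZero (h c) then fail c else record c { h = pred (h c) ; room = suc (room c) }
  effect eps c = c

  follow : Label → Parser → Parser
  follow l c = effect l (record c { flag = record (flag c) { taken = true } ; cur = w c })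

  wanted : Flags → Bool
  wanted f = Flags.match f ∧ not (Flags.taken f) ∧ Flags.coin f

  -- A choice is spent at every edge, followed or not. So a pass without failure uses one choice per
  -- edge, which keeps the choices of successive passes aligned.
  labelled : Label → Parser → Parser
  labelled l c = setPhase between (if wanted (flag (toss c)) then follow l (toss c) else toss c)

  label : Bool → Bool → Parser → Parser
  label true true = labelled push
  label true false = labelled pop
  label false true = labelled eps
  label false false = fail

  consumeAt : Phase → Bool → Parser → Parser
  consumeAt inN true c = record c { vN = suc (vN c) }
  consumeAt inN false c = setPhase inS (record c { lim = vN c })
  consumeAt inS true = limited (λ c → record c { vS = suc (vS c) })
  consumeAt inS false = nonzero (λ c → setPhase inT (record c { lim = vN c }))
  consumeAt inT true = limited (λ c → record c { vT = suc (vT c) })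
  consumeAt inT false = nonzero (setPhase between)
  consumeAt between true c =
    record c { flag = record (flag c) { phase = inU ; match = true } ; lim = vN c ; cmp = cur c }
  consumeAt between false = setPhase ended
  consumeAt inU true = limited tickCmp
  consumeAt inU false = nonzero (λ c → setPhase inV (testCmp (record c { lim = vN c ; w = 0 })))
  consumeAt inV true = limited (λ c → record c { w = suc (w c) })
  consumeAt inV false = nonzero (setPhase first)
  consumeAt first b = setPhase (second b)
  consumeAt (second b) b' = label b b'
  consumeAt ended b = fail

  consume : Bool → Parser → Parser
  consume b c = if bad c then c else consumeAt (phase c) b c

  feed : List Bool → Parser → Parser
  feed [] c = c
  feed (b ∷ y) c = feed y (consume b c)

  -- Only the syntactic part is reset; vertex, height, room, choices and failure are carried from
  -- pass to pass.
  begin : Parser → Parser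
  begin c = record c { flag = record (flag c) { phase = inN ; match = false }
                     ; vN = 0 ; vS = 0 ; vT = 0 ; lim = 0 ; cmp = 0 ; w = 0 }

  hasEnded : Flags → Bool
  hasEnded f = case Flags.phase f of λ { ended → true ; _ → false }

  finish : Parser → Parser
  finish c = if hasEnded (flag c) then c else fail c

  pass : List Bool → Parser → Parser
  pass y c = finish (feed y (begin c))

-- `tMove` and `tOut` are the parts of a step of `T` still to be carried out. The input head of `T`
-- is the machine's own.
record Simulator (T : Transducer) : Set where
  constructor simulator
  field
    tState : Fin (Transducer.states T)
    tCell  : Fin (suc (Transducer.symbols T))
    tMove  : Dir
    tOut   : Maybe Bool
    tDone  : Bool

pattern rL = zero
pattern rR = suc zero
pattern rTmp = suc (suc zero)
pattern rN = suc (suc (suc zero))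
pattern rSrc = suc (suc (suc (suc zero)))
pattern rTgt = suc (suc (suc (suc (suc zero))))
pattern rLim = suc (suc (suc (suc (suc (suc zero)))))
pattern rCmp = suc (suc (suc (suc (suc (suc (suc zero))))))
pattern rCur = suc (suc (suc (suc (suc (suc (suc (suc zero)))))))
pattern rV = suc (suc (suc (suc (suc (suc (suc (suc (suc zero))))))))
pattern rH = suc (suc (suc (suc (suc (suc (suc (suc (suc (suc zero)))))))))
pattern rRoom = suc (suc (suc (suc (suc (suc (suc (suc (suc (suc (suc zero))))))))))

-- The programs branch exactly where their counterparts in `Consume` do, so that the simulation
-- lemmas hold almost by computation.
module ParserProgram (T : Transducer) where
  open Consume using (wanted; hasEnded)

  Control : Set
  Control = Simulator T × Flags

  Code : ℕ → Set
  Code = RProg Control 12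

  onFlags : ∀ {d} → (Flags → Flags) → Code d
  onFlags f = silently (λ (t , c) → t , f c)

  setPhaseP : ∀ {d} → Phase → Code d
  setPhaseP p = onFlags (λ f → record f { phase = p })

  failP unmatchP tossP : ∀ {d} → Code d
  failP = onFlags (λ f → record f { bad = true })
  unmatchP = onFlags (λ f → record f { match = false })
  tossP = choose (λ b (t , f) → t , record f { coin = b })

  nonzeroP limitedP : ∀ {d} → Code d → Code d
  nonzeroP p = ifz rLim failP p
  limitedP p = ifz rLim failP (dec rLim ⨾ p)

  tickCmpP testCmpP : ∀ {d} → Code d
  tickCmpP = ifz rCmp unmatchP (dec rCmp)
  testCmpP = ifz rCmp skip unmatchP

  effectP : ∀ {d} → Label → Code d
  effectP push = ifz rRoom failP (dec rRoom ⨾ inc rH)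
  effectP pop = ifz rH failP (dec rH ⨾ inc rRoom)
  effectP eps = skip

  followP labelledP : ∀ {d} → Label → Code d
  followP l = onFlags (λ f → record f { taken = true }) ⨾ mov rCur (just rV) ⨾ effectP l
  labelledP l = tossP ⨾ cond (wanted ∘ proj₂) (followP l) skip ⨾ setPhaseP between

  labelP : ∀ {d} → Bool → Bool → Code d
  labelP true true = labelledP push
  labelP true false = labelledP pop
  labelP false true = labelledP eps
  labelP false false = failP

  consumeAtP : ∀ {d} → Phase → Bool → Code d
  consumeAtP inN true = inc rN
  consumeAtP inN false = mov rLim (just rN) ⨾ setPhaseP inS
  consumeAtP inS true = limitedP (inc rSrc)
  consumeAtP inS false = nonzeroP (mov rLim (just rN) ⨾ setPhaseP inT)
  consumeAtP inT true = limitedP (inc rTgt)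
  consumeAtP inT false = nonzeroP (setPhaseP between)
  consumeAtP between true =
    onFlags (λ f → record f { phase = inU ; match = true }) ⨾ mov rLim (just rN) ⨾ mov rCmp (just rCur)
  consumeAtP between false = setPhaseP ended
  consumeAtP inU true = limitedP tickCmpP
  consumeAtP inU false = nonzeroP (mov rLim (just rN) ⨾ mov rV nothing ⨾ testCmpP ⨾ setPhaseP inV)
  consumeAtP inV true = limitedP (inc rV)
  consumeAtP inV false = nonzeroP (setPhaseP first)
  consumeAtP first b = setPhaseP (second b)
  consumeAtP (second b) b' = labelP b b'
  consumeAtP ended b = failP

  consumeP : ∀ {d} → Bool → Code d
  consumeP b = cond (Flags.bad ∘ proj₂) skip
                 (caseOf Phase-finite (Flags.phase ∘ proj₂) (λ p → consumeAtP p b))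

  beginP finishP : ∀ {d} → Code d
  beginP = onFlags (λ f → record f { phase = inN ; match = false }) ⨾ mov rN nothing ⨾ mov rSrc nothing ⨾
           mov rTgt nothing ⨾ mov rLim nothing ⨾ mov rCmp nothing ⨾ mov rV nothing
  finishP = cond (hasEnded ∘ proj₂) skip failP

  module RunParser (x : List Bool) (e : ℕ) where
    open Runs {Control} {12} x e
    open Cases {Control} {12} x e
    open Consume
    open Parser

    record SimState : Set where
      constructor sim
      field
        simulated : Simulator T
        sL sR sTmp : ℕ
        sPos : Fin (2 + length x)

    ⟦_,_⟧ : SimState → Parser → S₂
    ⟦ sim t l r u i , c ⟧ = st₂ (t , flag c)
      (l ∷ r ∷ u ∷ vN c ∷ vS c ∷ vT c ∷ lim c ∷ cmp c ∷ cur c ∷ w c ∷ h c ∷ room c ∷ []) i (coins c) []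

    module _ (t : SimState) where

      run-effect : ∀ {d} l {c} → Small e c → Exec (effectP {d} l) ⟦ t , c ⟧ ⟦ t , effect l c ⟧
      run-effect push s = run-ifz ⟦ t ,_⟧ run-silently (seq dec (inc (Small.h< s)))
      run-effect pop s = run-ifz ⟦ t ,_⟧ run-silently (seq dec (inc (Small.room< s)))
      run-effect eps s = skip

      run-labelled : ∀ {d} l {c} → Small e c → Exec (labelledP {d} l) ⟦ t , c ⟧ ⟦ t , labelled l c ⟧
      run-labelled l (small a b c d e f) = seq choose (seq
        (run-cond ⟦ t ,_⟧ (seq run-silently (seq mov (run-effect l (small a b c d e f)))) skip) run-silently)

      run-label : ∀ {d} b b' {c} → Small e c → Exec (labelP {d} b b') ⟦ t , c ⟧ ⟦ t , label b b' c ⟧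
      run-label true true = run-labelled push
      run-label true false = run-labelled pop
      run-label false true = run-labelled eps
      run-label false false _ = run-silently

      run-consumeAt : ∀ {d} p b {c} → Small e c → Exec (consumeAtP {d} p b) ⟦ t , c ⟧ ⟦ t , consumeAt p b c ⟧
      run-consumeAt inN true s = inc (Small.vN< s)
      run-consumeAt inN false s = seq mov run-silently
      run-consumeAt inS true s = run-ifz ⟦ t ,_⟧ run-silently (seq dec (inc (Small.vS< s)))
      run-consumeAt inS false s = run-ifz ⟦ t ,_⟧ run-silently (seq mov run-silently)
      run-consumeAt inT true s = run-ifz ⟦ t ,_⟧ run-silently (seq dec (inc (Small.vT< s)))
      run-consumeAt inT false s = run-ifz ⟦ t ,_⟧ run-silently run-silently
      run-consumeAt between true s = seq run-silently (seq mov mov)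
      run-consumeAt between false s = run-silently
      run-consumeAt inU true s = run-ifz ⟦ t ,_⟧ run-silently (seq dec (run-ifz ⟦ t ,_⟧ run-silently dec))
      run-consumeAt inU false s = run-ifz ⟦ t ,_⟧ run-silently
        (seq mov (seq mov (seq (run-ifz ⟦ t ,_⟧ skip run-silently) run-silently)))
      run-consumeAt inV true s = run-ifz ⟦ t ,_⟧ run-silently (seq dec (inc (Small.w< s)))
      run-consumeAt inV false s = run-ifz ⟦ t ,_⟧ run-silently run-silently
      run-consumeAt first b s = run-silently
      run-consumeAt (second b) b' s = run-label b b' s
      run-consumeAt ended b s = run-silently

      run-consume : ∀ {d} b {c} → Small e c → Exec (consumeP {d} b) ⟦ t , c ⟧ ⟦ t , consume b c ⟧
      run-consume b {c} s = run-cond ⟦ t ,_⟧ skip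
        (run-caseOf Phase-finite (Flags.phase ∘ proj₂) (λ p → consumeAtP p b) (run-consumeAt (phase c) b s))

      run-begin : ∀ {d} c → Exec (beginP {d}) ⟦ t , c ⟧ ⟦ t , begin c ⟧
      run-begin c = seq run-silently (seq mov (seq mov (seq mov (seq mov (seq mov mov)))))

      run-finish : ∀ {d} c → Exec (finishP {d}) ⟦ t , c ⟧ ⟦ t , finish c ⟧
      run-finish c = run-cond ⟦ t ,_⟧ skip run-silently

-- Rerunning the transducer

move-right⁻ : ∀ {m} (i : Fin m) {j} → move right i ≡ just j → toℕ j ≡ suc (toℕ i)
move-right⁻ {m} i eq with suc (toℕ i) <? m
move-right⁻ i refl | yes lt = toℕ-fromℕ< lt

move-right-last : ∀ {m} (i : Fin m) → move right i ≡ nothing → suc (toℕ i) ≡ m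
move-right-last {m} i eq with suc (toℕ i) <? m
... | no ¬lt = ≤-antisym (toℕ<n i) (≮⇒≥ ¬lt)

move-left⁻ : ∀ {m} (i : Fin m) {j} → move left i ≡ just j → toℕ i ≡ suc (toℕ j)
move-left⁻ (suc i) refl = cong suc (sym (toℕ-inject₁ i))

clamp-move : ∀ {m} d (i : Fin m) {j} → move d i ≡ just j → clamp d i ≡ j
clamp-move d i eq = cong (maybe id i) eq

iterate : ∀ {A : Set} → ℕ → (A → A) → A → A
iterate zero f a = a
iterate (suc n) f a = f (iterate n f a)

-- the carries of j increments of a digit give the quotient of j by the base
module Counting (m : ℕ) where

  advance : Fin (suc m) × ℕ → Fin (suc m) × ℕ
  advance (d , k) = maybe (λ d' → d' , k) (zero , suc k) (move right d)

  count : ℕ → Fin (suc m) × ℕ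
  count j = iterate j advance (zero , 0)

  count-value : ∀ j → toℕ (proj₁ (count j)) + suc m * proj₂ (count j) ≡ j
  count-value zero = *-zeroʳ m
  count-value (suc j) with count j | count-value j
  ... | d , k | eq with move right d in mv
  ... | just d' = trans (cong (_+ suc m * k) (move-right⁻ d mv)) (cong suc eq)
  ... | nothing = trans (*-suc (suc m) k) (trans (cong (_+ suc m * k) (sym (move-right-last d mv))) (cong suc eq))

  count-unique : ∀ (b : Fin (suc m)) k → count (toℕ b + suc m * k) ≡ (b , k)
  count-unique b k =
    let d , k' = count (toℕ b + suc m * k)
        e₁ , e₂ = mixed-inj k' k (toℕ<n d) (toℕ<n b) (count-value (toℕ b + suc m * k))
    in cong₂ _,_ (toℕ-injective e₁) e₂

  count≤ : ∀ j → proj₂ (count j) ≤ j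
  count≤ j = ≤-trans (≤-trans (m≤n*m (proj₂ (count j)) (suc m)) (m≤n+m _ (toℕ (proj₁ (count j))))) (≤-reflexive (count-value j))

  digits : List (Fin (suc m)) → ℕ
  digits [] = 0
  digits (d ∷ ds) = toℕ d + suc m * digits ds

  digits< : ∀ ds → digits ds < suc m ^ length ds
  digits< [] = z<s
  digits< (d ∷ ds) = mixed-< (toℕ<n d) (digits< ds)

  digits-blank : ∀ n → digits (replicate n zero) ≡ 0
  digits-blank zero = refl
  digits-blank (suc n) = trans (cong (suc m *_) (digits-blank n)) (*-zeroʳ (suc m))

-- T is rerun on every pass; the parts of its tape left and right of the head
-- are kept in the registers L and R as numbers, nearest cell least significant.
module Recogniser (T : Transducer) where
  open ParserProgram T
  open Counting (Transducer.symbols T)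

  private
    B : ℕ
    B = suc (Transducer.symbols T)

  onSim : ∀ {d} → (Simulator T → Simulator T) → Code d
  onSim f = silently (λ (t , c) → f t , c)

  setCell : Fin B → Simulator T → Simulator T
  setCell b t = record t { tCell = b }

  -- Multiplication by the base plus a digit, and division by counting: the remainder accumulates in
  -- `tCell`, the quotient in `rTmp`.
  pushP popP : ∀ {d} → Fin 12 → Code (suc d)
  pushP r = mulReg r rTmp B ⨾
            caseOf (Fin-finite B) (Simulator.tCell ∘ proj₁) (λ d → repeat (toℕ d) (inc r))
  popP r = onSim (setCell zero) ⨾
    for r (cond (λ (t , _) → maybe (λ _ → false) true (move right (Simulator.tCell t)))
             (onSim (setCell zero) ⨾ inc rTmp)
             (onSim (λ t → setCell (maybe id zero (move right (Simulator.tCell t))) t))) ⨾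
    mov r (just rTmp) ⨾ mov rTmp nothing

  simStep : Maybe (Trans (Fin (Transducer.states T)) (Fin B)) → Control → Control × Dir × Maybe Bool
  -- No move or output is left pending, so the rest of the halting round has no effect.
  simStep nothing (t , c) = (record t { tDone = true ; tMove = stay ; tOut = nothing } , c) , stay , nothing
  simStep (just (q , a , di , dw , o)) (t , c) = (simulator q a dw o false , c) , di , nothing

  stepP checkLeft : ∀ {d} → Code d
  stepP = act (λ (t , c) a → simStep (Transducer.δ T (Simulator.tState t) a (Simulator.tCell t)) (t , c))
  checkLeft = act (λ (t , c) a → (record t { tDone = atLend a } , c) , stay , nothing)

  moveBy : ∀ {d} → Dir → Code (suc d)
  moveBy left = pushP rR ⨾ popP rL
  moveBy stay = skip
  moveBy right = pushP rL ⨾ popP rR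

  moveP runP rewindP resetP passP : ∀ {d} → Code (suc d)
  moveP = caseOf Dir-finite (Simulator.tMove ∘ proj₁) moveBy

  outP : ∀ {d} → Code d
  outP = caseOf (Maybe-finite Bool-finite) (Simulator.tOut ∘ proj₁) (maybe consumeP skip)

  unfinished : Control → Bool
  unfinished = not ∘ Simulator.tDone ∘ proj₁

  runP = while unfinished (stepP ⨾ moveP ⨾ outP)
  rewindP = checkLeft ⨾ while unfinished (shiftHead left ⨾ checkLeft)
  resetP = rewindP ⨾ mov rL nothing ⨾ mov rR nothing ⨾ mov rTmp nothing ⨾
           onSim (λ _ → simulator (Transducer.start T) zero stay nothing false)
  passP = resetP ⨾ beginP ⨾ runP ⨾ finishP

  continues : Flags → Bool
  continues f = Flags.coin f ∧ not (Flags.bad f)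

  -- The toss after a pass decides whether another follows. In `finalP`, `rLim` starts at the
  -- current vertex and loses one per unit of the target; it must neither run out early nor leave a
  -- rest.
  loopP finalP firstP : ∀ {d} → Code (2 + d)
  loopP = while (continues ∘ proj₂) (onFlags (λ f → record f { taken = false }) ⨾ passP ⨾ tossP)
  finalP = ifz rH skip failP ⨾ mov rLim (just rCur) ⨾ for rTgt (ifz rLim failP (dec rLim)) ⨾
           ifz rLim skip failP
  firstP = passP ⨾ mov rCur (just rSrc) ⨾ for rN (for rN (inc rRoom)) ⨾ tossP

  program : Code 2
  program = firstP ⨾ loopP ⨾ finalP

  module _ where
    open Parser
    open Consume

    AllSmall : ℕ → List Bool → Parser → Set
    AllSmall e [] c = ⊤
    AllSmall e (b ∷ y) c = Small e c × AllSmall e y (consume b c)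

    afterFirst : List Bool → Parser → Parser
    afterFirst y c = let c' = pass y c in
      toss (record c' { cur = vS c' ; room = vN c' * vN c' + room c' })

    round : List Bool → Parser → Parser
    round y c = toss (pass y (record c { flag = record (flag c) { taken = false } }))

    data Loop (y : List Bool) : Parser → Parser → Set where
      stops : ∀ {c} → continues (flag c) ≡ false → Loop y c c
      again : ∀ {c c'} → continues (flag c) ≡ true → Loop y (round y c) c' → Loop y c c'

    tickLim : Parser → Parser
    tickLim c = if isZero (lim c) then fail c else record c { lim = pred (lim c) }

    compared : Parser → Parser
    compared c = iterate (vT c) tickLim (record c { lim = cur c })

    verdict : Parser → Parser
    verdict c = let c' = compared (if isZero (h c) then c else fail c) in
      if isZero (lim c') then c' else fail c'

  module _ (x : List Bool) (e : ℕ) where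
    open Runs {Control} {12} x e
    open Cases {Control} {12} x e
    open RunParser x e
    open Consume
    open Parser

    to-state : ∀ {d} {p : Code d} {σ τ τ'} → τ ≡ τ' → Exec p σ τ → Exec p σ τ'
    to-state refl E = E

    run-push : ∀ {d} r (R : ℕ → ℕ → Vec ℕ 12) →
      (∀ v u → lookup (R v u) r ≡ v) → (∀ v u z → R v u [ r ]≔ z ≡ R z u) →
      (∀ v u → lookup (R v u) rTmp ≡ u) → (∀ v u z → R v u [ rTmp ]≔ z ≡ R v z) →
      ∀ {t f i ω y} v → toℕ (Simulator.tCell t) + v * B < 2 ^ e →
      Exec (pushP {d} r) (st₂ (t , f) (R v 0) i ω y) (st₂ (t , f) (R (toℕ (Simulator.tCell t) + v * B) 0) i ω y)
    run-push r R g₁ p₁ g₂ p₂ {t} v lt =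
      seq (View₂.run-mul r rTmp R g₁ p₁ g₂ p₂ v B (≤-<-trans (m≤n+m (v * B) _) lt))
          (run-caseOf (Fin-finite B) (Simulator.tCell ∘ proj₁) (λ d → repeat (toℕ d) (inc r))
            (View.run-incs r (λ v → R v 0) (λ v → g₁ v 0) (λ v → p₁ v 0) (toℕ (Simulator.tCell t)) (v * B) lt))

    run-pop : ∀ {d} r (R : ℕ → ℕ → Vec ℕ 12) →
      (∀ v u → lookup (R v u) r ≡ v) → (∀ v u z → R v u [ r ]≔ z ≡ R z u) →
      (∀ v u → lookup (R v u) rTmp ≡ u) → (∀ v u z → R v u [ rTmp ]≔ z ≡ R v z) →
      ∀ {t f i ω y} b k → toℕ b + B * k < 2 ^ e →
      Exec (popP {d} r) (st₂ (t , f) (R (toℕ b + B * k) 0) i ω y) (st₂ (setCell b t , f) (R k 0) i ω y)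
    run-pop r R g₁ p₁ g₂ p₂ {t} {f} {i} {ω} {y} b k lt =
      seq run-silently (seq
        (for-count (g₁ v 0) (subst (Iter _ v (family 0)) (cong σ (count-unique b k)) (iter-family v family each)))
        (seq (to-regs (trans (p₁ v k _) (cong (λ z → R z k) (g₂ v k))) mov) (to-regs (p₂ k k 0) mov)))
      where
      v = toℕ b + B * k
      σ : Fin B × ℕ → S₂
      σ (d , k) = st₂ (setCell d t , f) (R v k) i ω y
      family : ℕ → S₂
      family j = σ (count j)
      each : ∀ j → j < v → Exec _ (family j) (family (suc j))
      each j j< with count j | count≤ j
      ... | d , k | k≤ with move right d in mv
      ... | just d' = cond-false (cong (maybe (λ _ → false) true) mv)
              (to-state (cong (λ z → st₂ (setCell (maybe id zero z) t , f) (R v k) i ω y) mv) run-silently)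
      ... | nothing = cond-true (cong (maybe (λ _ → false) true) mv)
              (seq run-silently (View.run-inc rTmp (R v) (g₂ v) (p₂ v) k (≤-<-trans (≤-trans (s≤s k≤) j<) lt)))

    module _ {s : ℕ} (B^s< : B ^ s < 2 ^ e) where

      record Shadow (c : TConfig T x s) (ls : List (Fin B)) (a : Fin B) (rs : List (Fin B)) : Set where
        constructor shadow
        field
          head≡ : toℕ (wHead c) ≡ length ls
          tape≡ : map id (toList (tape c)) ≡ ls ʳ++ a ∷ rs

      written : ∀ {c ls a rs} → Shadow c ls a rs →
        lookup (tape c) (wHead c) ≡ a ×
        (∀ b → map id (toList (tape c [ wHead c ]≔ b)) ≡ ls ʳ++ b ∷ rs)
      written {c} {ls} (shadow h≡ t≡) =
        let e₁ , e₂ = map-toList-split id (tape c) (wHead c) (reverse ls)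
                        (trans h≡ (sym (length-reverse ls))) (trans t≡ (Listₚ.ʳ++-defn ls))
        in e₁ , λ b → trans (e₂ b) (sym (Listₚ.ʳ++-defn ls))

      shadow-length : ∀ {c ls a rs} → Shadow c ls a rs → length ls + suc (length rs) ≡ s
      shadow-length {c} {ls} (shadow _ t≡) = trans (sym (Listₚ.length-ʳ++ ls))
        (trans (cong length (sym t≡)) (trans (length-map id (toList (tape c))) (Vecₚ.length-toList (tape c))))

      digits-fit : ∀ ds → length ds ≤ s → digits ds < 2 ^ e
      digits-fit ds le = <-trans (<-≤-trans (digits< ds) (^-monoʳ-≤ B le)) B^s<

      simAt : ∀ (c : TConfig T x s) → List (Fin B) → Fin B → List (Fin B) → Dir → Maybe Bool → SimState
      simAt c ls a rs mv o = sim (simulator (state c) a mv o false) (digits ls) (digits rs) 0 (inHead c)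

      others : Parser → Vec ℕ 9
      others c = vN c ∷ vS c ∷ vT c ∷ lim c ∷ cmp c ∷ cur c ∷ w c ∷ h c ∷ room c ∷ []

      -- T's head move, with the new symbol a' still in the finite control
      run-move : ∀ {d} (ls : List (Fin B)) a' rs q ih wh {o} dw {p} (h : Fin s) →
        toℕ h ≡ length ls → length ls + suc (length rs) ≡ s → move dw h ≡ just wh →
        ∃ λ ls' → ∃ λ b → ∃ λ rs' → toℕ wh ≡ length ls' × ls ʳ++ a' ∷ rs ≡ ls' ʳ++ b ∷ rs' ×
          Exec (moveP {d}) ⟦ sim (simulator q a' dw o false) (digits ls) (digits rs) 0 ih , p ⟧
            ⟦ sim (simulator q b dw o false) (digits ls') (digits rs') 0 ih , p ⟧
      run-move ls a' rs q ih wh stay h h≡ len refl =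
        ls , a' , rs , h≡ , refl , run-caseOf Dir-finite (Simulator.tMove ∘ proj₁) moveBy skip
      -- With no cell to the right, the move of `T` would have been blocked.
      run-move ls a' [] q ih wh right h h≡ len mv =
        ⊥-elim (<-irrefl (trans (move-right⁻ h mv) (trans (cong suc h≡) (trans (+-comm 1 (length ls)) len))) (toℕ<n wh))
      run-move ls a' (b ∷ rs) q ih wh {o} right {p} h h≡ len mv =
        a' ∷ ls , b , rs , trans (move-right⁻ h mv) (cong suc h≡) , refl ,
        run-caseOf Dir-finite (Simulator.tMove ∘ proj₁) moveBy
          (seq (to-regs (cong (λ z → (toℕ a' + z) ∷ digits (b ∷ rs) ∷ 0 ∷ others p) (*-comm (digits ls) B))
                 (run-push rL (λ v u → v ∷ digits (b ∷ rs) ∷ u ∷ others p) (λ _ _ → refl) (λ _ _ _ → refl)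
                   (λ _ _ → refl) (λ _ _ _ → refl) (digits ls)
                   (subst (λ z → toℕ a' + z < 2 ^ e) (*-comm B (digits ls)) (digits-fit (a' ∷ ls)
                     (≤-trans (≤-trans (≤-reflexive (+-comm 1 (length ls))) (+-monoʳ-≤ (length ls) (s≤s z≤n)))
                       (≤-reflexive len))))))
               (run-pop rR (λ v u → digits (a' ∷ ls) ∷ v ∷ u ∷ others p) (λ _ _ → refl) (λ _ _ _ → refl)
                 (λ _ _ → refl) (λ _ _ _ → refl) b (digits rs)
                 (digits-fit (b ∷ rs) (≤-trans (≤-trans (n≤1+n _) (m≤n+m _ (length ls))) (≤-reflexive len)))))
      run-move [] a' rs q ih wh left h h≡ len mv with trans (sym h≡) (move-left⁻ h mv)
      ... | ()
      run-move (b ∷ ls) a' rs q ih wh {o} left {p} h h≡ len mv =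
        ls , b , a' ∷ rs , suc-injective (trans (sym (move-left⁻ h mv)) h≡) , refl ,
        run-caseOf Dir-finite (Simulator.tMove ∘ proj₁) moveBy
          (seq (to-regs (cong (λ z → digits (b ∷ ls) ∷ (toℕ a' + z) ∷ 0 ∷ others p) (*-comm (digits rs) B))
                 (run-push rR (λ v u → digits (b ∷ ls) ∷ v ∷ u ∷ others p) (λ _ _ → refl) (λ _ _ _ → refl)
                   (λ _ _ → refl) (λ _ _ _ → refl) (digits rs)
                   (subst (λ z → toℕ a' + z < 2 ^ e) (*-comm B (digits rs)) (digits-fit (a' ∷ rs)
                     (≤-trans (m≤n+m _ (suc (length ls))) (≤-reflexive len))))))
               (run-pop rL (λ v u → v ∷ digits (a' ∷ rs) ∷ u ∷ others p) (λ _ _ → refl) (λ _ _ _ → refl)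
                 (λ _ _ → refl) (λ _ _ _ → refl) b (digits ls)
                 (digits-fit (b ∷ ls) (≤-trans (m≤m+n _ _) (≤-reflexive len)))))

      run-out : ∀ {d t y} (o : Maybe Bool) {p} → Simulator.tOut (SimState.simulated t) ≡ o →
        AllSmall e (emit o ++ y) p →
        ∃ λ p' → Exec (outP {d}) ⟦ t , p ⟧ ⟦ t , p' ⟧ × AllSmall e y p' × feed y p' ≡ feed (emit o ++ y) p
      run-out nothing refl sm =
        _ , run-caseOf (Maybe-finite Bool-finite) (Simulator.tOut ∘ proj₁) (maybe consumeP skip) skip , sm , refl
      run-out {t = t} (just b) refl (s , sm) =
        _ , run-caseOf (Maybe-finite Bool-finite) (Simulator.tOut ∘ proj₁) (maybe consumeP skip) (run-consume t b s) , sm , refl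

      run-halting : ∀ {d t f rs i ω y} →
        Transducer.δ T (Simulator.tState t) (readIn x (toℕ i)) (Simulator.tCell t) ≡ nothing →
        Exec (stepP {d}) (st₂ (t , f) rs i ω y)
                         (st₂ (record t { tDone = true ; tMove = stay ; tOut = nothing } , f) rs i ω y)
      run-halting {t = t} {f} eq = act {di = stay} {o = nothing} (cong (λ z → simStep z (t , f)) eq)

      run-stepping : ∀ {d t f rs i i' ω y q a di dw o} →
        Transducer.δ T (Simulator.tState t) (readIn x (toℕ i)) (Simulator.tCell t) ≡ just (q , a , di , dw , o) →
        move di i ≡ just i' →
        Exec (stepP {d}) (st₂ (t , f) rs i ω y) (st₂ (simulator q a dw o false , f) rs i' ω y)
      run-stepping {t = t} {f} {rs} {i} {ω = ω} {y} {di = di} eq mi =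
        subst (λ j → Exec stepP (st₂ (t , f) rs i ω y) (st₂ _ rs j ω y)) (clamp-move di i mi)
          (act {di = di} {o = nothing} (cong (λ z → simStep z (t , f)) eq))

      -- Output bits go straight into the parser, at most one per step; this is why the output is
      -- never stored.
      run-simulation : ∀ {d c y} → Run T x {s} c y → ∀ {ls a rs mv o p} → Shadow c ls a rs → AllSmall e y p →
        ∃ λ t → Exec (runP {d}) ⟦ simAt c ls a rs mv o , p ⟧ ⟦ t , feed y p ⟧
      run-simulation {c = c} (halt eq) S sm =
        _ , while-go refl (seq (run-halting (trans (cong (Transducer.δ T (state c) (readIn x (toℕ (inHead c)))) (sym (proj₁ (written S)))) eq)) (seq
              (run-caseOf Dir-finite (Simulator.tMove ∘ proj₁) moveBy skip)
              (run-caseOf (Maybe-finite Bool-finite) (Simulator.tOut ∘ proj₁) (maybe consumeP skip) skip)))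
            (while-stop refl)
      run-simulation {d} {c = c} (step {q' = q'} {a'} {dw = dw} {o} {ih'} {wh'} {out} eq mi mw r) {ls} {rs = rs} {p = p} S sm =
        let ea , eu = written S
            ls' , b , rs' , h' , e' , M = run-move ls a' rs q' ih' wh' dw (wHead c) (Shadow.head≡ S) (shadow-length S) mw
            t' = simAt (config q' ih' (tape c [ wHead c ]≔ a') wh') ls' b rs' dw o
            p' , O , sm' , same = run-out {suc d} {t'} {out} o {p} refl sm
            t , E = run-simulation {d} r {ls'} {b} {rs'} {dw} {o} (shadow h' (trans (eu a') e')) sm'
        in t , while-go refl (seq (run-stepping (trans (cong (Transducer.δ T (state c) (readIn x (toℕ (inHead c)))) (sym ea)) eq) mi) (seq M O))
                 (to-state (cong ⟦ t ,_⟧ same) E)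

    run-rewindP : ∀ {d t f rs i ω y} →
      ∃ λ t' → Exec (rewindP {d}) (st₂ (t , f) rs i ω y) (st₂ (t' , f) rs zero ω y)
    run-rewindP {d} {t} {f} {rs} {i} {ω} {y} =
      let t' , E = leftwards (toℕ i) {record t { tDone = atLend (readIn x (toℕ i)) }} i refl (atLend-readIn x i)
      in t' , seq check E
      where
      check : ∀ {d t i} → Exec (checkLeft {d}) (st₂ (t , f) rs i ω y)
        (st₂ (record t { tDone = atLend (readIn x (toℕ i)) } , f) rs i ω y)
      check = act {di = stay} {o = nothing} refl
      leftwards : ∀ n {t} (i : Fin (2 + length x)) → toℕ i ≡ n → Simulator.tDone t ≡ isZero n →
        ∃ λ t' → Exec (while {d = suc d} unfinished (shiftHead left ⨾ checkLeft))
                   (st₂ (t , f) rs i ω y) (st₂ (t' , f) rs zero ω y)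
      leftwards zero zero refl dn = _ , while-stop (cong not dn)
      leftwards (suc n) (suc i) eq dn =
        let eq' = trans (toℕ-inject₁ i) (suc-injective eq)
            t' , E = leftwards n (inject₁ i) eq' (trans (atLend-readIn x (inject₁ i)) (cong isZero eq'))
        in t' , while-go (cong not dn) (seq run-shift check) E

    module Rerun {s : ℕ} (B^s< : B ^ suc s < 2 ^ e) {y : List Bool}
      (r : Run T x (config (Transducer.start T) zero (Vec.replicate (suc s) zero) zero) y) where

      run-pass : ∀ {d t p} → AllSmall e y (begin p) → ∃ λ t' → Exec (passP {d}) ⟦ t , p ⟧ ⟦ t' , pass y p ⟧
      run-pass {d} {p = p} sm =
        let _ , E₁ = run-rewindP
            t , E = run-simulation B^s< {d} r {[]} {zero} {replicate s zero} {stay} {nothing} (shadow refl (cong (zero ∷_) (blank s))) sm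
        in t , seq (seq E₁ (seq mov (seq mov (seq mov run-silently)))) (seq (run-begin fresh p) (seq
             (subst (λ z → Exec runP ⟦ record fresh { sR = z } , begin p ⟧ ⟦ t , feed y (begin p) ⟧)
               (digits-blank s) E)
             (run-finish t (feed y (begin p)))))
        where
        fresh : SimState
        fresh = sim (simulator (Transducer.start T) zero stay nothing false) 0 0 0 zero
        blank : ∀ n → map id (toList (Vec.replicate n (zero {Transducer.symbols T}))) ≡ replicate n zero
        blank zero = refl
        blank (suc n) = cong (zero ∷_) (blank n)

      run-first : ∀ {t p} → AllSmall e y (begin p) → (let c = pass y p in vN c * vN c + room c < 2 ^ e) →
        ∃ λ t' → Exec (firstP {0}) ⟦ t , p ⟧ ⟦ t' , afterFirst y p ⟧
      run-first {p = p} sm lt =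
        let t' , E = run-pass {p = p} sm in t' , seq E (seq mov (seq (for (squares t')) choose))
        where
        c = record (pass y p) { cur = vS (pass y p) }
        n = vN c
        with-room : SimState → ℕ → S₂
        with-room t k = ⟦ t , record c { room = k } ⟧
        squares : ∀ t → Iter (for rN (inc rRoom)) n (with-room t (room c)) (with-room t (n * n + room c))
        squares t = iter-family n (λ j → with-room t (j * n + room c)) λ j j< →
          to-state (cong (with-room t) (sym (+-assoc n (j * n) (room c))))
            (for (iter-family n (λ i → with-room t (i + (j * n + room c))) λ i i< →
              inc (≤-<-trans (≤-trans (+-monoˡ-≤ (j * n + room c) i<)
                (≤-trans (≤-reflexive (sym (+-assoc n (j * n) (room c)))) (+-monoˡ-≤ (room c) (*-monoˡ-≤ n j<)))) lt)))

      run-loop : ∀ (I : Parser → Set) → (∀ {c} → I c → AllSmall e y (begin (record c { flag = record (flag c) { taken = false } }))) →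
        (∀ {c} → I c → I (round y c)) → ∀ {t c c'} → I c → Loop y c c' →
        ∃ λ t' → Exec (loopP {0}) ⟦ t , c ⟧ ⟦ t' , c' ⟧
      run-loop I sm keep i (stops eq) = _ , while-stop eq
      run-loop I sm keep i (again eq l) =
        let t₁ , E = run-pass (sm i)
            t₂ , E' = run-loop I sm keep (keep i) l
        in t₂ , while-go eq (seq run-silently (seq E choose)) E'

      run-final : ∀ {t} c → Exec (finalP {0}) ⟦ t , c ⟧ ⟦ t , verdict c ⟧
      run-final {t} c =
        seq (run-ifz ⟦ t ,_⟧ skip run-silently) (seq mov (seq
          (for (iter-family _ (λ j → ⟦ t , iterate j tickLim (record c' { lim = cur c' }) ⟧)
            (λ _ _ → run-ifz ⟦ t ,_⟧ run-silently dec)))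
          (run-ifz ⟦ t ,_⟧ skip run-silently)))
        where
        c' = if isZero (h c) then c else fail c

      -- `I` is an invariant between passes; its task is to exclude register overflow in the next
      -- pass.
      run-program : ∀ (I : Parser → Set) → (∀ {c} → I c → AllSmall e y (begin (record c { flag = record (flag c) { taken = false } }))) →
        (∀ {c} → I c → I (round y c)) → ∀ {t p c'} → AllSmall e y (begin p) →
        (let c = pass y p in vN c * vN c + room c < 2 ^ e) → I (afterFirst y p) → Loop y (afterFirst y p) c' →
        ∃ λ t' → Exec program ⟦ t , p ⟧ ⟦ t' , verdict c' ⟧
      run-program I sm keep sm₀ lt i l =
        let _ , E₁ = run-first sm₀ lt
            t , E₂ = run-loop I sm keep i l
        in t , seq E₁ (seq E₂ (run-final _))

-- Bounds, termination and the final comparison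

module ParserBounds where
  open Parser
  open Consume

  -- `j` counts the bits read, which bounds all numbers read in unary, and pushes and pops preserve
  -- `h + room`. The other counters are only copied or decremented.
  Bounded : ℕ → ℕ → ℕ → Parser → Set
  Bounded K m j c = vN c ≤ j × vS c ≤ j × vT c ≤ j × w c ≤ j × h c + room c ≤ K × length (coins c) ≤ m

  private
    variable
      K m j : ℕ

  bounded-if : ∀ (t : Bool) {a b} → Bounded K m j a → Bounded K m j b → Bounded K m j (if t then a else b)
  bounded-if true A B = A
  bounded-if false A B = B

  bounded-suc : ∀ c → Bounded K m j c → Bounded K m (suc j) c
  bounded-suc c (a , b , d , e , f) = m≤n⇒m≤1+n a , m≤n⇒m≤1+n b , m≤n⇒m≤1+n d , m≤n⇒m≤1+n e , f

  bounded-toss : ∀ c → Bounded K m j c → Bounded K m j (toss c)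
  bounded-toss c (a , b , d , e , f , g) = a , b , d , e , f , ≤-trans (tail≤ (coins c)) g
    where
    tail≤ : ∀ ω → length (tailω ω) ≤ length ω
    tail≤ [] = z≤n
    tail≤ (_ ∷ ω) = n≤1+n _

  bounded-effect : ∀ l c → Bounded K m j c → Bounded K m j (effect l c)
  bounded-effect eps c B = B
  bounded-effect push c@(parser _ _ _ _ _ _ _ _ _ zero _) B = B
  bounded-effect {K} push c@(parser _ _ _ _ _ _ _ _ h (suc r) _) (a , b , d , e , f , g) =
    a , b , d , e , subst (_≤ K) (+-suc h r) f , g
  bounded-effect pop c@(parser _ _ _ _ _ _ _ _ zero _ _) B = B
  bounded-effect {K} pop c@(parser _ _ _ _ _ _ _ _ (suc h) r _) (a , b , d , e , f , g) =
    a , b , d , e , subst (_≤ K) (sym (+-suc h r)) f , g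

  bounded-label : ∀ b b' c → Bounded K m j c → Bounded K m j (label b b' c)
  bounded-label b b' c B = cases b b'
    where
    tossed = bounded-toss c B
    step-on : ∀ l → Bounded _ _ _ (labelled l c)
    step-on l = bounded-if (wanted (flag (toss c))) {follow l (toss c)} {toss c}
      (bounded-effect l (record (toss c) { flag = record (flag (toss c)) { taken = true } ; cur = w c }) tossed) tossed
    cases : ∀ b b' → Bounded _ _ _ (label b b' c)
    cases true true = step-on push
    cases true false = step-on pop
    cases false true = step-on eps
    cases false false = B

  bounded-consumeAt : ∀ p b c → Bounded K m j c → Bounded K m (suc j) (consumeAt p b c)
  bounded-consumeAt p b c B@(a₁ , a₂ , a₃ , a₄ , a₅ , a₆) = cases p b
    where
    B' = bounded-suc c B
    cases : ∀ p b → Bounded _ _ _ (consumeAt p b c)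
    cases inN true = let _ , r = B' in s≤s a₁ , r
    cases inN false = B'
    cases inS true = let a , _ , r = B' in bounded-if (isZero (lim c)) {fail c} {record c { lim = _ ; vS = suc (vS c) }} B' (a , s≤s a₂ , r)
    cases inS false = bounded-if (isZero (lim c)) {fail c} {setPhase inT (record c { lim = vN c })} B' B'
    cases inT true = let a , b , _ , r = B' in bounded-if (isZero (lim c)) {fail c} {record c { lim = _ ; vT = suc (vT c) }} B' (a , b , s≤s a₃ , r)
    cases inT false = bounded-if (isZero (lim c)) {fail c} {setPhase between c} B' B'
    cases between true = B'
    cases between false = B'
    cases inU true = bounded-if (isZero (lim c)) {fail c} B'
      (bounded-if (isZero (cmp c)) {unmatch (record c { lim = _ })} {record c { lim = _ ; cmp = _ }} B' B')
    cases inU false = let a , b , d , _ , r = B' in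
      bounded-if (isZero (lim c)) {fail c} B'
        (bounded-if (isZero (cmp c)) {record c { lim = _ ; w = 0 }} {unmatch (record c { lim = _ ; w = 0 })}
          (a , b , d , z≤n , r) (a , b , d , z≤n , r))
    cases inV true = let a , b , d , _ , r = B' in bounded-if (isZero (lim c)) {fail c} {record c { lim = _ ; w = suc (w c) }} B' (a , b , d , s≤s a₄ , r)
    cases inV false = bounded-if (isZero (lim c)) {fail c} {setPhase first c} B' B'
    cases first b = B'
    cases (second b') b = bounded-suc (label b' b c) (bounded-label b' b c B)
    cases ended b = B'

  bounded-consume : ∀ b c → Bounded K m j c → Bounded K m (suc j) (consume b c)
  bounded-consume b c B = bounded-if (bad c) {c} (bounded-suc c B) (bounded-consumeAt (phase c) b c B)

  bounded-feed : ∀ y c → Bounded K m j c → Bounded K m (length y + j) (feed y c)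
  bounded-feed [] c B = B
  bounded-feed {K} {m} {j} (b ∷ y) c B =
    subst (λ z → Bounded K m z (feed y (consume b c))) (+-suc (length y) j)
      (bounded-feed y (consume b c) (bounded-consume b c B))

  bounded-begin : ∀ c → h c + room c ≤ K → length (coins c) ≤ m → Bounded K m 0 (begin c)
  bounded-begin c hr l = z≤n , z≤n , z≤n , z≤n , hr , l

  bounded-pass : ∀ y c → h c + room c ≤ K → length (coins c) ≤ m → Bounded K m (length y) (pass y c)
  bounded-pass {K} {m} y c hr l = bounded-if (hasEnded (flag d)) {d} {fail d} B B
    where
    d = feed y (begin c)
    B : Bounded K m (length y) d
    B = subst (λ z → Bounded K m z d) (+-identityʳ (length y)) (bounded-feed y (begin c) (bounded-begin c hr l))

  small-of-bounded : ∀ {e c} → suc j < 2 ^ e → suc K < 2 ^ e → Bounded K m j c → Small e c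
  small-of-bounded {c = c} j< K< (a , b , d , f , g , _) =
    small (≤-<-trans (s≤s a) j<) (≤-<-trans (s≤s b) j<) (≤-<-trans (s≤s d) j<) (≤-<-trans (s≤s f) j<)
      (≤-<-trans (s≤s (≤-trans (m≤m+n (h c) (room c)) g)) K<)
      (≤-<-trans (s≤s (≤-trans (m≤n+m (room c) (h c)) g)) K<)

module ParserLoop (T : Transducer) where
  open Parser
  open Consume
  open ParserBounds
  open Recogniser T

  all-small : ∀ {e K m j} y c → suc (length y + j) < 2 ^ e → suc K < 2 ^ e → Bounded K m j c → AllSmall e y c
  all-small [] c j< K< B = tt
  all-small {e} {j = j} (b ∷ y) c j< K< B =
    small-of-bounded (≤-<-trans (s≤s (m≤n+m j (suc (length y)))) j<) K< B ,
    all-small y (consume b c) (subst (λ z → suc z < 2 ^ e) (sym (+-suc (length y) j)) j<) K< (bounded-consume b c B)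

  untake : Parser → Parser
  untake c = record c { flag = record (flag c) { taken = false } }

  ∧-left : ∀ a {b} → a ∧ b ≡ true → a ≡ true
  ∧-left true _ = refl

  -- To go on, the last toss must have been `true`, which only a nonempty list supplies, and that
  -- toss removed an entry.
  round-shorter : ∀ y c {m} → length (coins c) ≤ m → continues (flag (round y c)) ≡ true →
                  ∃ λ m' → m ≡ suc m' × length (coins (round y c)) ≤ m'
  round-shorter y c {m} le t =
    nonempty (coins (pass y (untake c))) (∧-left (headω (coins (pass y (untake c)))) t)
      (proj₂ (proj₂ (proj₂ (proj₂ (proj₂ (bounded-pass y (untake c) ≤-refl le))))))
    where
    nonempty : ∀ ω {m} → headω ω ≡ true → length ω ≤ m → ∃ λ m' → m ≡ suc m' × length (tailω ω) ≤ m'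
    nonempty (_ ∷ ω) _ (s≤s l) = _ , refl , l

  -- exhausted choices read as false, which ends the loop
  loop-total : ∀ y m c → length (coins c) ≤ m → ∃ λ c' → Loop y c c'
  loop-total y m c le with continues (flag c) in eq
  ... | false = c , stops eq
  ... | true with continues (flag (round y c)) in eq'
  ... | false = _ , again eq (stops eq')
  ... | true with round-shorter y c le eq'
  loop-total y (suc m) c le | true | true | _ , refl , le' =
    let c' , l = loop-total y m (round y c) le' in c' , again eq l

  tick-lim : ∀ n l c → iterate n tickLim (record c { lim = n + l }) ≡ record c { lim = l }
  tick-lim zero l c = refl
  tick-lim (suc n) l c = trans
    (cong (λ z → tickLim (iterate n tickLim (record c { lim = z }))) (sym (+-suc n l)))
    (cong tickLim (tick-lim n (suc l) c))

  tick-short : ∀ j m c → bad (iterate (suc (j + m)) tickLim (record c { lim = m })) ≡ true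
  tick-short zero m c = trans
    (cong (λ z → bad (tickLim (iterate m tickLim (record c { lim = z })))) (sym (+-identityʳ m)))
    (cong (bad ∘ tickLim) (tick-lim m 0 c))
  tick-short (suc j) m c = bad-tick (iterate (suc (j + m)) tickLim (record c { lim = m })) (tick-short j m c)
    where
    bad-tick : ∀ c → bad c ≡ true → bad (tickLim c) ≡ true
    bad-tick c b with isZero (lim c)
    ... | true = refl
    ... | false = b

  check-bad : ∀ c → bad c ≡ true → bad (if isZero (lim c) then c else fail c) ≡ true
  check-bad c b with isZero (lim c)
  ... | true = b
  ... | false = refl

  compared-bad : ∀ c → bad c ≡ true → bad (compared c) ≡ true
  compared-bad c b = stays (vT c)
    where
    stays : ∀ n → bad (iterate n tickLim (record c { lim = cur c })) ≡ true
    stays zero = b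
    stays (suc n) with isZero (lim (iterate n tickLim (record c { lim = cur c })))
    ... | true = refl
    ... | false = stays n

  accepted-not-bad : ∀ {A : Set} {b} → b ≡ true → b ≡ false → A
  accepted-not-bad refl ()

  -- Failure is never undone. For the vertices: if the current one is smaller than the target, `lim`
  -- runs out; if it is larger, a positive rest remains.
  verdict-sound : ∀ c → bad (verdict c) ≡ false → bad c ≡ false × h c ≡ 0 × cur c ≡ vT c
  verdict-sound c@(parser (flags _ _ _ true _) _ _ _ _ _ _ _ zero _ _) eq =
    accepted-not-bad (check-bad (compared c) (compared-bad c refl)) eq
  verdict-sound c@(parser _ _ _ _ _ _ _ _ (suc h) _ _) eq =
    accepted-not-bad (check-bad (compared (fail c)) (compared-bad (fail c) refl)) eq
  verdict-sound c@(parser (flags _ _ _ false _) _ _ t _ _ u _ zero _ _) eq with <-cmp u t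
  ... | tri≈ _ same _ = refl , refl , same
  ... | tri< u<t _ _ = accepted-not-bad (check-bad (compared c)
          (subst (λ n → bad (iterate n tickLim (record c { lim = u })) ≡ true)
            (trans (sym (+-suc (t ∸ suc u) u)) (m∸n+n≡m u<t)) (tick-short (t ∸ suc u) u c))) eq
  ... | tri> _ _ t<u = accepted-not-bad (cong (λ d → bad (if isZero (lim d) then d else fail d))
          (trans (cong (λ z → iterate t tickLim (record c { lim = z }))
                   (sym (trans (+-suc t (u ∸ suc t)) (m+[n∸m]≡n t<u))))
                 (tick-lim t (suc (u ∸ suc t)) c))) eq

  verdict-complete : ∀ c → bad c ≡ false → h c ≡ 0 → cur c ≡ vT c → bad (verdict c) ≡ false
  verdict-complete c@(parser _ _ _ t _ _ _ _ zero _ _) b refl refl = trans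
    (cong (λ d → bad (if isZero (lim d) then d else fail d))
      (trans (cong (λ z → iterate t tickLim (record c { lim = z })) (sym (+-identityʳ t))) (tick-lim t 0 c))) b

-- A pass without failure reads an encoding

module Parsing where
  open Parser
  open Consume

  consume-bad : ∀ b c → bad c ≡ true → consume b c ≡ c
  consume-bad b c eq with bad c | eq
  ... | true | refl = refl

  feed-bad : ∀ y c → bad c ≡ true → feed y c ≡ c
  feed-bad [] c eq = refl
  feed-bad (b ∷ y) c eq rewrite consume-bad b c eq = feed-bad y c eq

  Complete : Parser → Set
  Complete c = bad c ≡ false × hasEnded (flag c) ≡ true

  bad-incomplete : ∀ {A : Set} y c → bad c ≡ true → Complete (feed y c) → A
  bad-incomplete y c b (g , _) rewrite feed-bad y c b with trans (sym b) g
  ... | ()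

  In : Phase → ℕ → ℕ → Parser → Set
  In p n l c = bad c ≡ false × phase c ≡ p × vN c ≡ n × lim c ≡ l

  -- One argument for all vertex numbers: in `A l` the limit is `l`, each one read lowers it, and
  -- the closing zero needs it positive, whence `k < l`. A failure at either bit contradicts
  -- completion.
  parse-unary : (A : ℕ → Parser → Set) (Z : Parser → Set) →
    (∀ {l c} → A l c → bad (consume true c) ≡ true ⊎ ∃ λ l' → l ≡ suc l' × A l' (consume true c)) →
    (∀ {l c} → A l c → bad (consume false c) ≡ true ⊎ 0 < l × Z (consume false c)) →
    (∀ {l c} → A l c → hasEnded (flag c) ≡ false) →
    ∀ y {l c} → A l c → Complete (feed y c) →
    ∃ λ k → ∃ λ r → ∃ λ c' → y ≡ unary k ++ r × k < l × Z c' × feed y c ≡ feed r c'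
  parse-unary A Z tick end open' [] a (_ , t) with trans (sym (open' a)) t
  ... | ()
  parse-unary A Z tick end open' (true ∷ y) {c = c} a g with tick a
  ... | inj₁ b = bad-incomplete y (consume true c) b g
  ... | inj₂ (l' , refl , a') =
    let k , r , c' , ey , k< , z , ef = parse-unary A Z tick end open' y a' g
    in suc k , r , c' , cong (true ∷_) ey , s≤s k< , z , ef
  parse-unary A Z tick end open' (false ∷ y) {c = c} a g with end a
  ... | inj₁ b = bad-incomplete y (consume false c) b g
  ... | inj₂ (l> , z) = 0 , y , consume false c , refl , l> , z , refl

  open-phase : ∀ {p n l} c → hasEnded (flags p false false false false) ≡ false → In p n l c → hasEnded (flag c) ≡ false
  open-phase c h (_ , refl , _) = h

  parse-size : ∀ y v {c} → bad c ≡ false → phase c ≡ inN → vN c ≡ v → Complete (feed y c) →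
    ∃ λ k → ∃ λ r → ∃ λ c' → y ≡ unary k ++ r × In inS (k + v) (k + v) c' × feed y c ≡ feed r c'
  parse-size [] v {parser (flags inN _ _ false _) _ _ _ _ _ _ _ _ _ _} refl refl refl (_ , ())
  parse-size (true ∷ y) v {c@(parser (flags inN _ _ false _) _ _ _ _ _ _ _ _ _ _)} refl refl refl g =
    let k , r , c' , ey , i , ef = parse-size y (suc v) {consume true c} refl refl refl g
    in suc k , r , c' , cong (true ∷_) ey , subst (λ z → In inS z z c') (+-suc k v) i , ef
  parse-size (false ∷ y) v {c@(parser (flags inN _ _ false _) _ _ _ _ _ _ _ _ _ _)} refl refl refl g =
    0 , y , consume false c , refl , (refl , refl , refl , refl) , refl

  module _ {n : ℕ} where

    tick-S : ∀ {l c} → In inS n l c → bad (consume true c) ≡ true ⊎ ∃ λ l' → l ≡ suc l' × In inS n l' (consume true c)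
    tick-S {zero} {parser (flags inS _ _ false _) _ _ _ _ _ _ _ _ _ _} (refl , refl , refl , refl) = inj₁ refl
    tick-S {suc l} {parser (flags inS _ _ false _) _ _ _ _ _ _ _ _ _ _} (refl , refl , refl , refl) = inj₂ (l , refl , refl , refl , refl , refl)

    end-S : ∀ {l c} → In inS n l c → bad (consume false c) ≡ true ⊎ 0 < l × In inT n n (consume false c)
    end-S {zero} {parser (flags inS _ _ false _) _ _ _ _ _ _ _ _ _ _} (refl , refl , refl , refl) = inj₁ refl
    end-S {suc l} {parser (flags inS _ _ false _) _ _ _ _ _ _ _ _ _ _} (refl , refl , refl , refl) = inj₂ (z<s , refl , refl , refl , refl)

    tick-T : ∀ {l c} → In inT n l c → bad (consume true c) ≡ true ⊎ ∃ λ l' → l ≡ suc l' × In inT n l' (consume true c)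
    tick-T {zero} {parser (flags inT _ _ false _) _ _ _ _ _ _ _ _ _ _} (refl , refl , refl , refl) = inj₁ refl
    tick-T {suc l} {parser (flags inT _ _ false _) _ _ _ _ _ _ _ _ _ _} (refl , refl , refl , refl) = inj₂ (l , refl , refl , refl , refl , refl)

    Between : Parser → Set
    Between c = bad c ≡ false × phase c ≡ between × vN c ≡ n

    end-T : ∀ {l c} → In inT n l c → bad (consume false c) ≡ true ⊎ 0 < l × Between (consume false c)
    end-T {zero} {parser (flags inT _ _ false _) _ _ _ _ _ _ _ _ _ _} (refl , refl , refl , refl) = inj₁ refl
    end-T {suc l} {parser (flags inT _ _ false _) _ _ _ _ _ _ _ _ _ _} (refl , refl , refl , refl) = inj₂ (z<s , refl , refl , refl)

    tick-U : ∀ {l c} → In inU n l c → bad (consume true c) ≡ true ⊎ ∃ λ l' → l ≡ suc l' × In inU n l' (consume true c)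
    tick-U {zero} {parser (flags inU _ _ false _) _ _ _ _ _ _ _ _ _ _} (refl , refl , refl , refl) = inj₁ refl
    tick-U {suc l} {parser (flags inU _ _ false _) _ _ _ _ zero _ _ _ _ _} (refl , refl , refl , refl) = inj₂ (l , refl , refl , refl , refl , refl)
    tick-U {suc l} {parser (flags inU _ _ false _) _ _ _ _ (suc _) _ _ _ _ _} (refl , refl , refl , refl) = inj₂ (l , refl , refl , refl , refl , refl)

    end-U : ∀ {l c} → In inU n l c → bad (consume false c) ≡ true ⊎ 0 < l × In inV n n (consume false c)
    end-U {zero} {parser (flags inU _ _ false _) _ _ _ _ _ _ _ _ _ _} (refl , refl , refl , refl) = inj₁ refl
    end-U {suc l} {parser (flags inU _ _ false _) _ _ _ _ zero _ _ _ _ _} (refl , refl , refl , refl) = inj₂ (z<s , refl , refl , refl , refl)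
    end-U {suc l} {parser (flags inU _ _ false _) _ _ _ _ (suc _) _ _ _ _ _} (refl , refl , refl , refl) = inj₂ (z<s , refl , refl , refl , refl)

    tick-V : ∀ {l c} → In inV n l c → bad (consume true c) ≡ true ⊎ ∃ λ l' → l ≡ suc l' × In inV n l' (consume true c)
    tick-V {zero} {parser (flags inV _ _ false _) _ _ _ _ _ _ _ _ _ _} (refl , refl , refl , refl) = inj₁ refl
    tick-V {suc l} {parser (flags inV _ _ false _) _ _ _ _ _ _ _ _ _ _} (refl , refl , refl , refl) = inj₂ (l , refl , refl , refl , refl , refl)

    First : Parser → Set
    First c = bad c ≡ false × phase c ≡ first × vN c ≡ n

    end-V : ∀ {l c} → In inV n l c → bad (consume false c) ≡ true ⊎ 0 < l × First (consume false c)
    end-V {zero} {parser (flags inV _ _ false _) _ _ _ _ _ _ _ _ _ _} (refl , refl , refl , refl) = inj₁ refl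
    end-V {suc l} {parser (flags inV _ _ false _) _ _ _ _ _ _ _ _ _ _} (refl , refl , refl , refl) = inj₂ (z<s , refl , refl , refl)

    between-labelled : ∀ l c → bad c ≡ false → vN c ≡ n → bad (labelled l c) ≡ true ⊎ Between (labelled l c)
    between-labelled l c@(parser (flags _ _ _ false _) _ _ _ _ _ _ _ _ _ _) refl refl with wanted (flag (toss c))
    between-labelled l c@(parser (flags _ _ _ false _) _ _ _ _ _ _ _ _ _ _) refl refl | false = inj₂ (refl , refl , refl)
    between-labelled eps c@(parser (flags _ _ _ false _) _ _ _ _ _ _ _ _ _ _) refl refl | true = inj₂ (refl , refl , refl)
    between-labelled push c@(parser (flags _ _ _ false _) _ _ _ _ _ _ _ _ zero _) refl refl | true = inj₁ refl
    between-labelled push c@(parser (flags _ _ _ false _) _ _ _ _ _ _ _ _ (suc _) _) refl refl | true = inj₂ (refl , refl , refl)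
    between-labelled pop c@(parser (flags _ _ _ false _) _ _ _ _ _ _ _ zero _ _) refl refl | true = inj₁ refl
    between-labelled pop c@(parser (flags _ _ _ false _) _ _ _ _ _ _ _ (suc _) _ _) refl refl | true = inj₂ (refl , refl , refl)

    parse-label : ∀ y {c} → First c → Complete (feed y c) →
      ∃ λ l → ∃ λ r → ∃ λ c' → y ≡ labBits l ++ r × Between c' × feed y c ≡ feed r c'
    parse-label [] {parser (flags first _ _ false _) _ _ _ _ _ _ _ _ _ _} (refl , refl , refl) (_ , ())
    parse-label (_ ∷ []) {parser (flags first _ _ false _) _ _ _ _ _ _ _ _ _ _} (refl , refl , refl) (_ , ())
    parse-label (false ∷ false ∷ r) {c@(parser (flags first _ _ false _) _ _ _ _ _ _ _ _ _ _)} (refl , refl , refl) g =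
      bad-incomplete r (consume false (consume false c)) refl g
    parse-label (true ∷ true ∷ r) {c@(parser (flags first _ _ false _) _ _ _ _ _ _ _ _ _ _)} (refl , refl , refl) g
      with between-labelled push (consume true c) refl refl
    ... | inj₁ b = bad-incomplete r (labelled push (consume true c)) b g
    ... | inj₂ z = push , r , _ , refl , z , refl
    parse-label (true ∷ false ∷ r) {c@(parser (flags first _ _ false _) _ _ _ _ _ _ _ _ _ _)} (refl , refl , refl) g
      with between-labelled pop (consume true c) refl refl
    ... | inj₁ b = bad-incomplete r (labelled pop (consume true c)) b g
    ... | inj₂ z = pop , r , _ , refl , z , refl
    parse-label (false ∷ true ∷ r) {c@(parser (flags first _ _ false _) _ _ _ _ _ _ _ _ _ _)} (refl , refl , refl) g
      with between-labelled eps (consume false c) refl refl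
    ... | inj₁ b = bad-incomplete r (labelled eps (consume false c)) b g
    ... | inj₂ z = eps , r , _ , refl , z , refl

    parse-edge : ∀ y {c} → In inU n n c → Complete (feed y c) →
      Σ (Fin n) λ u → Σ (Fin n) λ v → ∃ λ l → ∃ λ r → ∃ λ c' →
        y ≡ unary (toℕ u) ++ unary (toℕ v) ++ labBits l ++ r × Between c' × feed y c ≡ feed r c'
    parse-edge y i g with parse-unary (In inU n) (In inV n n) tick-U end-U (λ {l} {c} → open-phase c refl) y i g
    ... | k , r₁ , c₁ , refl , u< , z₁ , f₁
      with parse-unary (In inV n) First tick-V end-V (λ {l} {c} → open-phase c refl) r₁ z₁ (subst Complete f₁ g)
    ... | k' , r₂ , c₂ , refl , v< , z₂ , f₂ with parse-label r₂ z₂ (subst Complete f₂ (subst Complete f₁ g))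
    ... | l , r₃ , c₃ , refl , z₃ , f₃ =
      fromℕ< u< , fromℕ< v< , l , r₃ , c₃ ,
      cong₂ (λ a b → unary a ++ unary b ++ labBits l ++ r₃) (sym (toℕ-fromℕ< u<)) (sym (toℕ-fromℕ< v<)) ,
      z₃ , trans f₁ (trans f₂ f₃)

    suffix≤ : ∀ (a b c r : List Bool) {m} → length (a ++ b ++ c ++ r) ≤ m → length r ≤ m
    suffix≤ a b c r le = ≤-trans (drop≤ c r) (≤-trans (drop≤ b (c ++ r)) (≤-trans (drop≤ a (b ++ c ++ r)) le))
      where
      drop≤ : ∀ (a r : List Bool) → length r ≤ length (a ++ r)
      drop≤ a r = ≤-trans (m≤n+m (length r) (length a)) (≤-reflexive (sym (length-++ a)))

    -- `m` bounds the length, as the recursion continues with what `parse-edge` leaves over, which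
    -- is not a subterm.
    parse-edges : ∀ m y {c} → length y ≤ m → Between c → Complete (feed y c) →
      Σ (List (Fin n × Label × Fin n)) λ E → y ≡ concatMap encEdge E ++ [ false ]
    parse-edges m [] {parser (flags between _ _ false _) _ _ _ _ _ _ _ _ _ _} le (refl , refl , refl) (_ , ())
    parse-edges m (false ∷ []) le z g = [] , refl
    parse-edges m (false ∷ b ∷ y) {c@(parser (flags between _ _ false _) _ _ _ _ _ _ _ _ _ _)} le (refl , refl , refl) g =
      bad-incomplete y (consume b (consume false c)) refl g
    parse-edges (suc m) (true ∷ y) {c@(parser (flags between _ _ false _) _ _ _ _ _ _ _ _ _ _)} (s≤s le) (refl , refl , refl) g
      with parse-edge y {consume true c} (refl , refl , refl , refl) g
    ... | u , v , l , r , c' , refl , z , f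
      with parse-edges m r (suffix≤ (unary (toℕ u)) (unary (toℕ v)) (labBits l) r le) z (subst Complete f g)
    ... | E , refl = (u , l , v) ∷ E ,
      sym (trans (++-assoc (encEdge (u , l , v)) (concatMap encEdge E) [ false ])
        (encEdge-++ u v l (concatMap encEdge E ++ [ false ])))

  finish-complete : ∀ c → bad (finish c) ≡ false → Complete c
  finish-complete c g with hasEnded (flag c)
  finish-complete c g | true = g , refl
  finish-complete c () | false

  -- The transducer may print anything; this is what certifies that the accepted output encodes an
  -- instance.
  parse-instance : ∀ y c → bad c ≡ false → bad (pass y c) ≡ false → ∃ λ I → encode I ≡ y
  parse-instance y c@(parser (flags _ _ _ false _) _ _ _ _ _ _ _ _ _ _) refl good
    with finish-complete (feed y (begin c)) good
  ... | g with parse-size y 0 {begin c} refl refl refl g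
  ... | k , r , c₁ , refl , z , f rewrite +-identityʳ k
    with parse-unary (In inS k) (In inT k k) tick-S end-S (λ {l} {c} → open-phase c refl) r z (subst Complete f g)
  ... | s , r₁ , c₂ , refl , s< , z₁ , f₁
    with parse-unary (In inT k) Between tick-T end-T (λ {l} {c} → open-phase c refl) r₁ z₁
           (subst Complete f₁ (subst Complete f g))
  ... | t , r₂ , c₃ , refl , t< , z₂ , f₂
    with parse-edges (length r₂) r₂ ≤-refl z₂ (subst Complete f₂ (subst Complete f₁ (subst Complete f g)))
  ... | E , refl = mkInstance k (fromℕ< s<) (fromℕ< t<) E ,
    cong₂ (λ a b → unary k ++ unary a ++ unary b ++ concatMap encEdge E ++ [ false ])
      (toℕ-fromℕ< s<) (toℕ-fromℕ< t<)

-- The effect of a pass on an encoded instance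

module Passing where
  open Parser
  open Consume

  -- The value of `match` after a source of `k` ones has been compared with `cmp` starting at `m`,
  -- when it was `b` before.
  eqRun : Bool → ℕ → ℕ → Bool
  eqRun b zero m = if isZero m then b else false
  eqRun b (suc k) zero = eqRun false k zero
  eqRun b (suc k) (suc m) = eqRun b k m

  eqRun-false : ∀ k m → eqRun false k m ≡ false
  eqRun-false zero zero = refl
  eqRun-false zero (suc m) = refl
  eqRun-false (suc k) zero = eqRun-false k zero
  eqRun-false (suc k) (suc m) = eqRun-false k m

  eqRun-sound : ∀ k m → eqRun true k m ≡ true → k ≡ m
  eqRun-sound zero zero _ = refl
  eqRun-sound (suc k) zero eq with trans (sym (eqRun-false k zero)) eq
  ... | ()
  eqRun-sound (suc k) (suc m) eq = cong suc (eqRun-sound k m eq)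

  eqRun-refl : ∀ k → eqRun true k k ≡ true
  eqRun-refl zero = refl
  eqRun-refl (suc k) = eqRun-refl k

  at : Phase → Bool → Bool → Bool → (n s t lim cmp cur w h room : ℕ) → List Bool → Parser
  at p m tk co n s t l cm cu w h r ω = parser (flags p m tk false co) n s t l cm cu w h r ω

  module _ {tk co : Bool} {cu h r : ℕ} {ω rest : List Bool} where

    feed-N : ∀ k v {m s t l cm w} → feed (unary k ++ rest) (at inN m tk co v s t l cm cu w h r ω) ≡
      feed rest (at inS m tk co (k + v) s t (k + v) cm cu w h r ω)
    feed-N zero v = refl
    feed-N (suc k) v {m} {s} {t} {l} {cm} {w} = trans (feed-N k (suc v))
      (cong (λ z → feed rest (at inS m tk co z s t z cm cu w h r ω)) (+-suc k v))

    feed-S : ∀ k v {l m n t cm w} → feed (unary k ++ rest) (at inS m tk co n v t (k + suc l) cm cu w h r ω) ≡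
      feed rest (at inT m tk co n (k + v) t n cm cu w h r ω)
    feed-S zero v = refl
    feed-S (suc k) v {l} {m} {n} {t} {cm} {w} = trans (feed-S k (suc v))
      (cong (λ z → feed rest (at inT m tk co n z t n cm cu w h r ω)) (+-suc k v))

    feed-T : ∀ k v {l m n s cm w} → feed (unary k ++ rest) (at inT m tk co n s v (k + suc l) cm cu w h r ω) ≡
      feed rest (at between m tk co n s (k + v) (suc l) cm cu w h r ω)
    feed-T zero v = refl
    feed-T (suc k) v {l} {m} {n} {s} {cm} {w} = trans (feed-T k (suc v))
      (cong (λ z → feed rest (at between m tk co n s z (suc l) cm cu w h r ω)) (+-suc k v))

    feed-U : ∀ k {m l n s t cm w} → feed (unary k ++ rest) (at inU m tk co n s t (k + suc l) cm cu w h r ω) ≡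
      feed rest (at inV (eqRun m k cm) tk co n s t n (cm ∸ k) cu 0 h r ω)
    feed-U zero {cm = zero} = refl
    feed-U zero {cm = suc _} = refl
    feed-U (suc k) {m} {l} {n} {s} {t} {zero} = trans (feed-U k {false} {l} {n} {s} {t} {zero})
      (cong (λ z → feed rest (at inV (eqRun false k 0) tk co n s t n z cu 0 h r ω)) (0∸n≡0 k))
    feed-U (suc k) {cm = suc cm} = feed-U k

    feed-V : ∀ k v {m l n s t cm} → feed (unary k ++ rest) (at inV m tk co n s t (k + suc l) cm cu v h r ω) ≡
      feed rest (at first m tk co n s t (suc l) cm cu (k + v) h r ω)
    feed-V zero v = refl
    feed-V (suc k) v {m} {l} {n} {s} {t} {cm} = trans (feed-V k (suc v))
      (cong (λ z → feed rest (at first m tk co n s t (suc l) cm cu z h r ω)) (+-suc k v))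

  -- taken, current vertex, height, room, choices
  Core : Set
  Core = Bool × ℕ × ℕ × ℕ × List Bool

  jump : Label → Core → Maybe Core
  jump eps κ = just κ
  jump push (tk , cu , h , zero , ω) = nothing
  jump push (tk , cu , h , suc r , ω) = just (tk , cu , suc h , r , ω)
  jump pop (tk , cu , zero , r , ω) = nothing
  jump pop (tk , cu , suc h , r , ω) = just (tk , cu , h , suc r , ω)

  edgeStep : ℕ → Label → ℕ → Core → Maybe Core
  edgeStep u l v (tk , cu , h , r , ω) =
    if eqRun true u cu ∧ not tk ∧ headω ω then jump l (true , v , h , r , tailω ω)
    else just (tk , cu , h , r , tailω ω)

  module _ {n : ℕ} where

    edgesStep : List (Fin n × Label × Fin n) → Core → Maybe Core
    edgesStep [] κ = just κ
    edgesStep ((u , l , v) ∷ E) κ = edgeStep (toℕ u) l (toℕ v) κ Maybe.>>= edgesStep E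

    module _ (s t : ℕ) where

      -- The fields left existential are scratch values, overwritten before they are next used.
      Shows : Phase → Maybe Core → Parser → Set
      Shows p nothing c = bad c ≡ true
      Shows p (just (tk , cu , h , r , ω)) c =
        ∃ λ m → ∃ λ co → ∃ λ l → ∃ λ cm → ∃ λ w' → c ≡ at p m tk co n s t l cm cu w' h r ω

      shows-labelled : ∀ l {p m tk co li cm cu v h r ω} →
        Shows between (if m ∧ not tk ∧ headω ω then jump l (true , v , h , r , tailω ω)
                       else just (tk , cu , h , r , tailω ω))
          (labelled l (at p m tk co n s t li cm cu v h r ω))
      shows-labelled l {m = m} {tk} {ω = ω} with m ∧ not tk ∧ headω ω
      shows-labelled l | false = _ , _ , _ , _ , _ , refl
      shows-labelled eps | true = _ , _ , _ , _ , _ , refl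
      shows-labelled push {r = zero} | true = refl
      shows-labelled push {r = suc r} | true = _ , _ , _ , _ , _ , refl
      shows-labelled pop {h = zero} | true = refl
      shows-labelled pop {h = suc h} | true = _ , _ , _ , _ , _ , refl

      feed-label : ∀ l {rest m tk co li cm cu w' h r ω} → ∃ λ p →
        feed (labBits l ++ rest) (at first m tk co n s t li cm cu w' h r ω) ≡
        feed rest (labelled l (at p m tk co n s t li cm cu w' h r ω))
      feed-label push = _ , refl
      feed-label pop = _ , refl
      feed-label eps = _ , refl

      below : ∀ (u : Fin n) → ∃ λ l → n ≡ toℕ u + suc l
      below u = n ∸ suc (toℕ u) , trans (sym (m+[n∸m]≡n (toℕ<n u))) (sym (+-suc (toℕ u) _))

      feed-edge : ∀ u l v κ c {rest} → Shows between (just κ) c →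
        ∃ λ d → feed (encEdge (u , l , v) ++ rest) c ≡ feed rest d ×
                Shows between (edgeStep (toℕ u) l (toℕ v) κ) d
      feed-edge u l v (tk , cu , h , r , ω) c {rest} (m , co , li , cm , w' , refl) =
        let a , ea = below u
            b , eb = below v
            p , e₃ = feed-label l
        in _ , trans (cong (λ z → feed z (at between m tk co n s t li cm cu w' h r ω)) (encEdge-++ u v l rest))
          (trans (cong (λ z → feed (unary (toℕ u) ++ unary (toℕ v) ++ labBits l ++ rest)
                                (at inU true tk co n s t z cu cu w' h r ω)) ea)
          (trans (feed-U (toℕ u))
          (trans (cong (λ z → feed (unary (toℕ v) ++ labBits l ++ rest)
                                (at inV (eqRun true (toℕ u) cu) tk co n s t z (cu ∸ toℕ u) cu 0 h r ω)) eb)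
          (trans (feed-V (toℕ v) 0)
          (trans (cong (λ z → feed (labBits l ++ rest)
                                (at first (eqRun true (toℕ u) cu) tk co n s t (suc b) (cu ∸ toℕ u) cu z h r ω))
                       (+-identityʳ (toℕ v)))
            e₃))))) ,
          shows-labelled l {p} {eqRun true (toℕ u) cu} {tk} {co} {suc b} {cu ∸ toℕ u} {cu} {toℕ v} {h} {r} {ω}

      feed-edges : ∀ E κ c → Shows between (just κ) c →
        Shows ended (edgesStep E κ) (feed (concatMap encEdge E ++ [ false ]) c)
      feed-edges [] κ c (_ , _ , _ , _ , _ , refl) = _ , _ , _ , _ , _ , refl
      feed-edges ((u , l , v) ∷ E) κ c S =
        let d , eq , S' = feed-edge u l v κ c {rest} S
        in subst (Shows ended _) (sym (trans (cong (λ z → feed z c) (++-assoc (encEdge (u , l , v)) _ [ false ])) eq))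
             (others (edgeStep (toℕ u) l (toℕ v) κ) d S')
        where
        rest = concatMap encEdge E ++ [ false ]
        others : ∀ mκ d → Shows between mκ d → Shows ended (mκ Maybe.>>= edgesStep E) (feed rest d)
        others (just κ') d S' = feed-edges E κ' d S'
        others nothing d b = subst (λ z → bad z ≡ true) (sym (Parsing.feed-bad rest d b)) b

  coreOf : Parser → Core
  coreOf c = Flags.taken (flag c) , cur c , h c , room c , coins c

  -- On an encoding all syntax checks succeed and only the guessing matters, so both directions of
  -- correctness can argue about `edgesStep`.
  pass-encode : ∀ I c → bad c ≡ false → let open Instance I in
    Shows {nV} (toℕ src) (toℕ tgt) ended (edgesStep edges (coreOf c)) (pass (encode I) c)
  pass-encode (mkInstance n s t E) c@(parser (flags _ _ tk false co) _ _ _ _ _ cu _ h r ω) refl =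
    finished (edgesStep E (coreOf c)) (feed (encode (mkInstance n s t E)) (begin c))
      (subst (Shows {n} (toℕ s) (toℕ t) ended (edgesStep E (coreOf c))) (sym eq)
        (feed-edges (toℕ s) (toℕ t) E (coreOf c) c₀ (_ , _ , _ , _ , _ , refl)))
    where
    finished : ∀ mκ d → Shows {n} (toℕ s) (toℕ t) ended mκ d → Shows {n} (toℕ s) (toℕ t) ended mκ (finish d)
    finished (just _) d (_ , _ , _ , _ , _ , refl) = _ , _ , _ , _ , _ , refl
    finished nothing d b with hasEnded (flag d)
    ... | true = b
    ... | false = refl
    a = proj₁ (below (toℕ s) (toℕ t) s)
    ea = proj₂ (below (toℕ s) (toℕ t) s)
    b = proj₁ (below (toℕ s) (toℕ t) t)
    eb = proj₂ (below (toℕ s) (toℕ t) t)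
    es = concatMap encEdge E ++ [ false ]
    c₀ = at between false tk co n (toℕ s) (toℕ t) (suc b) 0 cu 0 h r ω
    eq : feed (encode (mkInstance n s t E)) (begin c) ≡
         feed es c₀
    eq = trans (feed-N n 0)
      (trans (cong (λ z → feed (unary (toℕ s) ++ unary (toℕ t) ++ es) (at inS false tk co z 0 0 z 0 cu 0 h r ω)) (+-identityʳ n))
      (trans (cong (λ z → feed (unary (toℕ s) ++ unary (toℕ t) ++ es) (at inS false tk co n 0 0 z 0 cu 0 h r ω)) ea)
      (trans (feed-S (toℕ s) 0 {a})
      (trans (cong₂ (λ z z' → feed (unary (toℕ t) ++ es) (at inT false tk co n z 0 z' 0 cu 0 h r ω)) (+-identityʳ (toℕ s)) eb)
      (trans (feed-T (toℕ t) 0 {b})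
        (cong (λ z → feed es (at between false tk co n (toℕ s) z (suc b) 0 cu 0 h r ω)) (+-identityʳ (toℕ t))))))))

skipω : ∀ {A : Set} → List A → List Bool → List Bool
skipω [] ω = ω
skipω (_ ∷ E) ω = skipω E (tailω ω)

skipω-replicate : ∀ {A : Set} (E : List A) ω → skipω E (replicate (length E) false ++ ω) ≡ ω
skipω-replicate [] ω = refl
skipω-replicate (_ ∷ E) ω = skipω-replicate E ω

-- taken is set on the first pass, which only reads the sizes
initialParser : List Bool → Parser
initialParser ω = parser (flags inN false true false false) 0 0 0 0 0 0 0 0 0 ω

-- Guessed passes and climbs

module Correct (T : Transducer) (I : Instance) where
  open Instance I renaming (nV to n)
  open Dyck edges
  open Parser
  open Consume
  open Passing
  open Recogniser T
  open ParserLoop T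

  private
    H : ℕ
    H = n * n

  Edges : Set
  Edges = List (Fin n × Label × Fin n)

  if-∧-false : ∀ {A : Set} a {t e : A} → (if a ∧ false then t else e) ≡ e
  if-∧-false true = refl
  if-∧-false false = refl

  edges-taken : ∀ (E : Edges) {cu h r ω} → edgesStep E (true , cu , h , r , ω) ≡ just (true , cu , h , r , skipω E ω)
  edges-taken [] = refl
  edges-taken ((u , l , v) ∷ E) {cu} =
    trans (cong (Maybe._>>= edgesStep E) (if-∧-false (eqRun true (toℕ u) cu))) (edges-taken E)

  Moved : Fin n → ℕ → Core → Set
  Moved u h (_ , cu' , h' , r' , _) =
    ∃ λ v → cu' ≡ toℕ v × Star (Climb H) (u , h) (v , h') × h' + r' ≡ H

  jump-sound : ∀ (E : Edges) {u l v h r ω κ} → (u , l , v) ∈ edges → h + r ≡ H →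
    (jump l (true , toℕ v , h , r , ω) Maybe.>>= edgesStep E) ≡ just κ → Moved u h κ
  jump-sound E {l = eps} {v} m hr eq with trans (sym (edges-taken E)) eq
  ... | refl = v , refl , level m ◅ ε , hr
  jump-sound E {l = push} {r = zero} m hr ()
  jump-sound E {l = push} {v} {h} {suc r} m hr eq with trans (sym (edges-taken E)) eq
  ... | refl = v , refl , up (subst (suc h ≤_) hr (m<m+n h z<s)) m ◅ ε , trans (sym (+-suc h r)) hr
  jump-sound E {l = pop} {h = zero} m hr ()
  jump-sound E {l = pop} {v} {suc h} {r} m hr eq with trans (sym (edges-taken E)) eq
  ... | refl = v , refl , down m ◅ ε , trans (+-suc h r) hr

  edges-sound : ∀ (E : Edges) {u h r ω κ} → (∀ {e} → e ∈ E → e ∈ edges) → h + r ≡ H →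
    edgesStep E (false , toℕ u , h , r , ω) ≡ just κ → Moved u h κ
  edges-sound [] {u} sub hr refl = u , refl , ε , hr
  edges-sound ((a , l , b) ∷ E) {u} {ω = ω} sub hr eq with eqRun true (toℕ a) (toℕ u) in q
  ... | false = edges-sound E (sub ∘ there) hr eq
  ... | true with headω ω
  ... | false = edges-sound E (sub ∘ there) hr eq
  ... | true with toℕ-injective (eqRun-sound (toℕ a) (toℕ u) q)
  ... | refl = jump-sound E {v = b} (sub (here refl)) hr eq

  -- The choices are `true` at the wanted edge and `false` at all others, so an earlier edge with
  -- the same source is passed over.
  edges-complete : ∀ (E : Edges) {u l v h r h' r'} → (u , l , v) ∈ E →
    (∀ ω → jump l (true , toℕ v , h , r , ω) ≡ just (true , toℕ v , h' , r' , ω)) →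
    ∃ λ β → ∀ ω → edgesStep E (false , toℕ u , h , r , β ++ ω) ≡ just (true , toℕ v , h' , r' , ω)
  edges-complete ((u , l , v) ∷ E) {h = h} {r} {h'} {r'} (here refl) j = true ∷ replicate (length E) false , λ ω →
    trans (cong (λ b → (if b ∧ true then jump l (true , toℕ v , h , r , replicate (length E) false ++ ω)
                         else just (false , toℕ u , h , r , replicate (length E) false ++ ω)) Maybe.>>= edgesStep E)
             (eqRun-refl (toℕ u)))
      (trans (cong (Maybe._>>= edgesStep E) (j (replicate (length E) false ++ ω)))
        (trans (edges-taken E) (cong (λ ω → just (true , toℕ v , h' , r' , ω)) (skipω-replicate E ω))))
  edges-complete ((a , _ , _) ∷ E) {u} (there m) j =
    let β , eq = edges-complete E m j in false ∷ β , λ ω →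
    trans (cong (Maybe._>>= edgesStep E) (if-∧-false (eqRun true (toℕ a) (toℕ u)))) (eq ω)

  climb-complete : ∀ {u h v h' r} → Climb H (u , h) (v , h') → h + r ≡ H → ∃ λ β → ∃ λ r' → h' + r' ≡ H ×
    (∀ ω → edgesStep edges (false , toℕ u , h , r , β ++ ω) ≡ just (true , toℕ v , h' , r' , ω))
  climb-complete (level m) hr = let β , eq = edges-complete edges m (λ _ → refl) in β , _ , hr , eq
  climb-complete {h = h} {r = zero} (up h<H m) hr = ⊥-elim (<-irrefl (trans (sym (+-identityʳ h)) hr) h<H)
  climb-complete {h = h} {r = suc r} (up _ m) hr =
    let β , eq = edges-complete edges m (λ _ → refl) in β , r , trans (sym (+-suc h r)) hr , eq
  climb-complete {h = suc h} {r = r} (down m) hr =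
    let β , eq = edges-complete edges m (λ _ → refl) in β , suc r , trans (+-suc h r) hr , eq

  -- the path guessed so far leads from the source to the current vertex
  Reached : Parser → Set
  Reached c = bad c ≡ false × vT c ≡ toℕ tgt ×
    ∃ λ v → cur c ≡ toℕ v × Star (Climb H) (src , 0) (v , h c) × h c + room c ≡ H

  Explored : Parser → Set
  Explored c = bad c ≡ true ⊎ Reached c

  explored-shows : ∀ {u h₀} mκ d → Star (Climb H) (src , 0) (u , h₀) → (∀ {κ} → mκ ≡ just κ → Moved u h₀ κ) →
    Shows {n} (toℕ src) (toℕ tgt) ended mκ d → Explored (toss d)
  explored-shows nothing d S mv b = inj₁ b
  explored-shows (just κ) d S mv (_ , _ , _ , _ , _ , refl) =
    let v , e , S' , hr = mv refl in inj₂ (refl , refl , v , e , S ◅◅ S' , hr)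

  explored-round : ∀ c → Reached c → Explored (round (encode I) c)
  explored-round c (b , _ , v , refl , S , hr) =
    explored-shows (edgesStep edges (coreOf (untake c))) (pass (encode I) (untake c)) S
      (edges-sound edges id hr) (pass-encode I (untake c) b)

  ∧-right : ∀ a {b} → a ∧ not b ≡ true → b ≡ false
  ∧-right true {false} _ = refl

  loop-bad : ∀ {y c c'} → Loop y c c' → bad c ≡ true → bad c' ≡ true
  loop-bad (stops _) b = b
  loop-bad {c = c} (again t _) b with trans (sym b) (∧-right (coin c) t)
  ... | ()

  loop-explored : ∀ {c c'} → Loop (encode I) c c' → Explored c → Explored c'
  loop-explored (stops _) e = e
  loop-explored {c} (again t l) (inj₁ b) with trans (sym b) (∧-right (coin c) t)
  ... | ()
  loop-explored {c} (again t l) (inj₂ r) = loop-explored l (explored-round c r)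

  record Placed (u : Fin n) (h₀ : ℕ) (ω : List Bool) (c : Parser) : Set where
    constructor placed
    field
      good    : bad c ≡ false
      target  : vT c ≡ toℕ tgt
      vertex  : cur c ≡ toℕ u
      height  : h c ≡ h₀
      space   : h₀ + room c ≡ H
      choices : coins c ≡ ω

  -- The first pass follows no edge but still spends one choice per edge, whence `skipω`.
  placed-first : ∀ ω → ∃ λ c → afterFirst (encode I) (initialParser ω) ≡ toss c × Placed src 0 (skipω edges ω) c
  placed-first ω = placed-at (pass (encode I) (initialParser ω))
      (subst (λ k → Shows {n} (toℕ src) (toℕ tgt) ended k (pass (encode I) (initialParser ω)))
        (edges-taken edges) (pass-encode I (initialParser ω) refl))
    where
    settled : Parser → Parser
    settled d = record d { cur = vS d ; room = vN d * vN d + room d }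
    placed-at : ∀ d → Shows {n} (toℕ src) (toℕ tgt) ended (just (true , 0 , 0 , 0 , skipω edges ω)) d →
      ∃ λ c → toss (settled d) ≡ toss c × Placed src 0 (skipω edges ω) c
    placed-at d S = settled d , refl , at-source d S
      where
      at-source : ∀ d → Shows {n} (toℕ src) (toℕ tgt) ended (just (true , 0 , 0 , 0 , skipω edges ω)) d →
        Placed src 0 (skipω edges ω) (settled d)
      at-source d (_ , _ , _ , _ , _ , refl) = placed refl refl refl refl (+-identityʳ H) refl

  first-explored : ∀ ω → Explored (afterFirst (encode I) (initialParser ω))
  first-explored ω with placed-first ω
  ... | c , eq , placed g t v refl sp _ =
    subst Explored (sym eq) (inj₂ (g , t , src , v , ε , sp))

  -- Each step of the climb is one round: a `true` to continue, then the choices from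
  -- `climb-complete`; the empty list at the end tosses `false`. They depend only on climb and room,
  -- so they are fixed before the parser state.
  path-choices : ∀ {u h₀ v} → Star (Climb H) (u , h₀) (v , 0) → ∀ {r} → h₀ + r ≡ H → ∃ λ ω → ∀ c → room c ≡ r →
    Placed u h₀ ω c → ∃ λ c' → Loop (encode I) (toss c) c' × bad c' ≡ false × h c' ≡ 0 × cur c' ≡ toℕ v × vT c' ≡ toℕ tgt
  path-choices ε hr = [] , λ { c _ (placed g t v hh _ ω) →
    toss c , stops (cong (λ ω → headω ω ∧ not (bad c)) ω) , g , hh , v , t }
  path-choices {u} {h₀} {t} (_◅_ {j = v , h'} st rest) {r} hr with climb-complete st hr
  ... | β , r' , hr' , eq with path-choices rest hr'
  ... | ω , loop = true ∷ β ++ ω , continue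
    where
    continue : ∀ c → room c ≡ r → Placed u h₀ (true ∷ β ++ ω) c →
      ∃ λ c' → Loop (encode I) (toss c) c' × bad c' ≡ false × h c' ≡ 0 × cur c' ≡ toℕ t × vT c' ≡ toℕ tgt
    continue c er (placed g tg cu hh _ ωs) =
      proceed (pass (encode I) (untake (toss c)))
        (subst (λ k → Shows {n} (toℕ src) (toℕ tgt) ended k (pass (encode I) (untake (toss c))))
          (trans (cong (edgesStep edges) core≡) (eq ω)) (pass-encode I (untake (toss c)) g)) refl
      where
      core≡ : coreOf (untake (toss c)) ≡ (false , toℕ u , h₀ , r , β ++ ω)
      core≡ = cong (false ,_) (cong₂ _,_ cu (cong₂ _,_ hh (cong₂ _,_ er (cong tailω ωs))))
      proceed : ∀ d → Shows {n} (toℕ src) (toℕ tgt) ended (just (true , toℕ v , h' , r' , ω)) d →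
        round (encode I) (toss c) ≡ toss d →
        ∃ λ c' → Loop (encode I) (toss c) c' × bad c' ≡ false × h c' ≡ 0 × cur c' ≡ toℕ t × vT c' ≡ toℕ tgt
      proceed d (_ , _ , _ , _ , _ , refl) same =
        let c' , l , rest = loop d refl (placed refl refl refl refl hr' refl)
        in c' , again (cong₂ (λ ω b → headω ω ∧ not b) ωs g) (subst (λ z → Loop (encode I) z c') (sym same) l) , rest

-- From 1LogCFL to NL

module Decide (T : Transducer) (c : ℕ) (f : List Bool → List Bool)
  (computes : ∀ x → ComputesInSpace T x (logSpace (suc c) (length x)) (f x)) where

  open Parser
  open Consume
  open ParserBounds
  open Recogniser T
  open ParserProgram T
  open ParserLoop T

  private
    q b : ℕ
    q = Transducer.states T
    b = suc (Transducer.symbols T)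

  Flags-finite : Finite Flags
  Flags-finite = retract-finite (λ { (flags p m t b c) → p , m , t , b , c }) (λ { (p , m , t , b , c) → flags p m t b c })
    (λ _ → refl) (×-finite Phase-finite (×-finite Bool-finite (×-finite Bool-finite (×-finite Bool-finite Bool-finite))))

  Control-finite : Finite Control
  Control-finite = ×-finite
    (retract-finite (λ { (simulator s a d o t) → s , a , d , o , t }) (λ { (s , a , d , o , t) → simulator s a d o t })
      (λ _ → refl) (×-finite (Fin-finite q) (×-finite (Fin-finite b) (×-finite Dir-finite
        (×-finite (Maybe-finite Bool-finite) Bool-finite)))))
    Flags-finite

  g₀ : Control
  g₀ = simulator (Transducer.start T) zero stay nothing false , flags inN false true false false

  accepts : Control → Bool
  accepts (_ , f) = not (Flags.bad f)

  -- Bounds the configurations of `T` and thereby the length of its output. It is used doubled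
  -- because `room` is set to the square of a number of at most that length.
  exponent : ℕ
  exponent = q + (1 + (2 * (2 * suc c) + 2 * (b * suc c)))

  module At (x : List Bool) (e : ℕ) (lt : (2 + length x) ^ (exponent + exponent) < 2 ^ e) where

    open Exec₂ {Control} {12} x e
    open RunParser x e using (sim)

    private
      n s M K : ℕ
      n = length x
      s = logSpace (suc c) n
      M = length (f x)
      K = q * ((2 + n) * (s * b ^ s))

    K≤ : K ≤ (2 + n) ^ exponent
    K≤ = configs-bound q b (suc c) n

    M<K : M < K
    M<K = ≤-<-trans (length≤runLength (computes x)) (runLength-bound (computes x))

    K*K< : K * K < 2 ^ e
    K*K< = ≤-<-trans (≤-trans (*-mono-≤ K≤ K≤) (≤-reflexive (sym (^-distribˡ-+-* (2 + n) exponent exponent)))) lt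

    K<  : K < 2 ^ e
    K< = ≤-<-trans (m≤m*n K K {{>-nonZero (≤-<-trans z≤n M<K)}}) K*K<

    b^s< : b ^ s < 2 ^ e
    b^s< = ≤-<-trans (≤-trans (m≤n*m (b ^ s) s) (≤-trans (m≤n*m (s * b ^ s) (2 + n))
      (m≤n*m ((2 + n) * (s * b ^ s)) q {{Finₚ.nonZeroIndex (Transducer.start T)}}))) K<

    M+0< : suc (M + 0) < 2 ^ e
    M+0< = subst (λ z → suc z < 2 ^ e) (sym (+-identityʳ M)) (≤-<-trans M<K K<)

    M*M< : suc (M * M) < 2 ^ e
    M*M< = ≤-<-trans (*-mono-< M<K M<K) K*K<

    -- This covers malformed output too: the size read by the first pass is at most `M`, so
    -- `h + room` never exceeds `M * M`.
    run : ∀ ω {c'} → Loop (f x) (afterFirst (f x) (initialParser ω)) c' →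
      ∃ λ τ → Exec program (Realise.init Control-finite program g₀ x e ω []) τ ×
              accepts (S₂.ctl τ) ≡ not (bad (verdict c'))
    run ω {c'} l =
      let bp = bounded-pass (f x) (initialParser ω) (≤-refl {0}) ≤-refl
          t , E = Rerun.run-program x e b^s< (computes x) (λ c → h c + room c ≤ M * M)
            (λ {c} i → all-small (f x) (begin (untake c)) M+0< M*M< (bounded-begin (untake c) i ≤-refl))
            (λ {c} i → fifth (bounded-pass (f x) (untake c) i ≤-refl))
            {sim (proj₁ g₀) 0 0 0 zero} {initialParser ω}
            (all-small (f x) (begin (initialParser ω)) M+0< (≤-<-trans (s≤s z≤n) M*M<) (bounded-begin (initialParser ω) (≤-refl {0}) ≤-refl))
            (≤-<-trans (+-mono-≤ (*-mono-≤ (proj₁ bp) (proj₁ bp)) (≤-trans (m≤n+m _ (h (pass (f x) (initialParser ω)))) (fifth bp)))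
              (≤-<-trans (≤-reflexive (+-identityʳ (M * M))) (<-trans (n<1+n _) M*M<)))
            (≤-trans (≤-reflexive (swap (h (pass (f x) (initialParser ω))) _ (room (pass (f x) (initialParser ω)))))
              (≤-trans (+-mono-≤ (*-mono-≤ (proj₁ bp) (proj₁ bp)) (fifth bp)) (≤-reflexive (+-identityʳ (M * M)))))
            l
      in _ , E , refl
      where
      fifth : ∀ {A B C D F G : Set} → A × B × C × D × F × G → F
      fifth (_ , _ , _ , _ , z , _) = z
      swap : ∀ h a r → h + (a + r) ≡ a + (h + r)
      swap = solve-∀

    complete : Problem1LogCFL (f x) →
      ∃ λ ω → ∃ λ τ → Exec program (Realise.init Control-finite program g₀ x e ω []) τ × accepts (S₂.ctl τ) ≡ true
    complete (I , eq , w , W , g) with Correct.path-choices T I (Dyck.climbable (Instance.edges I) g W) refl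
    ... | ω , loops with Correct.placed-first T I (replicate (length (Instance.edges I)) false ++ ω)
    ... | d , first≡ , at-src
      with loops d (Correct.Placed.space at-src)
             (subst (λ z → Correct.Placed T I (Instance.src I) 0 z d) (skipω-replicate (Instance.edges I) ω) at-src)
    ... | c' , l , good , h≡ , cu , vt =
      -- Padding for the first pass, which spends one choice per edge before the guessing starts.
      let ω' = replicate (length (Instance.edges I)) false ++ ω
          τ , E , ok = run ω' (subst₂ (λ y z → Loop y z c') eq
                          (trans (sym first≡) (cong (λ y → afterFirst y (initialParser ω')) eq)) l)
      in ω' , τ , E , trans ok (cong not (verdict-complete c' good h≡ (trans cu (sym vt))))

    sound : ∀ ω → ∃ λ τ → Exec program (Realise.init Control-finite program g₀ x e ω []) τ ×
      (accepts (S₂.ctl τ) ≡ true → Problem1LogCFL (f x))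
    sound ω =
      let c' , l = loop-total (f x) _ (afterFirst (f x) (initialParser ω)) ≤-refl
          τ , E , ok = run ω l
      in τ , E , λ t → conclude l (verdict-sound c' (not-true (trans (sym ok) t)))
      where
      not-true : ∀ {b} → not b ≡ true → b ≡ false
      not-true {false} _ = refl
      conclude : ∀ {c'} → Loop (f x) (afterFirst (f x) (initialParser ω)) c' → bad c' ≡ false × h c' ≡ 0 × cur c' ≡ vT c' →
        Problem1LogCFL (f x)
      conclude {c'} l (good , h≡ , cu≡) with bad (pass (f x) (initialParser ω)) in is-bad
      -- A placeholder instance, as none has been parsed here; `loop-bad` concerns only the failure
      -- flag.
      ... | true = accepted-not-bad (Correct.loop-bad T (mkInstance 1 zero zero []) l is-bad) good
      ... | false with Parsing.parse-instance (f x) (initialParser ω) refl is-bad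
      ... | I , eq = I , eq , found (Correct.loop-explored T I
              (subst (λ y → Loop y (afterFirst y (initialParser ω)) c') (sym eq) l) (Correct.first-explored T I ω))
        where
        found : Correct.Explored T I c' → YesInstance I
        found (inj₁ b) = accepted-not-bad b good
        found (inj₂ (_ , t≡ , v , v≡ , S , _)) = Dyck.yes-of-climb (Instance.edges I)
          (subst₂ (λ z k → Star (Dyck.Climb (Instance.edges I) _) (Instance.src I , 0) (z , k))
            (toℕ-injective (trans (sym v≡) (trans cu≡ t≡))) h≡ S)

OneLogCFL⇒NL : ∀ {L} → OneLogCFL L → NL L
-- In space 0 nothing is computed, so any single input refutes this case.
OneLogCFL⇒NL (f , (T , zero , computes) , _) = ⊥-elim (computes [])
OneLogCFL⇒NL {L} (f , (T , suc c , computes) , reduces) =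
  Realise.recogniser Control-finite (Recogniser.program T) g₀ accepts L (exponent + exponent)
    (λ x e lt l → At.complete x e lt (proj₁ (reduces x) l))
    (λ x e lt ω → let τ , E , imp = At.sound x e lt ω in τ , E , λ t → proj₂ (reduces x) (imp t))
  where open Decide T c f computes

theorem5 : (L : Language) → NL L ⇔ OneLogCFL L
theorem5 L = mk⇔ NL⇒OneLogCFL OneLogCFL⇒NL
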